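{- Let $M$ be a regular matroid with ground set $E$, and fix an acyclic circuit signature $\sigma$ and an acyclic cocircuit signature $\sigma^*$ of $M$. Define $\varphi_{\sigma,\sigma^*}(\overrightarrow{O})=g_{\sigma,\sigma^*}^{ -1}(\overrightarrow{O^{cp}})\cup(\biguplus_{i\in I}C_i)\setminus(\biguplus_{j\in J}C_j^*)$, where $\overrightarrow{O}$ is obtained by reversing pairwise disjoint signed circuits $\{\overrightarrow{C_i}\}_{i\in I}$ and signed cocircuits $\{\overrightarrow{C_j^*}\}_{j\in J}$ in a $(\sigma,\sigma^*)$-compatible orientation $\overrightarrow{O^{cp}}$. Then: (1) $\varphi_{\sigma,\sigma^*}$ is a bijection from the set of (discrete) orientations of $M$ to the set of subsets of $E$; (2) it restricts to a bijection from the $\sigma$-compatible orientations to the independent sets of $M$, given by $\overrightarrow{O}\mapsto g_{\sigma,\sigma^*}^{ -1}(\overrightarrow{O^{cp}})\setminus(\biguplus_{j\in J}C_j^*)$; (3) it restricts to a bijection from the $\sigma^*$-compatible orientations to the spanning sets of $M$, given by $\overrightarrow{O}\mapsto g_{\sigma,\sigma^*}^{ -1}(\overrightarrow{O^{cp}})\cup(\biguplus_{i\in I}C_i)$.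
   Context: A matroid is regular if it is represented over $\mathbb{R}$ by a totally unimodular matrix (every square submatrix has determinant $0,\pm1$); fix such a matrix $A$ of size $r\times n$ with rank $r$, columns indexed by $E$. For each circuit $C$ there are exactly two $\{0,\pm1\}$-vectors in $\ker(A)$ with support $C$, the signed circuits $\pm\overrightarrow{C}$; for each cocircuit $C^*$ exactly two $\{0,\pm1\}$-vectors in $\operatorname{im}(A^T)$ with support $C^*$, the signed cocircuits. An orientation of $M$ is a vector $\overrightarrow{O}\in\{0,1\}^E$; a signed circuit/cocircuit $v$ is "in" $\overrightarrow{O}$ if $O_e=1$ whenever $v_e=1$ and $O_e=0$ whenever $v_e=-1$; reversing it gives $\overrightarrow{O}-v$. A circuit signature $\sigma$ chooses one signed circuit $\sigma(C)$ for each circuit $C$; it is acyclic if $\sum_C a_C\sigma(C)=0$ with $a_C\ge0$ forces all $a_C=0$; an orientation is $\sigma$-compatible if every signed circuit in it lies in $\sigma$. Acyclic cocircuit signatures and $\sigma^*$-compatibility are analogous; $(\sigma,\sigma^*)$-compatible means both. For a basis $B$: $C(B,e)$ ($e\notin B$) is the fundamental circuit in $B\cup\{e\}$, $C^*(B,e)$ ($e\in B$) the fundamental cocircuit in $(E\setminus B)\cup\{e\}$. $g_{\sigma,\sigma^*}(B)$ is the orientation agreeing on each $e\notin B$ with $\sigma(C(B,e))$ and on each $e\in B$ with $\sigma^*(C^*(B,e))$; it is a bijection from bases onto $(\sigma,\sigma^*)$-compatible orientations. Every orientation is obtained from a unique $(\sigma,\sigma^*)$-compatible orientation $\overrightarrow{O^{cp}}$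 in its circuit–cocircuit reversal class by reversing pairwise disjoint signed circuits and cocircuits as in the claim (the unions of their supports being determined by $\overrightarrow{O}$). -}

module Defs where

open import Data.Nat using (ℕ; zero; suc)
open import Data.Integer using (ℤ; +_; -_; _+_; _*_; -1ℤ; 0ℤ; 1ℤ)
import Data.Integer.Properties as ℤP
open import Data.Fin using (Fin; zero; suc; punchIn)
open import Data.Bool using (Bool; true; false; not; if_then_else_)
open import Data.Vec using (Vec; lookup; tabulate; zipWith; replicate; map)
open import Data.List using (List; []; _∷_; foldr; _++_)
open import Data.List.Relation.Unary.All using (All)
open import Data.List.Relation.Unary.AllPairs using (AllPairs)
open import Data.Fin.Subset using (Subset; _∈_; _∉_; _⊆_; _⊂_; _∪_; _─_; ∁; ⁅_⁆; _∩_)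
  renaming (⊥ to ∅)
open import Data.Product using (Σ; ∃; _×_; _,_; proj₁; proj₂)
open import Data.Sum using (_⊎_)
open import Relation.Nullary using (¬_; Dec; yes; no)
open import Relation.Binary.PropositionalEquality using (_≡_; _≢_)
open import Function.Definitions using (Injective)

sumFin : ∀ {k} → (Fin k → ℤ) → ℤ
sumFin {zero}  f = 0ℤ
sumFin {suc k} f = f zero + sumFin (λ i → f (suc i))

sgn : ℕ → ℤ
sgn zero          = 1ℤ
sgn (suc zero)    = -1ℤ
sgn (suc (suc j)) = sgn j

det : ∀ k → (Fin k → Fin k → ℤ) → ℤ
det zero    M = 1ℤ
det (suc k) M = sumFin {suc k} (λ j →
  sgn (Data.Fin.toℕ j) * (M zero j * det k (λ a b → M (suc a) (punchIn j b))))

TotallyUnimodular : ∀ {r n} → (Fin r → Fin n → ℤ) → Set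
TotallyUnimodular {r} {n} A =
  ∀ k (ρ : Fin k → Fin r) (κ : Fin k → Fin n) →
  Injective _≡_ _≡_ ρ → Injective _≡_ _≡_ κ →
  let d = det k (λ a b → A (ρ a) (κ b)) in (d ≡ 0ℤ) ⊎ (d ≡ 1ℤ) ⊎ (d ≡ -1ℤ)

FullRowRank : ∀ {r n} → (Fin r → Fin n → ℤ) → Set
FullRowRank {r} {n} A =
  Σ (Fin r → Fin n) λ κ → Injective _≡_ _≡_ κ × det r (λ a b → A a (κ b)) ≢ 0ℤ

isZero : ℤ → Bool
isZero (+ zero) = true
isZero _        = false

support : ∀ {n} → Vec ℤ n → Subset n
support v = map (λ x → not (isZero x)) v

IsSignVec : ∀ {n} → Vec ℤ n → Set
IsSignVec {n} v = ∀ (e : Fin n) → (lookup v e ≡ 0ℤ) ⊎ (lookup v e ≡ 1ℤ) ⊎ (lookup v e ≡ -1ℤ)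

module Matroid {r n : ℕ} (A : Fin r → Fin n → ℤ) where

  InKer : Vec ℤ n → Set
  InKer v = ∀ (i : Fin r) → sumFin (λ j → A i j * lookup v j) ≡ 0ℤ

  -- w ∈ im(A^T) (over ℚ): d·w = A^T y for some integer d ≠ 0, integer y
  InRowSpace : Vec ℤ n → Set
  InRowSpace w = Σ ℤ λ d → d ≢ 0ℤ × Σ (Fin r → ℤ) λ y →
    ∀ (j : Fin n) → d * lookup w j ≡ sumFin (λ i → y i * A i j)

  NonZero : Vec ℤ n → Set
  NonZero v = v ≢ replicate n 0ℤ

  Dependent : Subset n → Set
  Dependent D = Σ (Vec ℤ n) λ v → InKer v × NonZero v × support v ⊆ D

  Independent : Subset n → Set
  Independent D = ¬ Dependent D

  Circuit : Subset n → Set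
  Circuit C = Dependent C × (∀ D → D ⊂ C → Independent D)

  Basis : Subset n → Set
  Basis B = Independent B × (∀ D → B ⊆ D → Independent D → D ≡ B)

  Spanning : Subset n → Set
  Spanning S = Σ (Subset n) λ B → Basis B × B ⊆ S

  CoSupported : Subset n → Set
  CoSupported D = Σ (Vec ℤ n) λ w → InRowSpace w × NonZero w × support w ⊆ D

  Cocircuit : Subset n → Set
  Cocircuit C = CoSupported C × (∀ D → D ⊂ C → ¬ CoSupported D)

  SignedCircuit : Vec ℤ n → Set
  SignedCircuit v = IsSignVec v × InKer v × Circuit (support v)

  SignedCocircuit : Vec ℤ n → Set
  SignedCocircuit w = IsSignVec w × InRowSpace w × Cocircuit (support w)

  FundCircuit : Subset n → Fin n → Subset n → Set
  FundCircuit B e C = Circuit C × C ⊆ (B ∪ ⁅ e ⁆)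

  FundCocircuit : Subset n → Fin n → Subset n → Set
  FundCocircuit B e C = Cocircuit C × C ⊆ (∁ B ∪ ⁅ e ⁆)

  CircuitSignature : (Subset n → Vec ℤ n) → Set
  CircuitSignature σ = ∀ C → Circuit C → SignedCircuit (σ C) × support (σ C) ≡ C

  CocircuitSignature : (Subset n → Vec ℤ n) → Set
  CocircuitSignature σ* = ∀ C → Cocircuit C → SignedCocircuit (σ* C) × support (σ* C) ≡ C

  linComb : (Subset n → Vec ℤ n) → List (Subset n × ℕ) → Vec ℤ n
  linComb σ = foldr (λ p acc → zipWith _+_ (map (λ x → (+ proj₂ p) * x) (σ (proj₁ p))) acc)
                    (replicate n 0ℤ)

  Acyclic : (Subset n → Vec ℤ n) → Set
  Acyclic σ = ∀ (L : List (Subset n × ℕ)) → All (λ p → Circuit (proj₁ p)) L →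
    linComb σ L ≡ replicate n 0ℤ → All (λ p → proj₂ p ≡ 0) L

  CoAcyclic : (Subset n → Vec ℤ n) → Set
  CoAcyclic σ* = ∀ (L : List (Subset n × ℕ)) → All (λ p → Cocircuit (proj₁ p)) L →
    linComb σ* L ≡ replicate n 0ℤ → All (λ p → proj₂ p ≡ 0) L

  -- Orientations: O ∈ {0,1}^E, true = 1

  Orientation : Set
  Orientation = Vec Bool n

  AgreesAt : Orientation → Fin n → Vec ℤ n → Set
  AgreesAt O e v = (lookup v e ≡ 1ℤ → lookup O e ≡ true) × (lookup v e ≡ -1ℤ → lookup O e ≡ false)

  InOri : Vec ℤ n → Orientation → Set
  InOri v O = ∀ (e : Fin n) → AgreesAt O e v

  reverse : Orientation → Vec ℤ n → Orientation
  reverse O v = zipWith (λ b x → if isZero x then b else not b) O v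

  reverseAll : Orientation → List (Vec ℤ n) → Orientation
  reverseAll O L = foldr (λ v acc → reverse acc v) O L

  unionSupp : List (Vec ℤ n) → Subset n
  unionSupp L = foldr (λ v acc → support v ∪ acc) ∅ L

  Disjoint : Vec ℤ n → Vec ℤ n → Set
  Disjoint u v = (support u ∩ support v) ≡ ∅

  module Signatures (σ σ* : Subset n → Vec ℤ n) where

    SigmaCompatible : Orientation → Set
    SigmaCompatible O = ∀ v → SignedCircuit v → InOri v O → v ≡ σ (support v)

    SigmaStarCompatible : Orientation → Set
    SigmaStarCompatible O = ∀ w → SignedCocircuit w → InOri w O → w ≡ σ* (support w)

    Compatible : Orientation → Set
    Compatible O = SigmaCompatible O × SigmaStarCompatible O

    IsG : Subset n → Orientation → Set
    IsG B O = ∀ (e : Fin n) →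
      (e ∉ B → ∀ C → FundCircuit B e C → AgreesAt O e (σ C)) ×
      (e ∈ B → ∀ C → FundCocircuit B e C → AgreesAt O e (σ* C))

    Decomposition : Orientation → Orientation → List (Vec ℤ n) → List (Vec ℤ n) → Set
    Decomposition O Ocp Ls Lc =
      Compatible Ocp ×
      All SignedCircuit Ls × All SignedCocircuit Lc ×
      All (λ v → InOri v Ocp) (Ls ++ Lc) ×
      AllPairs Disjoint (Ls ++ Lc) ×
      O ≡ reverseAll Ocp (Ls ++ Lc)

    Phi : Orientation → Subset n → Set
    Phi O X = Σ (Subset n) λ B → Σ Orientation λ Ocp →
      Σ (List (Vec ℤ n)) λ Ls → Σ (List (Vec ℤ n)) λ Lc →
      Decomposition O Ocp Ls Lc × Basis B × IsG B Ocp ×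
      X ≡ ((B ∪ unionSupp Ls) ─ unionSupp Lc)

IsBijectionRel : ∀ {X Y : Set} → (X → Y → Set) → Set
IsBijectionRel {X} {Y} R =
  (∀ x → Σ Y λ y → R x y × (∀ y' → R x y' → y' ≡ y)) ×
  (∀ y → Σ X λ x → R x y × (∀ x' → R x' y → x' ≡ x))

{-# OPTIONS --safe #-}
-- The kernel and the row space of A are orthogonal, and by total unimodularity one of them always contains a
-- vector with entry 1 at a given element that vanishes on a prescribed side of the other elements; the proof uses
-- nothing else about A, so every statement about circuits and bases dualizes. Minty's colouring lemma follows.
-- A basis together with its orientation determines a cone: a kernel vector whose signs agree with the orientation
-- off the basis is a nonnegative combination of fundamental circuits of σ, so by acyclicity a vector cannot agree
-- with one such pair while its negative agrees with another. Applied to vectors given by Minty's lemma this shows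
-- that two bases whose orientations agree on their symmetric difference coincide; deleting and contracting the
-- elements one at a time then shows that every compatible orientation comes from a basis. Applied to the difference
-- of the sums of the reversed circuits (and dually of the cocircuits) it shows that φ is single-valued and injective,
-- hence bijective, the number of orientations being that of subsets. Reversing a circuit that is not in σ moves the
-- orientation along the acyclic cone of σ, so repeated reversal stops.
module Submission where

open import Defs
open import Data.Nat as ℕ using (ℕ; zero; suc)
import Data.Nat.Properties as ℕP
open import Data.Integer using (ℤ; +_; -[1+_]; +[1+_]; ∣_∣; -_; _+_; _*_; _-_; _≤_; -1ℤ; 0ℤ; 1ℤ; +≤+)
import Data.Integer.Properties as ℤP
open import Data.Integer.Tactic.RingSolver using (solve-∀)
open import Data.Fin using (Fin; zero; suc; toℕ; inject₁; punchIn; combine; finToFun; funToFin)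
import Data.Fin.Induction as FI
import Data.Fin.Properties as FP
open import Data.Bool using (Bool; true; false; not; _∧_; _∨_; _xor_; if_then_else_)
import Data.Bool.Properties as BP
open import Data.Vec using (Vec; []; _∷_; lookup; tabulate; replicate)
import Data.Vec.Properties as VP
open import Data.List as List using (List; []; _∷_)
open import Data.List.Membership.Propositional using () renaming (_∈_ to _∈ˡ_)
open import Data.List.Membership.Propositional.Properties using (∈-allFin)
open import Data.List.Relation.Unary.Any as Any using (Any; here; there)
open import Data.List.Relation.Unary.All as All using (All; []; _∷_)
import Data.List.Relation.Unary.All.Properties as AllP
open import Data.List.Relation.Unary.AllPairs as AllPairs using (AllPairs; []; _∷_)
import Data.List.Relation.Unary.AllPairs.Properties as AllPairsP
import Data.List.Relation.Unary.Any.Properties as AnyP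
open import Data.Fin.Subset using (Subset; _∈_; _∉_; _⊆_; _⊂_; _∪_; _─_; ∁; ⁅_⁆)
import Data.Fin.Subset.Properties as SP
open import Data.Product using (Σ; _×_; _,_; proj₁; proj₂)
open import Data.Sum using (_⊎_; inj₁; inj₂)
open import Data.Empty using (⊥; ⊥-elim)
open import Data.Unit using (⊤; tt)
open import Relation.Nullary using (¬_; Dec; yes; no; ¬?; _×-dec_)
open import Relation.Nullary.Decidable using (decidable-stable)
open import Relation.Binary.PropositionalEquality using (_≡_; _≢_; refl; sym; trans; cong; cong₂; subst; isEquivalence; module ≡-Reasoning)
open import Function.Definitions using (Injective)
open import Function.Bundles using (_⇔_; mk⇔; Inverse)
open import Induction.WellFounded using (WellFounded; Acc; acc)

-- Determinants

-- Minors of the matroid are never formed. A `Pattern` puts a constraint on each entry: `none`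
-- (zero: the element is deleted), `any` (free: it is contracted) or `one b` (weakly of sign `b`).
-- Duality exchanges `none` and `any`, and every use of Minty's lemma is a choice of patterns. The
-- lists of reversed circuits and cocircuits are awkward to compare, and one union of supports may
-- split into circuits in several ways. Since the listed vectors are disjoint and lie in the
-- compatible orientation, nothing cancels in their sums: the sum of the circuits and that of the
-- cocircuits determine both the reversal and the set added to or removed from the basis. So φ is
-- studied through these two vectors, with one `Cell` per element; the lists are met only in passing
-- to and from `Phi`. The relation `Phi` leaves the compatible orientation, the basis and the lists
-- open. Single-valuedness therefore compares two unrelated choices, and its proof contains the
-- uniqueness of the compatible orientation reached from `O`.

sumFin-cong : ∀ {k} {f g : Fin k → ℤ} → (∀ i → f i ≡ g i) → sumFin f ≡ sumFin g
sumFin-cong {zero}  h = refl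
sumFin-cong {suc k} h = cong₂ _+_ (h zero) (sumFin-cong (λ i → h (suc i)))

sumFin-+ : ∀ {k} (f g : Fin k → ℤ) → sumFin (λ i → f i + g i) ≡ sumFin f + sumFin g
sumFin-+ {zero}  f g = refl
sumFin-+ {suc k} f g =
  trans (cong (_+_ (f zero + g zero)) (sumFin-+ (λ i → f (suc i)) (λ i → g (suc i))))
        (interchange (f zero) (g zero) _ _)
  where
  interchange : ∀ a b c d → (a + b) + (c + d) ≡ (a + c) + (b + d)
  interchange = solve-∀

sumFin-* : ∀ {k} c (f : Fin k → ℤ) → sumFin (λ i → c * f i) ≡ c * sumFin f
sumFin-* {zero}  c f = sym (ℤP.*-zeroʳ c)
sumFin-* {suc k} c f =
  trans (cong (_+_ (c * f zero)) (sumFin-* c (λ i → f (suc i)))) (sym (ℤP.*-distribˡ-+ c _ _))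

sumFin-0 : ∀ {k} {f : Fin k → ℤ} → (∀ i → f i ≡ 0ℤ) → sumFin f ≡ 0ℤ
sumFin-0 {zero}  h = refl
sumFin-0 {suc k} h = cong₂ _+_ (h zero) (sumFin-0 (λ i → h (suc i)))

sumFin-swap : ∀ {k l} (f : Fin k → Fin l → ℤ) →
  sumFin (λ i → sumFin (f i)) ≡ sumFin (λ j → sumFin (λ i → f i j))
sumFin-swap {zero} {l} f = sym (sumFin-0 {l} (λ _ → refl))
sumFin-swap {suc k} f =
  trans (cong (_+_ (sumFin (f zero))) (sumFin-swap (λ i → f (suc i))))
        (sym (sumFin-+ (f zero) (λ j → sumFin (λ i → f (suc i) j))))

sgn-suc : ∀ j → sgn (suc j) ≡ - sgn j
sgn-suc zero          = refl
sgn-suc (suc zero)    = refl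
sgn-suc (suc (suc j)) = sgn-suc j

Matrix : ℕ → Set
Matrix k = Fin k → Fin k → ℤ

det-cong : ∀ k {M N : Matrix k} → (∀ i j → M i j ≡ N i j) → det k M ≡ det k N
det-cong zero    h = refl
det-cong (suc k) h = sumFin-cong λ j → cong (sgn (toℕ j) *_)
  (cong₂ _*_ (h zero j) (det-cong k λ a b → h (suc a) (punchIn j b)))

-- Both expansions agree on the corner entry, and expanding the remaining terms once more yields
-- the same double sum over the (suc a, suc j) minors.
det-column : ∀ k (M : Matrix (suc k)) →
  det (suc k) M ≡ sumFin (λ a → sgn (toℕ a) * (M a zero * det k (λ x y → M (punchIn a x) (suc y))))
det-column zero    M = refl
det-column (suc k) M = cong (_+_ (sgn 0 * (M zero zero * det (suc k) (λ x y → M (suc x) (suc y))))) (begin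
  sumFin (λ j → sgn (suc (toℕ j)) * (M zero (suc j) *
    det (suc k) (λ x y → M (suc x) (punchIn (suc j) y))))
    ≡⟨ sumFin-cong (λ j → cong (λ z → sgn (suc (toℕ j)) * (M zero (suc j) * z))
         (det-column k (λ x y → M (suc x) (punchIn (suc j) y)))) ⟩
  sumFin (λ j → sgn (suc (toℕ j)) * (M zero (suc j) *
    sumFin (λ a → sgn (toℕ a) * (M (suc a) zero * D a j))))
    ≡⟨ sumFin-cong (λ j → push (sgn (suc (toℕ j))) (M zero (suc j)) (λ a → sgn (toℕ a) * (M (suc a) zero * D a j))) ⟩
  sumFin (λ j → sumFin (λ a → sgn (suc (toℕ j)) * (M zero (suc j) *
    (sgn (toℕ a) * (M (suc a) zero * D a j)))))
    ≡⟨ sumFin-swap (λ j a → sgn (suc (toℕ j)) * (M zero (suc j) *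
         (sgn (toℕ a) * (M (suc a) zero * D a j)))) ⟩
  sumFin (λ a → sumFin (λ j → sgn (suc (toℕ j)) * (M zero (suc j) *
    (sgn (toℕ a) * (M (suc a) zero * D a j)))))
    ≡⟨ sumFin-cong (λ a → sumFin-cong (λ j → exchange a j)) ⟩
  sumFin (λ a → sumFin (λ j → sgn (suc (toℕ a)) * (M (suc a) zero *
    (sgn (toℕ j) * (M zero (suc j) * D a j)))))
    ≡⟨ sumFin-cong (λ a → sym (push (sgn (suc (toℕ a))) (M (suc a) zero) (λ j → sgn (toℕ j) * (M zero (suc j) * D a j)))) ⟩
  sumFin (λ a → sgn (suc (toℕ a)) * (M (suc a) zero *
    det (suc k) (λ x y → M (punchIn (suc a) x) (suc y)))) ∎)
  where
  open ≡-Reasoning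
  D : Fin (suc k) → Fin (suc k) → ℤ
  D a j = det k (λ x y → M (suc (punchIn a x)) (suc (punchIn j y)))

  push : ∀ {l} p q (f : Fin l → ℤ) → p * (q * sumFin f) ≡ sumFin (λ i → p * (q * f i))
  push p q f = sym (trans (sumFin-* p (λ i → q * f i)) (cong (p *_) (sumFin-* q f)))

  rearrange : ∀ s t p q d → (- s) * (p * (t * (q * d))) ≡ (- t) * (q * (s * (p * d)))
  rearrange = solve-∀

  exchange : ∀ a j → sgn (suc (toℕ j)) * (M zero (suc j) * (sgn (toℕ a) * (M (suc a) zero * D a j)))
                   ≡ sgn (suc (toℕ a)) * (M (suc a) zero * (sgn (toℕ j) * (M zero (suc j) * D a j)))
  exchange a j rewrite sgn-suc (toℕ j) | sgn-suc (toℕ a) =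
    rearrange (sgn (toℕ j)) (sgn (toℕ a)) (M zero (suc j)) (M (suc a) zero) (D a j)

det-transpose : ∀ k (M : Matrix k) → det k M ≡ det k (λ i j → M j i)
det-transpose zero    M = refl
det-transpose (suc k) M = trans (det-column k M) (sumFin-cong λ a →
  cong (λ z → sgn (toℕ a) * (M a zero * z)) (det-transpose k (λ x y → M (punchIn a x) (suc y))))

swapAdjacent : ∀ {k} → Fin k → Fin (suc k) → Fin (suc k)
swapAdjacent zero    zero          = suc zero
swapAdjacent zero    (suc zero)    = zero
swapAdjacent zero    (suc (suc x)) = suc (suc x)
swapAdjacent (suc p) zero          = zero
swapAdjacent (suc p) (suc x)       = suc (swapAdjacent p x)

-- A swap below the first row passes into the minors of the first-row expansion. A swap of the first
-- two rows is read off the first-column expansion: the two leading terms change places, where `sgn`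
-- differs, and every later minor still contains both rows.
det-swapAdjacent : ∀ {k} (p : Fin k) (M : Matrix (suc k)) →
  det (suc k) (λ i → M (swapAdjacent p i)) ≡ - det (suc k) M
det-swapAdjacent {suc k} (suc p) M = trans
  (sumFin-cong λ j → trans
    (cong (λ z → sgn (toℕ j) * (M zero j * z)) (det-swapAdjacent p (λ x y → M (suc x) (punchIn j y))))
    (negate (sgn (toℕ j)) (M zero j) _))
  (trans (sumFin-* -1ℤ (λ j → sgn (toℕ j) * (M zero j * det (suc k) (λ x y → M (suc x) (punchIn j y)))))
    (ℤP.-1*i≡-i _))
  where
  negate : ∀ s m d → s * (m * (- d)) ≡ -1ℤ * (s * (m * d))
  negate = solve-∀
det-swapAdjacent {suc k} zero M = begin
  det (2 ℕ.+ k) M′                                ≡⟨ det-column (suc k) M′ ⟩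
  col M′ zero + (col M′ (suc zero) + rest M′)     ≡⟨ cong₂ _+_ first (cong₂ _+_ second tail) ⟩
  - col M (suc zero) + (- col M zero + - rest M)  ≡⟨ collect (col M zero) (col M (suc zero)) (rest M) ⟩
  - (col M zero + (col M (suc zero) + rest M))    ≡⟨ cong -_ (sym (det-column (suc k) M)) ⟩
  - det (2 ℕ.+ k) M ∎
  where
  open ≡-Reasoning
  M′ : Matrix (2 ℕ.+ k)
  M′ i = M (swapAdjacent zero i)
  minor : Matrix (2 ℕ.+ k) → Fin (2 ℕ.+ k) → Matrix (suc k)
  minor N a x y = N (punchIn a x) (suc y)
  col : Matrix (2 ℕ.+ k) → Fin (2 ℕ.+ k) → ℤ
  col N a = sgn (toℕ a) * (N a zero * det (suc k) (minor N a))
  rest : Matrix (2 ℕ.+ k) → ℤ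
  rest N = sumFin (λ a → col N (suc (suc a)))
  collect : ∀ a b c → - b + (- a + - c) ≡ - (a + (b + c))
  collect = solve-∀
  flip+ : ∀ m d → 1ℤ * (m * d) ≡ - (-1ℤ * (m * d))
  flip+ = solve-∀
  flip- : ∀ m d → -1ℤ * (m * d) ≡ - (1ℤ * (m * d))
  flip- = solve-∀
  flip : ∀ s m d → s * (m * (- d)) ≡ -1ℤ * (s * (m * d))
  flip = solve-∀
  first : col M′ zero ≡ - col M (suc zero)
  first = trans (cong (λ z → 1ℤ * (M (suc zero) zero * z))
      (det-cong (suc k) {minor M′ zero} {minor M (suc zero)} λ { zero y → refl ; (suc x) y → refl }))
    (flip+ (M (suc zero) zero) _)
  second : col M′ (suc zero) ≡ - col M zero
  second = trans (cong (λ z → -1ℤ * (M zero zero * z))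
      (det-cong (suc k) {minor M′ (suc zero)} {minor M zero} λ { zero y → refl ; (suc x) y → refl }))
    (flip- (M zero zero) _)
  step : ∀ {k} (N : Matrix (2 ℕ.+ k)) (a : Fin k) →
    det (suc k) (λ x y → N (swapAdjacent zero (punchIn (suc (suc a)) x)) (suc y)) ≡
    - det (suc k) (λ x y → N (punchIn (suc (suc a)) x) (suc y))
  step {suc k} N a = trans
    (det-cong (2 ℕ.+ k) {λ x y → N (swapAdjacent zero (punchIn (suc (suc a)) x)) (suc y)}
      {λ x y → N (punchIn (suc (suc a)) (swapAdjacent zero x)) (suc y)} λ { zero y → refl ; (suc zero) y → refl ; (suc (suc x)) y → refl })
    (det-swapAdjacent zero (λ x y → N (punchIn (suc (suc a)) x) (suc y)))
  tail : rest M′ ≡ - rest M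
  tail = trans
    (sumFin-cong λ a → trans
      (cong (λ z → sgn (toℕ a) * (M (suc (suc a)) zero * z)) (step M a))
      (flip (sgn (toℕ a)) (M (suc (suc a)) zero) _))
    (trans (sumFin-* -1ℤ (λ a → col M (suc (suc a)))) (ℤP.-1*i≡-i _))

self-negative⇒0 : ∀ x → x ≡ - x → x ≡ 0ℤ
self-negative⇒0 (+ zero) _ = refl
self-negative⇒0 +[1+ m ] ()
self-negative⇒0 -[1+ m ] ()

-- If the equal rows are neighbours, swapping them gives `d ≡ - d`. A more distant copy is moved up
-- by adjacent swaps, each of which only changes the sign.
det-repeatedRow : ∀ k (M : Matrix (suc k)) (a : Fin k) → (∀ j → M zero j ≡ M (suc a) j) → det (suc k) M ≡ 0ℤ
det-repeatedRow (suc k) M a = FI.<-weakInduction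
  (λ a → ∀ M → (∀ j → M zero j ≡ M (suc a) j) → det (2 ℕ.+ k) M ≡ 0ℤ) adjacent further a M
  where
  adjacent : ∀ M → (∀ j → M zero j ≡ M (suc zero) j) → det (2 ℕ.+ k) M ≡ 0ℤ
  adjacent M h = self-negative⇒0 _ (trans
    (det-cong (2 ℕ.+ k) {M} {λ i → M (swapAdjacent zero i)} λ { zero j → h j ; (suc zero) j → sym (h j) ; (suc (suc i)) j → refl })
    (det-swapAdjacent zero M))
  swap-inject₁ : ∀ {k} (a : Fin k) → swapAdjacent a (inject₁ a) ≡ suc a
  swap-inject₁ zero    = refl
  swap-inject₁ (suc a) = cong suc (swap-inject₁ a)
  further : ∀ (a : Fin k) →
    (∀ M → (∀ j → M zero j ≡ M (suc (inject₁ a)) j) → det (2 ℕ.+ k) M ≡ 0ℤ) →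
    ∀ M → (∀ j → M zero j ≡ M (suc (suc a)) j) → det (2 ℕ.+ k) M ≡ 0ℤ
  further a ih M h = trans
    (sym (ℤP.neg-involutive _))
    (cong -_ (trans (sym (det-swapAdjacent (suc a) M))
      (ih (λ i → M (swapAdjacent (suc a) i))
        (λ j → trans (h j) (cong (λ x → M (suc x) j) (sym (swap-inject₁ a)))))))

det-repeatedColumn : ∀ k (M : Matrix (suc k)) (b : Fin k) → (∀ i → M i zero ≡ M i (suc b)) → det (suc k) M ≡ 0ℤ
det-repeatedColumn k M b h = trans (det-transpose (suc k) M) (det-repeatedRow k (λ i j → M j i) b h)

-- Kernel and row space of a totally unimodular matrix

sumFin-single : ∀ {k} {f : Fin k → ℤ} e → (∀ i → i ≢ e → f i ≡ 0ℤ) → sumFin f ≡ f e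
sumFin-single {suc k} {f} zero    h =
  trans (cong (_+_ (f zero)) (sumFin-0 (λ i → h (suc i) λ ()))) (ℤP.+-identityʳ _)
sumFin-single {suc k} {f} (suc e) h =
  trans (cong₂ _+_ (h zero λ ()) (sumFin-single e (λ i i≢e → h (suc i) λ eq → i≢e (FP.suc-injective eq))))
        (ℤP.+-identityˡ _)

δ : ∀ {k} → Fin k → Fin k → ℤ
δ x y with x FP.≟ y
... | yes _ = 1ℤ
... | no  _ = 0ℤ

δ-diag : ∀ {k} (x : Fin k) → δ x x ≡ 1ℤ
δ-diag x with x FP.≟ x
... | yes _  = refl
... | no x≢x = ⊥-elim (x≢x refl)

δ-off : ∀ {k} {x y : Fin k} → x ≢ y → δ x y ≡ 0ℤ
δ-off {x = x} {y} x≢y with x FP.≟ y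
... | yes x≡y = ⊥-elim (x≢y x≡y)
... | no _    = refl

sumFin-δ : ∀ {k} (g : Fin k → ℤ) x → sumFin (λ y → g y * δ x y) ≡ g x
sumFin-δ g x = trans
  (sumFin-single x λ y y≢x → trans (cong (_*_ (g y)) (δ-off (λ x≡y → y≢x (sym x≡y)))) (ℤP.*-zeroʳ (g y)))
  (trans (cong (_*_ (g x)) (δ-diag x)) (ℤP.*-identityʳ (g x)))

unit-square : ∀ {x} → (x ≡ 0ℤ) ⊎ (x ≡ 1ℤ) ⊎ (x ≡ -1ℤ) → x ≢ 0ℤ → x * x ≡ 1ℤ
unit-square (inj₁ x≡0)          x≢0 = ⊥-elim (x≢0 x≡0)
unit-square (inj₂ (inj₁ refl)) _   = refl
unit-square (inj₂ (inj₂ refl)) _   = refl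

cons : ∀ {k} {X : Set} → X → (Fin k → X) → Fin (suc k) → X
cons x f zero    = x
cons x f (suc i) = f i

cons-injective : ∀ {k} {X : Set} {x : X} {f : Fin k → X} →
  (∀ i → x ≢ f i) → Injective _≡_ _≡_ f → Injective _≡_ _≡_ (cons x f)
cons-injective fresh inj {zero}  {zero}  eq = refl
cons-injective fresh inj {zero}  {suc j} eq = ⊥-elim (fresh j eq)
cons-injective fresh inj {suc i} {zero}  eq = ⊥-elim (fresh i (sym eq))
cons-injective fresh inj {suc i} {suc j} eq = cong suc (inj eq)

module _ {r n : ℕ} (A : Fin r → Fin n → ℤ) where

  Kernel : (Fin n → ℤ) → Set
  Kernel v = ∀ i → sumFin (λ j → A i j * v j) ≡ 0ℤ

  RowSpan : (Fin n → ℤ) → Set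
  RowSpan w = Σ ℤ λ d → d ≢ 0ℤ × Σ (Fin r → ℤ) λ y →
    ∀ (j : Fin n) → d * w j ≡ sumFin (λ i → y i * A i j)

  Kernel-+ : ∀ {u v} → Kernel u → Kernel v → Kernel (λ e → u e + v e)
  Kernel-+ {u} {v} ku kv i = trans (sumFin-cong λ j → ℤP.*-distribˡ-+ (A i j) (u j) (v j))
    (trans (sumFin-+ (λ j → A i j * u j) (λ j → A i j * v j)) (cong₂ _+_ (ku i) (kv i)))

  Kernel-* : ∀ c {u} → Kernel u → Kernel (λ e → c * u e)
  Kernel-* c {u} ku i = trans (sumFin-cong λ j → move (A i j) c (u j))
    (trans (sumFin-* c (λ j → A i j * u j)) (trans (cong (_*_ c) (ku i)) (ℤP.*-zeroʳ c)))
    where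
    move : ∀ a c u → a * (c * u) ≡ c * (a * u)
    move = solve-∀

  Kernel-cong : ∀ {u v} → (∀ e → u e ≡ v e) → Kernel u → Kernel v
  Kernel-cong h ku i = trans (sumFin-cong λ j → cong (_*_ (A i j)) (sym (h j))) (ku i)

  RowSpan-+ : ∀ {u v} → RowSpan u → RowSpan v → RowSpan (λ e → u e + v e)
  RowSpan-+ {u} {v} (d , d≢0 , y , p) (d′ , d′≢0 , y′ , p′) =
    d * d′ , nonzero , (λ i → d′ * y i + d * y′ i) , λ j → begin
      d * d′ * (u j + v j)
        ≡⟨ split d d′ (u j) (v j) ⟩
      d′ * (d * u j) + d * (d′ * v j)
        ≡⟨ cong₂ (λ a b → d′ * a + d * b) (p j) (p′ j) ⟩
      d′ * sumFin (λ i → y i * A i j) + d * sumFin (λ i → y′ i * A i j)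
        ≡⟨ sym (cong₂ _+_ (sumFin-* d′ (λ i → y i * A i j)) (sumFin-* d (λ i → y′ i * A i j))) ⟩
      sumFin (λ i → d′ * (y i * A i j)) + sumFin (λ i → d * (y′ i * A i j))
        ≡⟨ sym (sumFin-+ (λ i → d′ * (y i * A i j)) (λ i → d * (y′ i * A i j))) ⟩
      sumFin (λ i → d′ * (y i * A i j) + d * (y′ i * A i j))
        ≡⟨ sumFin-cong (λ i → join d d′ (y i) (y′ i) (A i j)) ⟩
      sumFin (λ i → (d′ * y i + d * y′ i) * A i j) ∎
    where
    open ≡-Reasoning
    split : ∀ d d′ u v → d * d′ * (u + v) ≡ d′ * (d * u) + d * (d′ * v)
    split = solve-∀
    join : ∀ d d′ y y′ a → d′ * (y * a) + d * (y′ * a) ≡ (d′ * y + d * y′) * a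
    join = solve-∀
    nonzero : d * d′ ≢ 0ℤ
    nonzero eq with ℤP.i*j≡0⇒i≡0∨j≡0 d eq
    ... | inj₁ z = d≢0 z
    ... | inj₂ z = d′≢0 z

  RowSpan-* : ∀ c {u} → RowSpan u → RowSpan (λ e → c * u e)
  RowSpan-* c {u} (d , d≢0 , y , p) = d , d≢0 , (λ i → c * y i) , λ j →
    trans (move d c (u j)) (trans (cong (_*_ c) (p j))
      (trans (sym (sumFin-* c (λ i → y i * A i j))) (sumFin-cong λ i → sym (ℤP.*-assoc c (y i) (A i j)))))
    where
    move : ∀ a c u → a * (c * u) ≡ c * (a * u)
    move = solve-∀

  RowSpan-cong : ∀ {u v} → (∀ e → u e ≡ v e) → RowSpan u → RowSpan v
  RowSpan-cong h (d , d≢0 , y , p) = d , d≢0 , y , λ j → trans (cong (_*_ d) (sym (h j))) (p j)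

  RowSpan-row : ∀ i → RowSpan (A i)
  RowSpan-row i = 1ℤ , (λ ()) , δ i , λ j → trans (ℤP.*-identityˡ _)
    (sym (trans (sumFin-cong λ l → ℤP.*-comm (δ i l) (A l j)) (sumFin-δ (λ l → A l j) i)))

  RowSpan-sum : ∀ {k} (w : Fin k → Fin n → ℤ) → (∀ a → RowSpan (w a)) → RowSpan (λ e → sumFin (λ a → w a e))
  RowSpan-sum {zero}  w h = 1ℤ , (λ ()) , (λ _ → 0ℤ) , λ j → sym (sumFin-0 {r} λ _ → refl)
  RowSpan-sum {suc k} w h = RowSpan-+ (h zero) (RowSpan-sum (λ a → w (suc a)) (λ a → h (suc a)))

  Kernel⊥RowSpan : ∀ {v w} → Kernel v → RowSpan w → sumFin (λ e → v e * w e) ≡ 0ℤ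
  Kernel⊥RowSpan {v} {w} kv (d , d≢0 , y , p) = cancel (begin
    d * sumFin (λ e → v e * w e)
      ≡⟨ sym (sumFin-* d (λ e → v e * w e)) ⟩
    sumFin (λ e → d * (v e * w e))
      ≡⟨ sumFin-cong (λ e → trans (move d (v e) (w e)) (cong (_*_ (v e)) (p e))) ⟩
    sumFin (λ e → v e * sumFin (λ i → y i * A i e))
      ≡⟨ sumFin-cong (λ e → sym (sumFin-* (v e) (λ i → y i * A i e))) ⟩
    sumFin (λ e → sumFin (λ i → v e * (y i * A i e)))
      ≡⟨ sumFin-swap (λ e i → v e * (y i * A i e)) ⟩
    sumFin (λ i → sumFin (λ e → v e * (y i * A i e)))
      ≡⟨ sumFin-cong (λ i → trans (sumFin-cong λ e → regroup (v e) (y i) (A i e))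
           (trans (sumFin-* (y i) (λ e → A i e * v e))
             (trans (cong (_*_ (y i)) (kv i)) (ℤP.*-zeroʳ (y i))))) ⟩
    sumFin {r} (λ i → 0ℤ)
      ≡⟨ sumFin-0 {r} (λ _ → refl) ⟩
    0ℤ ∎)
    where
    open ≡-Reasoning
    move : ∀ d v w → d * (v * w) ≡ v * (d * w)
    move = solve-∀
    regroup : ∀ v y a → v * (y * a) ≡ y * (a * v)
    regroup = solve-∀
    cancel : ∀ {x} → d * x ≡ 0ℤ → x ≡ 0ℤ
    cancel eq with ℤP.i*j≡0⇒i≡0∨j≡0 d eq
    ... | inj₁ z = ⊥-elim (d≢0 z)
    ... | inj₂ z = z

  module _ {k} (ρ : Fin k → Fin r) (κ : Fin k → Fin n) where

    minor : ℤ
    minor = det k (λ a b → A (ρ a) (κ b))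

    -- The chosen minor enlarged by row `i` and column `f`. As a function of `f` it is a combination
    -- of rows of `A`, by expansion along the new column; as a function of `i` it is a combination
    -- of columns, by expansion along the new row.
    border : Fin r → Fin n → ℤ
    border i f = det (suc k) (λ a b → A (cons i ρ a) (cons f κ b))

    border-RowSpan : ∀ i → RowSpan (border i)
    border-RowSpan i = RowSpan-cong (λ f → trans
        (sumFin-cong λ a → regroup (sgn (toℕ a)) (cofactor a) (A (cons i ρ a) f))
        (sym (det-column k (λ a b → A (cons i ρ a) (cons f κ b)))))
      (RowSpan-sum (λ a f → (sgn (toℕ a) * cofactor a) * A (cons i ρ a) f)
        (λ a → RowSpan-* (sgn (toℕ a) * cofactor a) (RowSpan-row (cons i ρ a))))
      where
      cofactor : Fin (suc k) → ℤ
      cofactor a = det k (λ x y → A (cons i ρ (punchIn a x)) (κ y))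
      regroup : ∀ s c a → (s * c) * a ≡ s * (a * c)
      regroup = solve-∀

    -- Cramer's rule. The cofactors along the new row do not depend on `i`, so placing them at the
    -- columns `cons f κ` gives a vector whose product with row `i` is `border i f`. The cofactor at
    -- `f` is the old minor. Summing against `δ` places the cofactors without inverting `κ`.
    border-kernel : ∀ f → (∀ i → border i f ≡ 0ℤ) → (∀ b → κ b ≢ f) →
      Σ (Fin n → ℤ) λ v → Kernel v × v f ≡ minor × (∀ g → f ≢ g → (∀ b → κ b ≢ g) → v g ≡ 0ℤ)
    border-kernel f vanish fresh = v , kernel , at-f , off
      where
      open ≡-Reasoning
      κ′ : Fin (suc k) → Fin n
      κ′ = cons f κ
      cofactor : Fin (suc k) → ℤ
      cofactor b = sgn (toℕ b) * det k (λ x y → A (ρ x) (κ′ (punchIn b y)))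
      v : Fin n → ℤ
      v g = sumFin (λ b → cofactor b * δ (κ′ b) g)
      regroup : ∀ a c d → a * (c * d) ≡ c * (a * d)
      regroup = solve-∀
      expand : ∀ s m d → (s * d) * m ≡ s * (m * d)
      expand = solve-∀
      kernel : Kernel v
      kernel i = begin
        sumFin (λ g → A i g * v g)
          ≡⟨ sumFin-cong (λ g → trans (sym (sumFin-* (A i g) (λ b → cofactor b * δ (κ′ b) g)))
               (sumFin-cong λ b → regroup (A i g) (cofactor b) (δ (κ′ b) g))) ⟩
        sumFin (λ g → sumFin (λ b → cofactor b * (A i g * δ (κ′ b) g)))
          ≡⟨ sumFin-swap (λ g b → cofactor b * (A i g * δ (κ′ b) g)) ⟩
        sumFin (λ b → sumFin (λ g → cofactor b * (A i g * δ (κ′ b) g)))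
          ≡⟨ sumFin-cong (λ b → trans (sumFin-* (cofactor b) (λ g → A i g * δ (κ′ b) g))
               (cong (_*_ (cofactor b)) (sumFin-δ (A i) (κ′ b)))) ⟩
        sumFin (λ b → cofactor b * A i (κ′ b))
          ≡⟨ sumFin-cong (λ b → expand (sgn (toℕ b)) (A i (κ′ b))
               (det k (λ x y → A (ρ x) (κ′ (punchIn b y))))) ⟩
        border i f
          ≡⟨ vanish i ⟩
        0ℤ ∎
      term-0 : ∀ b {g} → κ′ b ≢ g → cofactor b * δ (κ′ b) g ≡ 0ℤ
      term-0 b ne = trans (cong (_*_ (cofactor b)) (δ-off ne)) (ℤP.*-zeroʳ (cofactor b))
      at-f : v f ≡ minor
      at-f = trans (sumFin-single {f = λ b → cofactor b * δ (κ′ b) f} zero λ { zero ne → ⊥-elim (ne refl) ; (suc b) _ → term-0 (suc b) (fresh b) })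
        (trans (cong (_*_ (cofactor zero)) (δ-diag f)) (trans (ℤP.*-identityʳ (cofactor zero)) (ℤP.*-identityˡ minor)))
      off : ∀ g → f ≢ g → (∀ b → κ b ≢ g) → v g ≡ 0ℤ
      off g f≢g out = sumFin-0 {f = λ b → cofactor b * δ (κ′ b) g} λ { zero → term-0 zero f≢g ; (suc b) → term-0 (suc b) (out b) }

  MaximalMinor : (Fin n → Bool) → Set
  MaximalMinor D = Σ ℕ λ k → Σ (Fin k → Fin r) λ ρ → Σ (Fin k → Fin n) λ κ →
    Injective _≡_ _≡_ ρ × Injective _≡_ _≡_ κ × minor ρ κ ≢ 0ℤ × (∀ b → D (κ b) ≡ true) ×
    (∀ i f → D f ≡ true → border ρ κ i f ≡ 0ℤ)

  border-rows : ∀ {k} {ρ : Fin k → Fin r} {κ i f} →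
    Injective _≡_ _≡_ ρ → border ρ κ i f ≢ 0ℤ → Injective _≡_ _≡_ (cons i ρ)
  border-rows {k} {ρ} {κ} {i} {f} inj nz = cons-injective
    (λ a i≡ρa → nz (det-repeatedRow k (λ a b → A (cons i ρ a) (cons f κ b)) a (λ j → cong (λ l → A l (cons f κ j)) i≡ρa)))
    inj

  border-columns : ∀ {k} {ρ : Fin k → Fin r} {κ i f} →
    Injective _≡_ _≡_ κ → border ρ κ i f ≢ 0ℤ → Injective _≡_ _≡_ (cons f κ)
  border-columns {k} {ρ} {κ} {i} {f} inj nz = cons-injective
    (λ b f≡κb → nz (det-repeatedColumn k (λ a b → A (cons i ρ a) (cons f κ b)) b (λ j → cong (A (cons i ρ j)) f≡κb)))
    inj

  -- Growth starts from the empty minor, whose determinant is 1, and adds any nonvanishing border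
  -- inside `D`. Its rows stay distinct because a repeated row makes the border vanish, so at most
  -- `r` enlargements occur; this is the fuel.
  maximalMinor : ∀ D → MaximalMinor D
  maximalMinor D = grow r (λ ()) (λ ()) (ℕP.m≤m+n r 0) (λ { {()} }) (λ { {()} }) (λ ()) (λ ())
    where
    grow : ∀ fuel {k} (ρ : Fin k → Fin r) (κ : Fin k → Fin n) → r ℕ.≤ fuel ℕ.+ k →
      Injective _≡_ _≡_ ρ → Injective _≡_ _≡_ κ → minor ρ κ ≢ 0ℤ → (∀ b → D (κ b) ≡ true) → MaximalMinor D
    grow fuel {k} ρ κ bound injρ injκ nz inD
      with FP.any? (λ i → FP.any? (λ f → (D f BP.≟ true) ×-dec ¬? (border ρ κ i f ℤP.≟ 0ℤ)))
    ... | no none = k , ρ , κ , injρ , injκ , nz , inD , λ i f Df →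
      decidable-stable (border ρ κ i f ℤP.≟ 0ℤ) (λ b≢0 → none (i , f , Df , b≢0))
    ... | yes (i , f , Df , b≢0) with fuel
    ...   | zero = ⊥-elim (ℕP.<⇒≱ (FP.injective⇒≤ (border-rows injρ b≢0)) bound)
    ...   | suc fuel′ = grow fuel′ (cons i ρ) (cons f κ) (subst (r ℕ.≤_) (sym (ℕP.+-suc fuel′ k)) bound)
      (border-rows injρ b≢0) (border-columns injκ b≢0) b≢0
      λ { zero → Df ; (suc b) → inD b }

  module _ (tu : TotallyUnimodular A) where

    -- A maximal minor within `D` is bordered by column `e`. A nonzero border yields a row-space
    -- vector that vanishes on `D` by maximality; if all borders vanish, Cramer's rule yields a
    -- kernel vector. By total unimodularity the entry at `e` is 1 or -1, and multiplying by it once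
    -- more makes it 1.
    kernel-or-rowSpan : ∀ (D : Fin n → Bool) e → D e ≡ false →
      (Σ (Fin n → ℤ) λ v → Kernel v × v e ≡ 1ℤ × (∀ f → f ≢ e → D f ≡ false → v f ≡ 0ℤ)) ⊎
      (Σ (Fin n → ℤ) λ w → RowSpan w × w e ≡ 1ℤ × (∀ f → D f ≡ true → w f ≡ 0ℤ))
    kernel-or-rowSpan D e De with maximalMinor D
    ... | k , ρ , κ , injρ , injκ , nz , inD , maximal
      with FP.any? (λ i → ¬? (border ρ κ i e ℤP.≟ 0ℤ))
    ...   | yes (i , b≢0) = inj₂
      ( (λ f → border ρ κ i e * border ρ κ i f) , RowSpan-* (border ρ κ i e) (border-RowSpan ρ κ i)
      , unit-square (tu (suc k) (cons i ρ) (cons e κ) (border-rows injρ b≢0) (border-columns injκ b≢0)) b≢0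
      , λ f Df → trans (cong (_*_ (border ρ κ i e)) (maximal i f Df)) (ℤP.*-zeroʳ (border ρ κ i e)) )
    ...   | no none
      with border-kernel ρ κ e (λ i → decidable-stable (border ρ κ i e ℤP.≟ 0ℤ) (λ b≢0 → none (i , b≢0)))
             (λ b κb≡e → outside De (subst (λ x → D x ≡ true) κb≡e (inD b)))
      where
      outside : ∀ {b} → b ≡ false → b ≢ true
      outside refl ()
    ...     | v , kv , ve , off = inj₁
      ( (λ f → minor ρ κ * v f) , Kernel-* (minor ρ κ) kv
      , trans (cong (_*_ (minor ρ κ)) ve) (unit-square (tu k ρ κ injρ injκ) nz)
      , λ f f≢e Df → trans (cong (_*_ (minor ρ κ)) (off f (λ e≡f → f≢e (sym e≡f))
          λ b κb≡f → outside Df (subst (λ x → D x ≡ true) κb≡f (inD b)))) (ℤP.*-zeroʳ (minor ρ κ)) )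
      where
      outside : ∀ {b} → b ≡ false → b ≢ true
      outside refl ()

-- Regular pairs and Minty's colouring lemma

sumFin-pair : ∀ {k} {f : Fin k → ℤ} d e → d ≢ e → (∀ i → i ≢ d → i ≢ e → f i ≡ 0ℤ) → sumFin f ≡ f d + f e
sumFin-pair zero    zero    d≢e h = ⊥-elim (d≢e refl)
sumFin-pair {suc k} {f} zero (suc e) d≢e h =
  cong (_+_ (f zero)) (sumFin-single e λ i i≢e → h (suc i) (λ ()) λ eq → i≢e (FP.suc-injective eq))
sumFin-pair {suc k} {f} (suc d) zero d≢e h = trans (ℤP.+-comm (f zero) _) (cong (λ x → x + f zero)
  (sumFin-single d λ i i≢d → h (suc i) (λ eq → i≢d (FP.suc-injective eq)) λ ()))
sumFin-pair {suc k} {f} (suc d) (suc e) d≢e h = trans (cong₂ _+_ (h zero (λ ()) λ ())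
  (sumFin-pair d e (λ eq → d≢e (cong suc eq))
    λ i i≢d i≢e → h (suc i) (λ eq → i≢d (FP.suc-injective eq)) (λ eq → i≢e (FP.suc-injective eq))))
  (ℤP.+-identityˡ _)

sumFin-nonneg : ∀ {k} {f : Fin k → ℤ} → (∀ i → 0ℤ ≤ f i) → 0ℤ ≤ sumFin f
sumFin-nonneg {zero}  h = ℤP.≤-refl
sumFin-nonneg {suc k} h = ℤP.+-mono-≤ (h zero) (sumFin-nonneg (λ i → h (suc i)))

nonneg-sum≡0 : ∀ {x y} → 0ℤ ≤ x → 0ℤ ≤ y → x + y ≡ 0ℤ → x ≡ 0ℤ × y ≡ 0ℤ
nonneg-sum≡0 {+ zero} {+ zero} _ _ _ = refl , refl
nonneg-sum≡0 {+ zero} {+[1+ m ]} _ _ ()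
nonneg-sum≡0 {+[1+ m ]} {+ y} _ _ ()

sumFin-nonneg-0 : ∀ {k} {f : Fin k → ℤ} → (∀ i → 0ℤ ≤ f i) → sumFin f ≡ 0ℤ → ∀ i → f i ≡ 0ℤ
sumFin-nonneg-0 {suc k} {f} h eq i with nonneg-sum≡0 (h zero) (sumFin-nonneg {f = λ j → f (suc j)} (λ i → h (suc i))) eq
sumFin-nonneg-0 h eq zero    | z , _ = z
sumFin-nonneg-0 {suc k} {f} h eq (suc i) | _ , z = sumFin-nonneg-0 {f = λ j → f (suc j)} (λ i → h (suc i)) z i

IsSign : ℤ → Set
IsSign x = (x ≡ 0ℤ) ⊎ (x ≡ 1ℤ) ⊎ (x ≡ -1ℤ)

ε : Bool → ℤ
ε true  = 1ℤ
ε false = -1ℤ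

ε*ε : ∀ b → ε b * ε b ≡ 1ℤ
ε*ε true  = refl
ε*ε false = refl

ε-cancel : ∀ b x → ε b * (ε b * x) ≡ x
ε-cancel b x = trans (sym (ℤP.*-assoc (ε b) (ε b) x)) (trans (cong (λ z → z * x) (ε*ε b)) (ℤP.*-identityˡ x))

ε≡0 : ∀ b {x} → ε b * x ≡ 0ℤ → x ≡ 0ℤ
ε≡0 b {x} eq = trans (sym (ε-cancel b x)) (trans (cong (_*_ (ε b)) eq) (ℤP.*-zeroʳ (ε b)))

ε*0 : ∀ b {x} → x ≡ 0ℤ → ε b * x ≡ 0ℤ
ε*0 b refl = ℤP.*-zeroʳ (ε b)

ε*sign : ∀ b {x} → IsSign x → IsSign (ε b * x)
ε*sign b     (inj₁ refl)         = inj₁ (ℤP.*-zeroʳ (ε b))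
ε*sign true  (inj₂ (inj₁ refl)) = inj₂ (inj₁ refl)
ε*sign false (inj₂ (inj₁ refl)) = inj₂ (inj₂ refl)
ε*sign true  (inj₂ (inj₂ refl)) = inj₂ (inj₂ refl)
ε*sign false (inj₂ (inj₂ refl)) = inj₂ (inj₁ refl)

≤-resp : ∀ {x y} → x ≡ y → 0ℤ ≤ x → 0ℤ ≤ y
≤-resp refl p = p

≡⇒0≤ : ∀ {x} → x ≡ 0ℤ → 0ℤ ≤ x
≡⇒0≤ refl = ℤP.≤-refl

*-nonneg : ∀ {x y} → 0ℤ ≤ x → 0ℤ ≤ y → 0ℤ ≤ x * y
*-nonneg {+ x} {+ y} _ _ = ≤-resp (ℤP.pos-* x y) (+≤+ ℕ.z≤n)

*-nonneg-neg : ∀ {x y} → ¬ 0ℤ ≤ x → ¬ 0ℤ ≤ y → 0ℤ ≤ x * y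
*-nonneg-neg {+ x}      p q = ⊥-elim (p (+≤+ ℕ.z≤n))
*-nonneg-neg { -[1+ x ]} {+ y} p q = ⊥-elim (q (+≤+ ℕ.z≤n))
*-nonneg-neg { -[1+ x ]} { -[1+ y ]} p q = +≤+ ℕ.z≤n

ε*ε-product : ∀ b x y → (ε b * x) * (ε b * y) ≡ x * y
ε*ε-product b x y = trans (rearrange (ε b) x y) (ε-cancel b (x * y))
  where
  rearrange : ∀ e x y → (e * x) * (e * y) ≡ e * (e * (x * y))
  rearrange = solve-∀

divides-1 : ∀ {x y} → x * y ≡ -1ℤ → (x ≡ 1ℤ) ⊎ (x ≡ -1ℤ)
divides-1 {x} {y} eq = abs-1 x (ℕP.m*n≡1⇒m≡1 ∣ x ∣ ∣ y ∣ (trans (sym (ℤP.abs-* x y)) (cong ∣_∣ eq)))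
  where
  abs-1 : ∀ x → ∣ x ∣ ≡ 1 → (x ≡ 1ℤ) ⊎ (x ≡ -1ℤ)
  abs-1 (+ .1) refl = inj₁ refl
  abs-1 -[1+ zero ] refl = inj₂ refl

false≢true : ∀ {b} → b ≡ false → b ≢ true
false≢true refl ()

-- Vectors are functions, compared pointwise, hence the two closure fields `K-cong` and `R-cong`.
-- Regularity is the exact entry 1 in `alternative`. Both cases of it exclude `e` itself, so
-- complementing `D` exchanges them and the axioms are self-dual.
record RegularPair {n : ℕ} (K R : (Fin n → ℤ) → Set) : Set where
  field
    K-0    : K (λ _ → 0ℤ)
    K-+    : ∀ {u v} → K u → K v → K (λ e → u e + v e)
    K-*    : ∀ c {u} → K u → K (λ e → c * u e)
    K-cong : ∀ {u v} → (∀ e → u e ≡ v e) → K u → K v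
    R-0    : R (λ _ → 0ℤ)
    R-+    : ∀ {u v} → R u → R v → R (λ e → u e + v e)
    R-*    : ∀ c {u} → R u → R (λ e → c * u e)
    R-cong : ∀ {u v} → (∀ e → u e ≡ v e) → R u → R v
    orthogonal  : ∀ {v w} → K v → R w → sumFin (λ e → v e * w e) ≡ 0ℤ
    alternative : ∀ (D : Fin n → Bool) e →
      (Σ (Fin n → ℤ) λ v → K v × v e ≡ 1ℤ × (∀ f → f ≢ e → D f ≡ false → v f ≡ 0ℤ)) ⊎
      (Σ (Fin n → ℤ) λ w → R w × w e ≡ 1ℤ × (∀ f → f ≢ e → D f ≡ true → w f ≡ 0ℤ))

dual : ∀ {n} {K R : (Fin n → ℤ) → Set} → RegularPair K R → RegularPair R K
dual P = record
  { K-0 = R-0 ; R-0 = K-0 ; K-+ = R-+ ; K-* = R-* ; K-cong = R-cong ; R-+ = K-+ ; R-* = K-* ; R-cong = K-cong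
  ; orthogonal = λ {v} {w} rv kw → trans (sumFin-cong λ e → ℤP.*-comm (v e) (w e)) (orthogonal kw rv)
  ; alternative = λ D e → swap D (alternative (λ f → not (D f)) e)
  }
  where
  open RegularPair P
  swap : ∀ {e} {K R : _ → Set} D →
    (Σ (Fin _ → ℤ) λ v → K v × v e ≡ 1ℤ × (∀ f → f ≢ e → not (D f) ≡ false → v f ≡ 0ℤ)) ⊎
    (Σ (Fin _ → ℤ) λ w → R w × w e ≡ 1ℤ × (∀ f → f ≢ e → not (D f) ≡ true → w f ≡ 0ℤ)) →
    (Σ (Fin _ → ℤ) λ v → R v × v e ≡ 1ℤ × (∀ f → f ≢ e → D f ≡ false → v f ≡ 0ℤ)) ⊎
    (Σ (Fin _ → ℤ) λ w → K w × w e ≡ 1ℤ × (∀ f → f ≢ e → D f ≡ true → w f ≡ 0ℤ))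
  swap D (inj₁ (v , kv , ve , z)) = inj₂ (v , kv , ve , λ f ne Df → z f ne (cong not Df))
  swap D (inj₂ (w , rw , we , z)) = inj₁ (w , rw , we , λ f ne Df → z f ne (cong not Df))

-- These are the signed circuits of `K`. Minimality of the support is put in the form in which
-- eliminations use it: a member supported within `v` that vanishes at one point of the support of
-- `v` is zero.
record Elementary {n : ℕ} (K : (Fin n → ℤ) → Set) (v : Fin n → ℤ) : Set where
  field
    signed  : ∀ e → IsSign (v e)
    member  : K v
    point   : Σ (Fin n) λ e → v e ≢ 0ℤ
    minimal : ∀ u → K u → (∀ f → v f ≡ 0ℤ → u f ≡ 0ℤ) → ∀ g → v g ≢ 0ℤ → u g ≡ 0ℤ → ∀ f → u f ≡ 0ℤ

without : ∀ {n} → (Fin n → Bool) → Fin n → Fin n → Bool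
without D f g with g FP.≟ f
... | yes _ = false
... | no  _ = D g

without-true : ∀ {n} (D : Fin n → Bool) {f g} → without D f g ≡ true → D g ≡ true × g ≢ f
without-true D {f} {g} eq with g FP.≟ f
without-true D () | yes _
... | no g≢f = eq , g≢f

without-keep : ∀ {n} (D : Fin n → Bool) {f g} → D g ≡ true → g ≢ f → without D f g ≡ true
without-keep D {f} {g} eq g≢f with g FP.≟ f
... | yes g≡f = ⊥-elim (g≢f g≡f)
... | no _    = eq

without-false : ∀ {n} (D : Fin n → Bool) {f g} → D g ≡ false → without D f g ≡ false
without-false D {f} {g} eq with g FP.≟ f
... | yes _ = refl
... | no _  = eq

data Pattern : Set where
  none any : Pattern
  one      : Bool → Pattern

dualᵖ : Pattern → Pattern
dualᵖ none    = any
dualᵖ any     = none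
dualᵖ (one b) = one b

Conf : Pattern → ℤ → Set
Conf none    x = x ≡ 0ℤ
Conf any     x = ⊤
Conf (one b) x = 0ℤ ≤ ε b * x

conf-0 : ∀ p {x} → x ≡ 0ℤ → Conf p x
conf-0 none    eq = eq
conf-0 any     eq = tt
conf-0 (one b) eq = ≡⇒0≤ (ε*0 b eq)

-- This is what makes `dualᵖ` the right dual: vectors of `K` and `R` conforming to dual patterns
-- have nonnegative products everywhere, and orthogonality then forces every product to be zero.
conf-product : ∀ p {x y} → Conf p x → Conf (dualᵖ p) y → 0ℤ ≤ x * y
conf-product none    refl _ = ℤP.≤-refl
conf-product any {x} _ refl = ≡⇒0≤ (ℤP.*-zeroʳ x)
conf-product (one b) {x} {y} p q = ≤-resp (ε*ε-product b x y) (*-nonneg p q)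

update : ∀ {n} → (Fin n → Pattern) → Fin n → Pattern → Fin n → Pattern
update P f p g with g FP.≟ f
... | yes _ = p
... | no  _ = P g

update-at : ∀ {n} (P : Fin n → Pattern) f p → update P f p f ≡ p
update-at P f p with f FP.≟ f
... | yes _  = refl
... | no f≢f = ⊥-elim (f≢f refl)

update-off : ∀ {n} (P : Fin n → Pattern) {f p g} → g ≢ f → update P f p g ≡ P g
update-off P {f} {p} {g} g≢f with g FP.≟ f
... | yes g≡f = ⊥-elim (g≢f g≡f)
... | no _    = refl

-- Returning from an updated pattern requires a new check only at `f`. `F` is the identity for
-- vectors of `K` and `dualᵖ` for vectors of `R`.
conf-downdate : ∀ {n} (F : Pattern → Pattern) (P : Fin n → Pattern) f p {v : Fin n → ℤ} →
  (∀ g → Conf (F (update P f p g)) (v g)) → Conf (F (P f)) (v f) → ∀ g → Conf (F (P g)) (v g)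
conf-downdate F P f p h hf g with g FP.≟ f | h g
... | yes refl | _ = hf
... | no _     | c = c

-- Elementary vectors inside a prescribed set

module Shrink {n : ℕ} {K R : (Fin n → ℤ) → Set} (pair : RegularPair K R) where
  open RegularPair pair

  elementary-ε : ∀ b {v} → Elementary K v → Elementary K (λ e → ε b * v e)
  elementary-ε b {v} ev = record
    { signed = λ e → ε*sign b (signed e)
    ; member = K-* (ε b) member
    ; point = proj₁ point , λ eq → proj₂ point (ε≡0 b eq)
    ; minimal = λ u ku sub g vg → minimal u ku (λ f vf → sub f (ε*0 b vf)) g (λ eq → vg (ε*0 b eq))
    }
    where open Elementary ev

  -- A certificate that `f` cannot be dropped from `D`: a kernel vector supported in `D` and `e`
  -- meets `w` at most in `e` and `f`, so its entry at `e` forces the one at `f`.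
  Witness : (Fin n → Bool) → Fin n → Fin n → Set
  Witness D e f = Σ (Fin n → ℤ) λ w → R w × w e ≡ 1ℤ × (∀ g → g ≢ e → g ≢ f → D g ≡ true → w g ≡ 0ℤ)

  witness-pair : ∀ {D e f u} → f ≢ e → K u → (∀ g → g ≢ e → D g ≡ false → u g ≡ 0ℤ) →
    ((w , _) : Witness D e f) → u e + u f * w f ≡ 0ℤ
  witness-pair {D} {e} {f} {u} f≢e ku zero-off (w , rw , we , zero-on) = begin
    u e + u f * w f          ≡⟨ cong (λ z → z + u f * w f) (sym (trans (cong (_*_ (u e)) we) (ℤP.*-identityʳ (u e)))) ⟩
    u e * w e + u f * w f    ≡⟨ sym (sumFin-pair e f (λ e≡f → f≢e (sym e≡f)) elsewhere) ⟩
    sumFin (λ g → u g * w g) ≡⟨ orthogonal ku rw ⟩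
    0ℤ ∎
    where
    open ≡-Reasoning
    elsewhere : ∀ g → g ≢ e → g ≢ f → u g * w g ≡ 0ℤ
    elsewhere g g≢e g≢f with D g in eq
    ... | true  = trans (cong (_*_ (u g)) (zero-on g g≢e g≢f eq)) (ℤP.*-zeroʳ (u g))
    ... | false = cong (λ z → z * w g) (zero-off g g≢e eq)

  ElementaryThrough : (Fin n → Bool) → Fin n → Set
  ElementaryThrough D e = Σ (Fin n → ℤ) λ c → Elementary K c × c e ≡ 1ℤ × (∀ f → f ≢ e → D f ≡ false → c f ≡ 0ℤ)

  -- The witnesses tie every entry `u f` of a kernel vector on `D` to `u e` by
  -- `u e + u f * w f ≡ 0`. For `v` itself this reads `v f * w f ≡ -1`, so `v f` is a unit and `w f`
  -- is nonzero; hence a vector vanishing at one point of the support vanishes at `e`, and then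
  -- everywhere.
  tight⇒elementary : ∀ D e {v} → K v → v e ≡ 1ℤ → (∀ f → f ≢ e → D f ≡ false → v f ≡ 0ℤ) →
    (∀ f → f ≢ e → D f ≡ true → Witness D e f) → Elementary K v
  tight⇒elementary D e {v} kv ve off wit = record
    { signed = sign ; member = kv ; point = e , (λ eq → 1≢0 (trans (sym ve) eq)) ; minimal = minimal }
    where
    1≢0 : 1ℤ ≢ 0ℤ
    1≢0 ()
    product : ∀ f → (f≢e : f ≢ e) → (Df : D f ≡ true) → v f * proj₁ (wit f f≢e Df) f ≡ -1ℤ
    product f f≢e Df = trans (solve-for (v e) _) (cong₂ _-_ (witness-pair {D} f≢e kv off (wit f f≢e Df)) ve)
      where
      solve-for : ∀ x y → y ≡ (x + y) - x
      solve-for = solve-∀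
    sign : ∀ f → IsSign (v f)
    sign f with f FP.≟ e
    ... | yes refl = inj₂ (inj₁ ve)
    ... | no f≢e with D f in eq
    ...   | false = inj₁ (off f f≢e eq)
    ...   | true  = inj₂ (divides-1 (product f f≢e eq))
    minimal : ∀ u → K u → (∀ f → v f ≡ 0ℤ → u f ≡ 0ℤ) → ∀ g → v g ≢ 0ℤ → u g ≡ 0ℤ → ∀ f → u f ≡ 0ℤ
    minimal u ku sub g vg ug = λ f → all-0 f
      where
      u-off : ∀ f → f ≢ e → D f ≡ false → u f ≡ 0ℤ
      u-off f f≢e Df = sub f (off f f≢e Df)
      ue : u e ≡ 0ℤ
      ue with g FP.≟ e
      ... | yes refl = ug
      ... | no g≢e with D g in eq
      ...   | false = ⊥-elim (vg (off g g≢e eq))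
      ...   | true  = trans (sym (ℤP.+-identityʳ (u e))) (trans
        (cong (λ z → u e + z * proj₁ (wit g g≢e eq) g) (sym ug)) (witness-pair {D} g≢e ku u-off (wit g g≢e eq)))
      all-0 : ∀ f → u f ≡ 0ℤ
      all-0 f with f FP.≟ e
      ... | yes refl = ue
      ... | no f≢e with D f in eq
      ...   | false = u-off f f≢e eq
      ...   | true with ℤP.i*j≡0⇒i≡0∨j≡0 (u f) (trans (sym (ℤP.+-identityˡ _))
                (trans (cong (λ z → z + u f * proj₁ (wit f f≢e eq) f) (sym ue)) (witness-pair {D} f≢e ku u-off (wit f f≢e eq))))
      ...     | inj₁ uf = uf
      ...     | inj₂ wf = ⊥-elim (-1≢0 (trans (sym (product f f≢e eq)) (trans (cong (_*_ (v f)) wf) (ℤP.*-zeroʳ (v f)))))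
        where
        -1≢0 : -1ℤ ≢ 0ℤ
        -1≢0 ()

  -- Each element is tried for removal once. Either a kernel vector survives without it and `D`
  -- shrinks, or the row-space vector of the other alternative is a witness for it, which stays a
  -- witness when `D` shrinks further.
  elementary-through : ∀ D e {v} → K v → v e ≡ 1ℤ → (∀ f → f ≢ e → D f ≡ false → v f ≡ 0ℤ) → ElementaryThrough D e
  elementary-through D e kv ve off = go (List.allFin n) D kv ve off (λ f _ _ → inj₁ (∈-allFin f))
    where
    go : ∀ l D {v} → K v → v e ≡ 1ℤ → (∀ f → f ≢ e → D f ≡ false → v f ≡ 0ℤ) →
      (∀ f → f ≢ e → D f ≡ true → (f ∈ˡ l) ⊎ Witness D e f) → ElementaryThrough D e
    go [] D {v} kv ve off todo = v , tight⇒elementary D e kv ve off wit , ve , off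
      where
      wit : ∀ f → f ≢ e → D f ≡ true → Witness D e f
      wit f f≢e Df with todo f f≢e Df
      ... | inj₂ w = w
    go (h ∷ l) D {v} kv ve off todo with alternative (without D h) e
    ... | inj₁ (v′ , kv′ , ve′ , off′) =
      let (c , ec , ce , coff) = go l (without D h) kv′ ve′ off′ todo′
      in c , ec , ce , λ f f≢e Df → coff f f≢e (without-false D Df)
      where
      todo′ : ∀ f → f ≢ e → without D h f ≡ true → (f ∈ˡ l) ⊎ Witness (without D h) e f
      todo′ f f≢e Df with without-true D Df
      ... | Df′ , f≢h with todo f f≢e Df′
      ...   | inj₁ (here f≡h) = ⊥-elim (f≢h f≡h)
      ...   | inj₁ (there f∈l) = inj₁ f∈l
      ...   | inj₂ (w , rw , we , on) = inj₂ (w , rw , we , λ g g≢e g≢f Dg → on g g≢e g≢f (proj₁ (without-true D Dg)))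
    ... | inj₂ (w , rw , we , on) = go l D kv ve off todo′
      where
      todo′ : ∀ f → f ≢ e → D f ≡ true → (f ∈ˡ l) ⊎ Witness D e f
      todo′ f f≢e Df with todo f f≢e Df
      ... | inj₁ (here refl) = inj₂ (w , rw , we , λ g g≢e g≢f Dg → on g g≢e (without-keep D Dg g≢f))
      ... | inj₁ (there f∈l) = inj₁ f∈l
      ... | inj₂ wit = inj₂ wit

module Minty {n : ℕ} {K R : (Fin n → ℤ) → Set} (pair : RegularPair K R) where
  open RegularPair pair
  open Shrink using (elementary-through; elementary-ε)

  Conforming : ((Fin n → ℤ) → Set) → (Fin n → Pattern) → Fin n → Bool → Set
  Conforming L P e b = Σ (Fin n → ℤ) λ c → Elementary L c × c e ≡ ε b × (∀ f → Conf (P f) (c f))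

  opposite-signs : ∀ {v w} → K v → R w → (∀ e → 0ℤ ≤ v e * w e) → ∀ e → v e * w e ≡ 0ℤ
  opposite-signs kv rw h = sumFin-nonneg-0 h (orthogonal kv rw)

  -- Induction on the sign-constrained elements: at such an element f both alternatives "forbid f" and
  -- "free f" are solved; a solution of each kind with the wrong sign at f would violate orthogonality.
  minty : ∀ P e b → P e ≡ one b → Conforming K P e b ⊎ Conforming R (λ f → dualᵖ (P f)) e b
  minty P e b Pe = go (List.allFin n) P Pe (λ f _ _ → ∈-allFin f)
    where
    isAny : Pattern → Bool
    isAny none    = false
    isAny any     = true
    isAny (one _) = false

    scale : ∀ {L M} → RegularPair L M → ∀ P (D : Fin n → Bool) → P e ≡ one b →
      (∀ f → f ≢ e → P f ≡ any ⊎ D f ≡ false) →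
      (Σ (Fin n → ℤ) λ v → L v × v e ≡ 1ℤ × (∀ f → f ≢ e → D f ≡ false → v f ≡ 0ℤ)) → Conforming L P e b
    scale {L} pr P D Pe free (v , lv , ve , off) with elementary-through pr D e lv ve off
    ... | c , ec , ce , coff = (λ f → ε b * c f) , elementary-ε pr b ec
        , trans (cong (_*_ (ε b)) ce) (ℤP.*-identityʳ (ε b)) , conf
      where
      conf : ∀ f → Conf (P f) (ε b * c f)
      conf f with f FP.≟ e
      ... | yes refl rewrite Pe = ≤-resp (sym (trans (ε-cancel b (c f)) ce)) (+≤+ ℕ.z≤n)
      ... | no f≢e with free f f≢e
      ...   | inj₁ Pf rewrite Pf = tt
      ...   | inj₂ Df = conf-0 (P f) (ε*0 b (coff f f≢e Df))

    go : ∀ l P → P e ≡ one b → (∀ f → f ≢ e → Σ Bool (λ b′ → P f ≡ one b′) → f ∈ˡ l) →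
      Conforming K P e b ⊎ Conforming R (λ f → dualᵖ (P f)) e b
    go [] P Pe todo with alternative (λ f → isAny (P f)) e
    ... | inj₁ sol = inj₁ (scale pair P (λ f → isAny (P f)) Pe free sol)
      where
      free : ∀ f → f ≢ e → P f ≡ any ⊎ isAny (P f) ≡ false
      free f f≢e with P f
      ... | none  = inj₂ refl
      ... | any   = inj₁ refl
      ... | one _ = inj₂ refl
    ... | inj₂ (w , rw , we , on) = inj₂ (scale (dual pair) (λ f → dualᵖ (P f)) (λ f → not (isAny (P f)))
        (cong dualᵖ Pe) free (w , rw , we , λ f f≢e eq → on f f≢e (not-false eq)))
      where
      not-false : ∀ {b} → not b ≡ false → b ≡ true
      not-false {true} _ = refl
      free : ∀ f → f ≢ e → dualᵖ (P f) ≡ any ⊎ not (isAny (P f)) ≡ false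
      free f f≢e with P f in eq
      ... | none  = inj₁ refl
      ... | any   = inj₂ refl
      ... | one b′ with todo f f≢e (b′ , eq)
      ...   | ()
    go (h ∷ l) P Pe todo with P h in Ph | h FP.≟ e
    ... | none  | _ = go l P Pe λ f f≢e (b′ , Pf) → Any.tail (λ { refl → clash (trans (sym Ph) Pf) }) (todo f f≢e (b′ , Pf))
      where
      clash : ∀ {b} → none ≡ one b → ⊥
      clash ()
    ... | any   | _ = go l P Pe λ f f≢e (b′ , Pf) → Any.tail (λ { refl → clash (trans (sym Ph) Pf) }) (todo f f≢e (b′ , Pf))
      where
      clash : ∀ {b} → any ≡ one b → ⊥
      clash ()
    ... | one b′ | yes h≡e = go l P Pe λ f f≢e Pf → Any.tail (λ f≡h → f≢e (trans f≡h h≡e)) (todo f f≢e Pf)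
    ... | one b′ | no h≢e = reconcile (go l (update P h none) (at-e none) (todo′ none λ ()))
                                    (go l (update P h any) (at-e any) (todo′ any λ ()))
      where
      Pʰ : Pattern → Fin n → Pattern
      Pʰ p = update P h p
      at-e : ∀ p → Pʰ p e ≡ one b
      at-e p = trans (update-off P (λ e≡h → h≢e (sym e≡h))) Pe
      todo′ : ∀ p → (∀ {b} → p ≢ one b) → ∀ f → f ≢ e → Σ Bool (λ b → Pʰ p f ≡ one b) → f ∈ˡ l
      todo′ p p≢ f f≢e (b″ , eq) with f FP.≟ h
      ... | yes refl = ⊥-elim (p≢ eq)
      ... | no f≢h = Any.tail f≢h (todo f f≢e (b″ , eq))
      restoreᴷ : ∀ p (c : Fin n → ℤ) → (∀ f → Conf (Pʰ p f) (c f)) → 0ℤ ≤ ε b′ * c h → ∀ f → Conf (P f) (c f)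
      restoreᴷ p c conf ch = conf-downdate (λ q → q) P h p {c} conf (subst (λ q → Conf q (c h)) (sym Ph) ch)
      restoreᴿ : ∀ p (c : Fin n → ℤ) → (∀ f → Conf (dualᵖ (Pʰ p f)) (c f)) → 0ℤ ≤ ε b′ * c h → ∀ f → Conf (dualᵖ (P f)) (c f)
      restoreᴿ p c conf ch = conf-downdate dualᵖ P h p {c} conf (subst (λ q → Conf (dualᵖ q) (c h)) (sym Ph) ch)
      reconcile : Conforming K (Pʰ none) e b ⊎ Conforming R (λ f → dualᵖ (Pʰ none f)) e b →
                Conforming K (Pʰ any) e b ⊎ Conforming R (λ f → dualᵖ (Pʰ any f)) e b →
                Conforming K P e b ⊎ Conforming R (λ f → dualᵖ (P f)) e b
      -- A kernel vector for `none`, or a row-space vector for `any` (dually `none`), vanishes at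
      -- `h` and so already satisfies the sign constraint. Only the remaining combination calls for
      -- a comparison of signs.
      reconcile (inj₁ (v , ev , ve , conf)) _ = inj₁ (v , ev , ve , restoreᴷ none v conf
        (≡⇒0≤ (ε*0 b′ (subst (λ q → Conf q (v h)) (update-at P h none) (conf h)))))
      reconcile (inj₂ _) (inj₂ (w , ew , we , conf)) = inj₂ (w , ew , we , restoreᴿ any w conf
        (≡⇒0≤ (ε*0 b′ (subst (λ q → Conf (dualᵖ q) (w h)) (update-at P h any) (conf h)))))
      reconcile (inj₂ (w , ew , we , confw)) (inj₁ (v , ev , ve , confv))
        with 0ℤ ℤP.≤? ε b′ * v h | 0ℤ ℤP.≤? ε b′ * w h
      ... | yes vh | _ = inj₁ (v , ev , ve , restoreᴷ any v confv vh)
      ... | no _ | yes wh = inj₂ (w , ew , we , restoreᴿ none w confw wh)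
      ... | no vh | no wh = ⊥-elim (1≢0 (trans (sym (trans (cong₂ _*_ ve we) (ε*ε b)))
          (opposite-signs {v} {w} (Elementary.member ev) (Elementary.member ew) product e)))
        where
        1≢0 : 1ℤ ≢ 0ℤ
        1≢0 ()
        product : ∀ f → 0ℤ ≤ v f * w f
        product f with f FP.≟ h | confv f | confw f
        ... | yes refl | _  | _  = ≤-resp (ε*ε-product b′ (v f) (w f)) (*-nonneg-neg vh wh)
        ... | no _     | cv | cw = conf-product (P f) cv cw

-- Signatures and frames of a basis

neg : ∀ {n} → (Fin n → ℤ) → Fin n → ℤ
neg v e = - v e

-- Nonnegative integral combinations with coefficients encoded by repetition. Integers suffice
-- because fundamental vectors have entry 1 or -1 at their own element.
data Cone {n : ℕ} (S : (Fin n → ℤ) → Set) : (Fin n → ℤ) → Set where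
  cone-0 : ∀ {x} → (∀ e → x e ≡ 0ℤ) → Cone S x
  cone-+ : ∀ {s u x} → S s → Cone S u → (∀ e → x e ≡ s e + u e) → Cone S x

module _ {n : ℕ} {S : (Fin n → ℤ) → Set} where

  cone-cong : ∀ {u v} → (∀ e → u e ≡ v e) → Cone S u → Cone S v
  cone-cong h (cone-0 z)       = cone-0 λ e → trans (sym (h e)) (z e)
  cone-cong h (cone-+ s cu eq) = cone-+ s cu λ e → trans (sym (h e)) (eq e)

  cone-generator : ∀ {s} → S s → Cone S s
  cone-generator {s} Ss = cone-+ {u = λ _ → 0ℤ} Ss (cone-0 λ _ → refl) λ e → sym (ℤP.+-identityʳ (s e))

  cone-sum : ∀ {u v} → Cone S u → Cone S v → Cone S (λ e → u e + v e)
  cone-sum {v = v} (cone-0 z) cv = cone-cong (λ e → sym (trans (cong (λ x → x + v e) (z e)) (ℤP.+-identityˡ (v e)))) cv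
  cone-sum {v = v} (cone-+ {s} {u} Ss cu eq) cv =
    cone-+ Ss (cone-sum cu cv) λ e → trans (cong (λ x → x + v e) (eq e)) (ℤP.+-assoc (s e) (u e) (v e))

  cone-multiple : ∀ {s u x} m → S s → Cone S u → (∀ e → x e ≡ + m * s e + u e) → Cone S x
  cone-multiple {s} {u} zero    Ss cu eq = cone-cong (λ e → sym (trans (eq e) (ℤP.+-identityˡ (u e)))) cu
  cone-multiple {s} {u} (suc m) Ss cu eq = cone-+ {u = λ e → + m * s e + u e} Ss
    (cone-multiple m Ss cu λ _ → refl) λ e → trans (eq e) (peel (+ m) (s e) (u e))
    where
    peel : ∀ m s u → (1ℤ + m) * s + u ≡ s + (m * s + u)
    peel = solve-∀

-- Acyclicity is stated as pointedness of the cone, the form needed to compare two bases. `opposed?`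
-- is the finite search that drives both the deletion-contraction induction and the repeated
-- reversal.
record Signature {n : ℕ} (K S : (Fin n → ℤ) → Set) : Set where
  field
    elementary : ∀ {s} → S s → Elementary K s
    total      : ∀ {c} → Elementary K c → S c ⊎ S (neg c)
    acyclic    : ∀ {u} → Cone S u → Cone S (neg u) → ∀ e → u e ≡ 0ℤ
    opposed?   : ∀ (P : Fin n → Pattern) → Dec (Σ (Fin n → ℤ) λ s → S s × (∀ e → Conf (P e) (- s e)))

-- For `P e = one (O e)` this is the failure of compatibility: the negative of a selected circuit
-- lies in the orientation `O`. Patterns containing `none` and `any` express the analogue after
-- deletions and contractions.
Opposed : ∀ {n} → ((Fin n → ℤ) → Set) → (Fin n → Pattern) → Set
Opposed S P = Σ (Fin _ → ℤ) λ s → S s × (∀ e → Conf (P e) (- s e))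

-- For the kernel and `b = false` it says that `B` is independent; for the row space and `b = true`
-- it says that the complement of `B` contains no cocircuit, so that `B` is spanning.
Null : ∀ {n} → ((Fin n → ℤ) → Set) → (Fin n → Bool) → Bool → Set
Null K B b = ∀ v → K v → (∀ e → B e ≡ b → v e ≡ 0ℤ) → ∀ e → v e ≡ 0ℤ

-- The fundamental circuit of `e` (`b = false`) or its fundamental cocircuit (`b = true`) in the
-- orientation chosen by the signature, with `g` its sign at `e`.
Fundamental : ∀ {n} → ((Fin n → ℤ) → Set) → (Fin n → Bool) → Bool → Fin n → Bool → Set
Fundamental S B b e g = Σ (Fin _ → ℤ) λ s → S s × s e ≡ ε g × (∀ f → f ≢ e → B f ≡ b → s f ≡ 0ℤ)

HalfFrame : ∀ {n} → ((Fin n → ℤ) → Set) → (Fin n → Bool) → Bool → (Fin n → Bool) → Set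
HalfFrame S B b G = ∀ e → B e ≡ b → Fundamental S B b e (G e)

ε≢0 : ∀ b → ε b ≢ 0ℤ
ε≢0 true  ()
ε≢0 false ()

0≤⇒+abs : ∀ {x} → 0ℤ ≤ x → x ≡ + ∣ x ∣
0≤⇒+abs {+ x} _ = refl

≢⇒not : ∀ {x y : Bool} → x ≢ y → x ≡ not y
≢⇒not {true}  {true}  h = ⊥-elim (h refl)
≢⇒not {true}  {false} h = refl
≢⇒not {false} {true}  h = refl
≢⇒not {false} {false} h = ⊥-elim (h refl)

not-self : ∀ {b} → b ≢ not b
not-self {true}  ()
not-self {false} ()

ε-not : ∀ b x → ε (not b) * x ≡ ε b * (- x)
ε-not true  x = flip x
  where
  flip : ∀ x → -1ℤ * x ≡ 1ℤ * (- x)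
  flip = solve-∀
ε-not false x = flip x
  where
  flip : ∀ x → 1ℤ * x ≡ -1ℤ * (- x)
  flip = solve-∀

ε-not-neg : ∀ b x → ε (not b) * (- x) ≡ ε b * x
ε-not-neg b x = trans (ε-not b (- x)) (cong (_*_ (ε b)) (ℤP.neg-involutive x))

-- A vector with the frame's signs outside the basis is the combination of fundamental vectors
-- with the same entries there.
half-frame-cone : ∀ {n} {K R S : (Fin n → ℤ) → Set} → RegularPair K R → Signature K S → ∀ {B b G} →
  Null K B b → HalfFrame S B b G → ∀ {v} → K v → (∀ e → B e ≡ b → 0ℤ ≤ ε (G e) * v e) → Cone S v
half-frame-cone {n} {K} {R} {S} pair sig {B} {b} {G} null half = λ kv good →
  go (List.allFin n) kv good (λ e _ _ → ∈-allFin e)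
  where
  open RegularPair pair
  open Signature sig
  go : ∀ l {v} → K v → (∀ e → B e ≡ b → 0ℤ ≤ ε (G e) * v e) → (∀ e → B e ≡ b → v e ≢ 0ℤ → e ∈ˡ l) → Cone S v
  go [] {v} kv good todo = cone-0 (null v kv λ e Be → decidable-stable (v e ℤP.≟ 0ℤ) (λ ve → absurd (todo e Be ve)))
    where
    absurd : ∀ {e} → e ∈ˡ [] → ⊥
    absurd ()
  go (h ∷ l) {v} kv good todo with B h BP.≟ b
  ... | no Bh≢b = go l kv good λ e Be ve → Any.tail (λ { refl → Bh≢b Be }) (todo e Be ve)
  ... | yes Bh with half h Bh
  ...   | s , Ss , sh , off = cone-multiple {u = v′} m Ss (go l kv′ good′ todo′) λ e → rejoin (+ m) (s e) (v e)
    where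
    m : ℕ
    m = ∣ ε (G h) * v h ∣
    v′ : Fin n → ℤ
    v′ e = v e + (- + m) * s e
    kv′ : K v′
    kv′ = K-+ kv (K-* (- + m) (Elementary.member (elementary Ss)))
    rejoin : ∀ m s v → v ≡ m * s + (v + (- m) * s)
    rejoin = solve-∀
    cancel-at : ∀ g v → v + (- (g * v)) * g ≡ v - g * (g * v)
    cancel-at = solve-∀
    v′h : v′ h ≡ 0ℤ
    v′h = trans (cong₂ (λ x y → v h + (- x) * y) (sym (0≤⇒+abs (good h Bh))) sh)
      (trans (cancel-at (ε (G h)) (v h)) (trans (cong (λ x → v h - x) (ε-cancel (G h) (v h))) (ℤP.+-inverseʳ (v h))))
    v′-off : ∀ e → e ≢ h → B e ≡ b → v′ e ≡ v e
    v′-off e e≢h Be = trans (cong (λ x → v e + (- + m) * x) (off e e≢h Be))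
      (trans (cong (_+_ (v e)) (ℤP.*-zeroʳ (- + m))) (ℤP.+-identityʳ (v e)))
    good′ : ∀ e → B e ≡ b → 0ℤ ≤ ε (G e) * v′ e
    good′ e Be with e FP.≟ h
    ... | yes refl = ≡⇒0≤ (ε*0 (G h) v′h)
    ... | no e≢h   = ≤-resp (cong (_*_ (ε (G e))) (sym (v′-off e e≢h Be))) (good e Be)
    todo′ : ∀ e → B e ≡ b → v′ e ≢ 0ℤ → e ∈ˡ l
    todo′ e Be v′e with e FP.≟ h
    ... | yes refl = ⊥-elim (v′e v′h)
    ... | no e≢h   = Any.tail e≢h (todo e Be λ ve → v′e (trans (v′-off e e≢h Be) ve))

two-frames : ∀ {n} {K R S : (Fin n → ℤ) → Set} → RegularPair K R → Signature K S → ∀ {b B₁ G₁ B₂ G₂} →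
  Null K B₁ b → HalfFrame S B₁ b G₁ → Null K B₂ b → HalfFrame S B₂ b G₂ →
  ∀ {v} → K v → (∀ e → B₁ e ≡ b → 0ℤ ≤ ε (G₁ e) * v e) → (∀ e → B₂ e ≡ b → 0ℤ ≤ ε (G₂ e) * (- v e)) →
  ∀ e → v e ≡ 0ℤ
two-frames pair sig null₁ half₁ null₂ half₂ {v} kv good₁ good₂ =
  Signature.acyclic sig (half-frame-cone pair sig null₁ half₁ kv good₁)
    (half-frame-cone pair sig null₂ half₂
      (K-cong (λ e → ℤP.-1*i≡-i (v e)) (K-* -1ℤ kv)) good₂)
  where open RegularPair pair

no-opposed-good : ∀ {n} {K R S : (Fin n → ℤ) → Set} → RegularPair K R → Signature K S → ∀ {B b G} →
  Null K B b → HalfFrame S B b G → ∀ {s} → S s → ¬ (∀ e → B e ≡ b → 0ℤ ≤ ε (G e) * (- s e))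
no-opposed-good pair sig null half {s} Ss good =
  proj₂ point (acyclic (cone-generator Ss)
    (half-frame-cone pair sig null half (K-cong (λ e → ℤP.-1*i≡-i (s e)) (K-* -1ℤ member)) good) (proj₁ point))
  where
  open RegularPair pair
  open Signature sig
  open Elementary (elementary Ss)

-- A fundamental vector with the wrong sign at `e` has no other entries on that side of `B`, so its
-- negative would agree with the frame and lie in the cone together with it.
half-frame-unique : ∀ {n} {K R S : (Fin n → ℤ) → Set} → RegularPair K R → Signature K S → ∀ {B b G} →
  Null K B b → HalfFrame S B b G → ∀ e → B e ≡ b → ∀ g → Fundamental S B b e g → g ≡ G e
half-frame-unique pair sig {B} {b} {G} null half e Be g (s , Ss , se , off) =
  decidable-stable (g BP.≟ G e) λ g≢G → no-opposed-good pair sig null half Ss (good g≢G)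
  where
  good : g ≢ G e → ∀ f → B f ≡ b → 0ℤ ≤ ε (G f) * (- s f)
  good g≢G f Bf with f FP.≟ e
  ... | yes refl = ≤-resp (sym (trans (sym (ε-not (G f) (s f))) (trans (cong₂ (λ x y → ε x * y) (sym (≢⇒not g≢G)) se) (ε*ε g))))
                     (+≤+ ℕ.z≤n)
  ... | no f≢e   = ≡⇒0≤ (ε*0 (G f) (cong -_ (off f f≢e Bf)))

-- `b xor B f` marks the side of `B` opposite to that of `e`. A row-space vector vanishing there is
-- zero by `Null`, so the alternative gives a kernel vector, which is shrunk and then replaced by
-- its negative if the signature says so.
fundamental-exists : ∀ {n} {K R S : (Fin n → ℤ) → Set} → RegularPair K R → Signature K S → ∀ B b →
  Null R B (not b) → ∀ e → B e ≡ b → Σ Bool (Fundamental S B b e)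
fundamental-exists {n} {K} {R} {S} pair sig B b null e Be with RegularPair.alternative pair (λ f → b xor B f) e
... | inj₂ (w , rw , we , on) = ⊥-elim (ε≢0 true (trans (sym we) (null w rw zero-on e)))
  where
  xor-not : ∀ b → b xor not b ≡ true
  xor-not true  = refl
  xor-not false = refl
  zero-on : ∀ f → B f ≡ not b → w f ≡ 0ℤ
  zero-on f Bf = on f (λ { refl → not-self (trans (sym Be) Bf) }) (trans (cong (b xor_) Bf) (xor-not b))
... | inj₁ (v , kv , ve , off) with Shrink.elementary-through pair (λ f → b xor B f) e kv ve off
...   | c , ec , ce , coff = orient (Signature.total sig ec)
  where
  c-off : ∀ f → f ≢ e → B f ≡ b → c f ≡ 0ℤ
  c-off f f≢e Bf = coff f f≢e (trans (cong (b xor_) Bf) (BP.xor-same b))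
  orient : S c ⊎ S (neg c) → Σ Bool (Fundamental S B b e)
  orient (inj₁ Sc) = true , c , Sc , ce , c-off
  orient (inj₂ Sc) = false , neg c , Sc , cong -_ ce , λ f f≢e Bf → cong -_ (c-off f f≢e Bf)

module Frames {n : ℕ} {K R S S* : (Fin n → ℤ) → Set}
  (pair : RegularPair K R) (sig : Signature K S) (sig* : Signature R S*) where
  open RegularPair pair

  record Frame (B G : Fin n → Bool) : Set where
    field
      nullK : Null K B false
      nullR : Null R B true
      halfK : HalfFrame S B false G
      halfR : HalfFrame S* B true G

  frame-exists : ∀ B → Null K B false → Null R B true → Σ (Fin n → Bool) (Frame B)
  frame-exists B nullK nullR = (λ e → proj₁ (at e)) , record
    { nullK = nullK ; nullR = nullR ; halfK = λ e → proj₁ (proj₂ (at e)) ; halfR = λ e → proj₂ (proj₂ (at e)) }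
    where
    at : ∀ e → Σ Bool λ g → (B e ≡ false → Fundamental S B false e g) × (B e ≡ true → Fundamental S* B true e g)
    at e with B e in Be
    ... | false = let (g , fund) = fundamental-exists pair sig B false nullR e Be in g , (λ _ → fund) , λ ()
    ... | true  = let (g , fund) = fundamental-exists (dual pair) sig* B true nullK e Be in g , (λ ()) , λ _ → fund

  -- Vectors conforming to the pattern respect the signs G₁ outside B₁, and their negatives the
  -- signs G₂ outside B₂; for the dual pattern the two frames change roles.
  clashPattern : Bool → Bool → Bool → Bool → Pattern
  clashPattern true  true  g₁ g₂ = any
  clashPattern true  false g₁ g₂ = one (not g₂)
  clashPattern false true  g₁ g₂ = one g₁
  clashPattern false false g₁ g₂ with g₁ BP.≟ g₂
  ... | yes _ = none
  ... | no _  = one g₁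

  -- An element where the bases differ carries a sign in the pattern, so Minty's lemma gives a
  -- vector that is nonzero there. A kernel vector contradicts `two-frames` for σ. For a row-space
  -- vector `agree` aligns the two signs on the symmetric difference, and it contradicts
  -- `two-frames` for σ*.
  basis-unique : ∀ {B₁ G₁ B₂ G₂} → Frame B₁ G₁ → Frame B₂ G₂ →
    (∀ e → B₁ e ≢ B₂ e → G₁ e ≡ G₂ e) → ∀ e → B₁ e ≡ B₂ e
  basis-unique {B₁} {G₁} {B₂} {G₂} F₁ F₂ agree e = decidable-stable (B₁ e BP.≟ B₂ e) λ differ →
    contradict (start (B₁ e) (B₂ e) (G₁ e) (G₂ e) differ)
    where
    P : Fin n → Pattern
    P f = clashPattern (B₁ f) (B₂ f) (G₁ f) (G₂ f)

    start : ∀ b₁ b₂ g₁ g₂ → b₁ ≢ b₂ → Σ Bool λ b → clashPattern b₁ b₂ g₁ g₂ ≡ one b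
    start true  true  g₁ g₂ differ = ⊥-elim (differ refl)
    start true  false g₁ g₂ differ = not g₂ , refl
    start false true  g₁ g₂ differ = g₁ , refl
    start false false g₁ g₂ differ = ⊥-elim (differ refl)

    good₁ : ∀ b₁ b₂ g₁ g₂ x → Conf (clashPattern b₁ b₂ g₁ g₂) x → b₁ ≡ false → 0ℤ ≤ ε g₁ * x
    good₁ false true  g₁ g₂ x c _ = c
    good₁ false false g₁ g₂ x c _ with g₁ BP.≟ g₂
    ... | yes _ = ≡⇒0≤ (ε*0 g₁ c)
    ... | no _  = c

    good₂ : ∀ b₁ b₂ g₁ g₂ x → Conf (clashPattern b₁ b₂ g₁ g₂) x → b₂ ≡ false → 0ℤ ≤ ε g₂ * (- x)
    good₂ true  false g₁ g₂ x c _ = ≤-resp (ε-not g₂ x) c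
    good₂ false false g₁ g₂ x c _ with g₁ BP.≟ g₂
    ... | yes _  = ≡⇒0≤ (ε*0 g₂ (cong -_ c))
    ... | no g₁≢ = ≤-resp (trans (cong (λ g → ε g * x) (≢⇒not g₁≢)) (ε-not g₂ x)) c

    good₂* : ∀ b₁ b₂ g₁ g₂ x → (b₁ ≢ b₂ → g₁ ≡ g₂) → Conf (dualᵖ (clashPattern b₁ b₂ g₁ g₂)) x → b₂ ≡ true → 0ℤ ≤ ε g₂ * x
    good₂* true  true g₁ g₂ x _  c _ = ≡⇒0≤ (ε*0 g₂ c)
    good₂* false true g₁ g₂ x eq c _ = ≤-resp (cong (λ g → ε g * x) (eq λ ())) c

    good₁* : ∀ b₁ b₂ g₁ g₂ x → (b₁ ≢ b₂ → g₁ ≡ g₂) → Conf (dualᵖ (clashPattern b₁ b₂ g₁ g₂)) x → b₁ ≡ true → 0ℤ ≤ ε g₁ * (- x)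
    good₁* true true  g₁ g₂ x _  c _ = ≡⇒0≤ (ε*0 g₁ (cong -_ c))
    good₁* true false g₁ g₂ x eq c _ = ≤-resp (trans (cong (λ g → ε (not g) * x) (sym (eq λ ()))) (ε-not g₁ x)) c

    open Frame
    contradict : Σ Bool (λ b → P e ≡ one b) → ⊥
    contradict (b , Pe) with Minty.minty pair P e b Pe
    ... | inj₁ (v , ev , ve , conf) = ε≢0 b (trans (sym ve)
      (two-frames pair sig (nullK F₁) (halfK F₁) (nullK F₂) (halfK F₂) (Elementary.member ev)
        (λ f → good₁ (B₁ f) (B₂ f) (G₁ f) (G₂ f) (v f) (conf f))
        (λ f → good₂ (B₁ f) (B₂ f) (G₁ f) (G₂ f) (v f) (conf f)) e))
    ... | inj₂ (w , ew , we , conf) = ε≢0 b (trans (sym we)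
      (two-frames (dual pair) sig* (nullR F₂) (halfR F₂) (nullR F₁) (halfR F₁) (Elementary.member ew)
        (λ f → good₂* (B₁ f) (B₂ f) (G₁ f) (G₂ f) (w f) (agree f) (conf f))
        (λ f → good₁* (B₁ f) (B₂ f) (G₁ f) (G₂ f) (w f) (agree f) (conf f)) e))

-- Compatible orientations come from bases

Settled : Pattern → Set
Settled p = p ≡ none ⊎ p ≡ any

settled-dual : ∀ {p} → Settled p → Settled (dualᵖ p)
settled-dual (inj₁ refl) = inj₂ refl
settled-dual (inj₂ refl) = inj₁ refl

conf-settled-neg : ∀ {p} → Settled p → ∀ {x} → Conf p x → Conf p (- x)
conf-settled-neg (inj₁ refl) eq = cong -_ eq
conf-settled-neg (inj₂ refl) _  = tt

-- Without sign constraints a pattern is invariant under negation, so a conforming elementary vector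
-- would be opposed up to sign. Minty's lemma at a free element `e` must then give a row-space
-- vector that is zero on the other free elements; it meets `v` only in `e`, which forces `v e` to
-- vanish.
null-settled : ∀ {n} {K R S : (Fin n → ℤ) → Set} → RegularPair K R → Signature K S → ∀ P B b →
  (∀ e → Settled (P e)) → (∀ e → P e ≡ none → B e ≡ b) → ¬ Opposed S P → Null K B b
null-settled {n} {K} {R} {S} pair sig P B b settled none⇒b unopposed v kv v-off e =
  decidable-stable (v e ℤP.≟ 0ℤ) nonzero
  where
  open RegularPair pair
  v-none : ∀ f → P f ≡ none → v f ≡ 0ℤ
  v-none f Pf = v-off f (none⇒b f Pf)
  nonzero : ¬ (v e ≢ 0ℤ)
  nonzero ve with settled e
  ... | inj₁ Pe = ve (v-none e Pe)
  ... | inj₂ Pe with Minty.minty pair (update P e (one true)) e true (update-at P e (one true))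
  ...   | inj₁ (c , ec , ce , conf) = oriented (Signature.total sig ec)
    where
    confP : ∀ f → Conf (P f) (c f)
    confP = conf-downdate (λ p → p) P e (one true) {c} conf (subst (λ p → Conf p (c e)) (sym Pe) tt)
    oriented : S c ⊎ S (neg c) → ⊥
    oriented (inj₁ Sc) = unopposed (c , Sc , λ f → conf-settled-neg (settled f) (confP f))
    oriented (inj₂ Sc) = unopposed (neg c , Sc , λ f → subst (Conf (P f)) (sym (ℤP.neg-involutive (c f))) (confP f))
  ...   | inj₂ (w , ew , we , conf) = ve (trans (sym (ℤP.*-identityʳ (v e))) (trans (cong (_*_ (v e)) (sym we))
      (trans (sym (sumFin-single {f = λ f → v f * w f} e elsewhere)) (orthogonal kv (Elementary.member ew)))))
    where
    elsewhere : ∀ f → f ≢ e → v f * w f ≡ 0ℤ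
    elsewhere f f≢e with settled f
    ... | inj₁ Pf = cong (λ x → x * w f) (v-none f Pf)
    ... | inj₂ Pf = trans (cong (_*_ (v f)) (subst (λ p → Conf (dualᵖ p) (w f)) (trans (update-off P f≢e) Pf) (conf f)))
                      (ℤP.*-zeroʳ (v f))

module Compatible {n : ℕ} {K R S S* : (Fin n → ℤ) → Set}
  (pair : RegularPair K R) (sig : Signature K S) (sig* : Signature R S*) where
  open RegularPair pair
  open Frames pair sig sig*

  -- A basis of the minor, presented as a basis of the whole matroid that avoids the deleted
  -- elements and contains the contracted ones; the orientation is prescribed only where a sign
  -- remains.
  FrameFor : (Fin n → Pattern) → Set
  FrameFor P = Σ (Fin n → Bool) λ B → Σ (Fin n → Bool) λ G → Frame B G ×
    (∀ e → P e ≡ none → B e ≡ false) × (∀ e → P e ≡ any → B e ≡ true) × (∀ e b → P e ≡ one b → G e ≡ b)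

  -- Deleting (none) and contracting (any) h cannot both create opposed vectors, by orthogonality. If
  -- neither does and both give the wrong sign at h, the two bases contradict basis-unique; if exactly
  -- one does, the opposed vector it creates contradicts a wrong sign at h of the frame for the other.
  private
    step : ∀ P h b → P h ≡ one b → ¬ Opposed S P → ¬ Opposed S* (λ e → dualᵖ (P e)) →
      (¬ Opposed S* (λ e → dualᵖ (update P h none e)) → FrameFor (update P h none)) →
      (¬ Opposed S (update P h any) → FrameFor (update P h any)) → FrameFor P
    step P h b Ph unopp unopp* deleted contracted
      with Signature.opposed? sig (update P h any) | Signature.opposed? sig* (λ e → dualᵖ (update P h none e))
    ... | dK | dR = decide dK dR
      where
      badK : ∀ {s} → S s → (∀ e → Conf (update P h any e) (- s e)) → ¬ 0ℤ ≤ ε b * (- s h)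
      badK {s} Ss conf ok = unopp (s , Ss , conf-downdate (λ p → p) P h any {neg s} conf
        (subst (λ p → Conf p (- s h)) (sym Ph) ok))
      badR : ∀ {t} → S* t → (∀ e → Conf (dualᵖ (update P h none e)) (- t e)) → ¬ 0ℤ ≤ ε b * (- t h)
      badR {t} St conf ok = unopp* (t , St , conf-downdate dualᵖ P h none {neg t} conf
        (subst (λ p → Conf (dualᵖ p) (- t h)) (sym Ph) ok))
      flipped : ∀ {g x} → g ≢ b → ¬ 0ℤ ≤ ε b * x → 0ℤ ≤ ε g * x
      flipped {g} {x} g≢b neg with 0ℤ ℤP.≤? ε g * x
      ... | yes p = p
      ... | no np = ⊥-elim (absurd (g BP.≟ b))
        where
        opp : ∀ b → ¬ 0ℤ ≤ ε b * x → ¬ 0ℤ ≤ ε (not b) * x → ⊥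
        opp b p q with ℤP.≤-total 0ℤ (ε b * x)
        ... | inj₁ r = p r
        ... | inj₂ r = q (≤-resp (trans (ℤP.neg-distribʳ-* (ε b) x) (sym (ε-not b x))) (ℤP.neg-mono-≤ r))
        absurd : Dec (g ≡ b) → ⊥
        absurd (yes g≡b) = g≢b g≡b
        absurd (no _)    = opp b neg (subst (λ y → ¬ 0ℤ ≤ ε y * x) (≢⇒not g≢b) np)
      accept : ∀ p → (∀ {b} → p ≢ one b) → ((B , G , _) : FrameFor (update P h p)) → G h ≡ b → FrameFor P
      accept p p≢ (B , G , F , del , con , sgn) Gh = B , G , F
        , (λ e Pe → del e (trans (update-off P (off-h Pe λ ())) Pe))
        , (λ e Pe → con e (trans (update-off P (off-h Pe λ ())) Pe))
        , signs
        where
        off-h : ∀ {e q} → P e ≡ q → q ≢ one b → e ≢ h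
        off-h Pe q≢ refl = q≢ (trans (sym Pe) Ph)
        signs : ∀ e b′ → P e ≡ one b′ → G e ≡ b′
        signs e b′ Pe with e FP.≟ h
        ... | yes refl = trans Gh (one-injective (trans (sym Ph) Pe))
          where
          one-injective : ∀ {x y} → one x ≡ one y → x ≡ y
          one-injective refl = refl
        ... | no e≢h = sgn e b′ (trans (update-off P e≢h) Pe)
      contract-clash : ((B , G , _) : FrameFor (update P h any)) → G h ≢ b → ¬ Opposed S* (λ e → dualᵖ (update P h none e))
      contract-clash (B , G , F , del , con , sgn) Gh (t , St , conf) =
        no-opposed-good (dual pair) sig* (Frame.nullR F) (Frame.halfR F) St good
        where
        good : ∀ e → B e ≡ true → 0ℤ ≤ ε (G e) * (- t e)
        good e Be with e FP.≟ h | conf e | del e | sgn e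
        ... | yes refl | _ | _ | _ = flipped Gh (badR St conf)
        ... | no e≢h | c | d | s with P e
        ...   | none  = ⊥-elim (false≢true (d refl) Be)
        ...   | any   = ≡⇒0≤ (ε*0 (G e) c)
        ...   | one b′ = subst (λ g → 0ℤ ≤ ε g * (- t e)) (sym (s b′ refl)) c
      delete-clash : ((B , G , _) : FrameFor (update P h none)) → G h ≢ b → ¬ Opposed S (update P h any)
      delete-clash (B , G , F , del , con , sgn) Gh (s , Ss , conf) =
        no-opposed-good pair sig (Frame.nullK F) (Frame.halfK F) Ss good
        where
        good : ∀ e → B e ≡ false → 0ℤ ≤ ε (G e) * (- s e)
        good e Be with e FP.≟ h | conf e | con e | sgn e
        ... | yes refl | _ | _ | _ = flipped Gh (badK Ss conf)
        ... | no e≢h | c | d | s′ with P e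
        ...   | none  = ≡⇒0≤ (ε*0 (G e) c)
        ...   | any   = ⊥-elim (false≢true Be (d refl))
        ...   | one b′ = subst (λ g → 0ℤ ≤ ε g * (- s e)) (sym (s′ b′ refl)) c
      both-clash : ((_ , G₁ , _) : FrameFor (update P h none)) → ((_ , G₂ , _) : FrameFor (update P h any)) →
        G₁ h ≢ b → G₂ h ≢ b → ⊥
      both-clash (B₁ , G₁ , F₁ , del₁ , con₁ , sgn₁) (B₂ , G₂ , F₂ , del₂ , con₂ , sgn₂) G₁h G₂h =
        false≢true (trans (sym (basis-unique F₁ F₂ agree h)) (del₁ h (update-at P h none))) (con₂ h (update-at P h any))
        where
        agree : ∀ e → B₁ e ≢ B₂ e → G₁ e ≡ G₂ e
        agree e differ with e FP.≟ h | del₁ e | con₁ e | sgn₁ e | del₂ e | con₂ e | sgn₂ e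
        ... | yes refl | _ | _ | _ | _ | _ | _ = trans (≢⇒not G₁h) (sym (≢⇒not G₂h))
        ... | no _ | d₁ | c₁ | s₁ | d₂ | c₂ | s₂ with P e
        ...   | none   = ⊥-elim (differ (trans (d₁ refl) (sym (d₂ refl))))
        ...   | any    = ⊥-elim (differ (trans (c₁ refl) (sym (c₂ refl))))
        ...   | one b′ = trans (s₁ b′ refl) (sym (s₂ b′ refl))
      decide : Dec (Opposed S (update P h any)) → Dec (Opposed S* (λ e → dualᵖ (update P h none e))) → FrameFor P
      decide (yes (s , Ss , confs)) (yes (t , St , conft)) = ⊥-elim (wrong
        (ℤP.i*j≡0⇒i≡0∨j≡0 (- s h) (Minty.opposite-signs pair {neg s} {neg t}
          (negated pair (Elementary.member (Signature.elementary sig Ss)))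
          (negated (dual pair) (Elementary.member (Signature.elementary sig* St))) product h)))
        where
        negated : ∀ {K R} → RegularPair K R → ∀ {u} → K u → K (neg u)
        negated pr {u} ku = RegularPair.K-cong pr (λ e → ℤP.-1*i≡-i (u e)) (RegularPair.K-* pr -1ℤ ku)
        product : ∀ e → 0ℤ ≤ (- s e) * (- t e)
        product e with e FP.≟ h | confs e | conft e
        ... | yes refl | _  | _  = ≤-resp (ε*ε-product b (- s h) (- t h)) (*-nonneg-neg (badK Ss confs) (badR St conft))
        ... | no _     | cs | ct = conf-product (P e) cs ct
        wrong : - s h ≡ 0ℤ ⊎ - t h ≡ 0ℤ → ⊥
        wrong (inj₁ z) = badK Ss confs (≡⇒0≤ (ε*0 b z))
        wrong (inj₂ z) = badR St conft (≡⇒0≤ (ε*0 b z))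
      decide (yes opp) (no ¬opp*) with deleted ¬opp*
      ... | F@(_ , G , _) with G h BP.≟ b
      ...   | yes Gh = accept none (λ ()) F Gh
      ...   | no Gh  = ⊥-elim (delete-clash F Gh opp)
      decide (no ¬opp) (yes opp*) with contracted ¬opp
      ... | F@(_ , G , _) with G h BP.≟ b
      ...   | yes Gh = accept any (λ ()) F Gh
      ...   | no Gh  = ⊥-elim (contract-clash F Gh opp*)
      decide (no ¬opp) (no ¬opp*) with deleted ¬opp* | contracted ¬opp
      ... | F₁@(_ , G₁ , _) | F₂@(_ , G₂ , _) with G₁ h BP.≟ b | G₂ h BP.≟ b
      ...   | yes Gh | _      = accept none (λ ()) F₁ Gh
      ...   | no _   | yes Gh = accept any (λ ()) F₂ Gh
      ...   | no G₁h | no G₂h = ⊥-elim (both-clash F₁ F₂ G₁h G₂h)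

    -- Deletion can spoil only the cocircuit condition, because a zero entry at `h` satisfies any
    -- earlier constraint there. Dually, contraction can spoil only the circuit condition. So one
    -- condition per branch has to be tested.
    delete-unopposed : ∀ P h → ¬ Opposed S P → ¬ Opposed S (update P h none)
    delete-unopposed P h unopp (s , Ss , conf) = unopp (s , Ss , conf-downdate (λ p → p) P h none {neg s} conf
      (conf-0 (P h) (subst (λ p → Conf p (- s h)) (update-at P h none) (conf h))))

    contract-unopposed : ∀ P h → ¬ Opposed S* (λ e → dualᵖ (P e)) → ¬ Opposed S* (λ e → dualᵖ (update P h any e))
    contract-unopposed P h unopp (t , St , conf) = unopp (t , St , conf-downdate dualᵖ P h any {neg t} conf
      (conf-0 (dualᵖ (P h)) (subst (λ p → Conf (dualᵖ p) (- t h)) (update-at P h any) (conf h))))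

  frame-for : ∀ l P → (∀ e → (e ∈ˡ l) ⊎ Settled (P e)) →
    ¬ Opposed S P → ¬ Opposed S* (λ e → dualᵖ (P e)) → FrameFor P
  frame-for [] P todo unopp unopp* =
    B , proj₁ framed , proj₂ framed , B-none , B-any , λ e b Pe → ⊥-elim (no-one (settled e) Pe)
    where
    settled : ∀ e → Settled (P e)
    settled e with todo e
    ... | inj₂ s = s
    isAny : Pattern → Bool
    isAny any     = true
    isAny none    = false
    isAny (one _) = false
    B : Fin n → Bool
    B e = isAny (P e)
    B-none : ∀ e → P e ≡ none → B e ≡ false
    B-none e Pe = cong isAny Pe
    B-any : ∀ e → P e ≡ any → B e ≡ true
    B-any e Pe = cong isAny Pe
    no-one : ∀ {p b} → Settled p → p ≢ one b
    no-one (inj₁ refl) ()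
    no-one (inj₂ refl) ()
    dual-none : ∀ e → dualᵖ (P e) ≡ none → B e ≡ true
    dual-none e eq with P e
    ... | any = refl
    framed : Σ (Fin n → Bool) (Frame B)
    framed = frame-exists B (null-settled pair sig P B false settled B-none unopp)
      (null-settled (dual pair) sig* (λ e → dualᵖ (P e)) B true (λ e → settled-dual (settled e)) dual-none unopp*)
  frame-for (h ∷ l) P todo unopp unopp* with P h in Ph
  ... | none = frame-for l P todo′ unopp unopp*
    where
    todo′ : ∀ e → (e ∈ˡ l) ⊎ Settled (P e)
    todo′ e with todo e
    ... | inj₁ (here refl) = inj₂ (inj₁ Ph)
    ... | inj₁ (there m)   = inj₁ m
    ... | inj₂ s           = inj₂ s
  ... | any = frame-for l P todo′ unopp unopp*
    where
    todo′ : ∀ e → (e ∈ˡ l) ⊎ Settled (P e)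
    todo′ e with todo e
    ... | inj₁ (here refl) = inj₂ (inj₂ Ph)
    ... | inj₁ (there m)   = inj₁ m
    ... | inj₂ s           = inj₂ s
  ... | one b = step P h b Ph unopp unopp*
    (λ unopp*′ → frame-for l (update P h none) (todo′ none (inj₁ refl)) (delete-unopposed P h unopp) unopp*′)
    (λ unopp′ → frame-for l (update P h any) (todo′ any (inj₂ refl)) unopp′ (contract-unopposed P h unopp*))
    where
    todo′ : ∀ p → Settled p → ∀ e → (e ∈ˡ l) ⊎ Settled (update P h p e)
    todo′ p sp e with e FP.≟ h | todo e
    ... | yes _  | _                = inj₂ sp
    ... | no e≢h | inj₁ (here e≡h)  = ⊥-elim (e≢h e≡h)
    ... | no _   | inj₁ (there m)   = inj₁ m
    ... | no _   | inj₂ s           = inj₂ s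

  compatible⇒frame : ∀ (O : Fin n → Bool) → ¬ Opposed S (λ e → one (O e)) → ¬ Opposed S* (λ e → one (O e)) →
    Σ (Fin n → Bool) λ B → Σ (Fin n → Bool) λ G → Frame B G × (∀ e → G e ≡ O e)
  compatible⇒frame O unopp unopp* with frame-for (List.allFin n) (λ e → one (O e)) (λ e → inj₁ (∈-allFin e)) unopp unopp*
  ... | B , G , F , _ , _ , signs = B , G , F , λ e → signs e (O e) refl

-- Reversal to a compatible orientation

-- Strict orders on a finite type are well founded, so orientations are coded as numbers below
-- `2 ^ n`; the same coding later serves to count them against subsets.
decode : ∀ {n} → Fin (2 ℕ.^ n) → Fin n → Bool
decode i e = Inverse.to FP.2↔Bool (finToFun i e)

encode : ∀ {n} → (Fin n → Bool) → Fin (2 ℕ.^ n)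
encode O = funToFin (λ e → Inverse.from FP.2↔Bool (O e))

decode-encode : ∀ {n} (O : Fin n → Bool) e → decode (encode O) e ≡ O e
decode-encode O e = trans
  (cong (Inverse.to FP.2↔Bool) (FP.finToFun-funToFin (λ e → Inverse.from FP.2↔Bool (O e)) e))
  (Inverse.strictlyInverseˡ FP.2↔Bool (O e))

-- o arises from o′ by reversing at this element a vector with entry x, taken with the sign it has in o′.
data Reversed (o o′ : Bool) (x : ℤ) : Set where
  fixed   : o ≡ o′ → x ≡ 0ℤ → Reversed o o′ x
  flipped : o ≡ not o′ → x ≡ ε o′ → Reversed o o′ x

-ε : ∀ b → - ε b ≡ ε (not b)
-ε true  = refl
-ε false = refl

-- An element reversed twice gets opposite entries, each taken with the sign of its own target, so
-- they cancel and the amounts add along a sequence of reversals.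
reversed-trans : ∀ {a b c x y} → Reversed a b x → Reversed b c y → Reversed a c (x + y)
reversed-trans (fixed refl refl)   (fixed refl refl)   = fixed refl refl
reversed-trans (fixed refl refl)   (flipped refl refl) = flipped refl (ℤP.+-identityˡ _)
reversed-trans (flipped refl refl) (fixed refl refl)   = flipped refl (ℤP.+-identityʳ _)
reversed-trans {c = c} (flipped refl refl) (flipped refl refl) = fixed (BP.not-involutive c)
  (trans (cong (λ x → x + ε c) (sym (-ε c))) (ℤP.+-inverseˡ (ε c)))

reversed-irrefl : ∀ {a x} → Reversed a a x → x ≡ 0ℤ
reversed-irrefl (fixed _ x≡0) = x≡0
reversed-irrefl (flipped eq _) = ⊥-elim (not-self eq)

reversed-nonneg : ∀ {a b x} → Reversed a b x → 0ℤ ≤ ε b * x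
reversed-nonneg {b = b} (fixed _ x≡0)   = ≡⇒0≤ (ε*0 b x≡0)
reversed-nonneg {b = b} (flipped _ refl) = ≤-resp (sym (ε*ε b)) (+≤+ ℕ.z≤n)

module Reversal {n : ℕ} {K R S : (Fin n → ℤ) → Set} (pair : RegularPair K R) (sig : Signature K S) where
  open RegularPair pair
  open Signature sig

  -- The partial sums of a sequence of reversals lie in the cone of the acyclic signature, so no orientation recurs.
  private
    _⊏_ : Fin (2 ℕ.^ n) → Fin (2 ℕ.^ n) → Set
    j ⊏ i = Σ (Fin n → ℤ) λ k → Cone S k × (Σ (Fin n) λ e → k e ≢ 0ℤ) × (∀ e → Reversed (decode {n} i e) (decode {n} j e) (k e))

    ⊏-trans : ∀ {i j l} → i ⊏ j → j ⊏ l → i ⊏ l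
    ⊏-trans {i} {j} {l} (k , ck , _ , rev) (k′ , ck′ , (e , k′e) , rev′) =
      (λ f → k′ f + k f) , cone-sum ck′ ck , decided , λ f → reversed-trans (rev′ f) (rev f)
      where
      negated : (∀ f → k′ f + k f ≡ 0ℤ) → ∀ f → k f ≡ - k′ f
      negated z f = trans (solve-for (k′ f) (k f)) (trans (cong (λ x → x - k′ f) (z f)) (ℤP.+-identityˡ (- k′ f)))
        where
        solve-for : ∀ x y → y ≡ (x + y) - x
        solve-for = solve-∀
      decided : Σ (Fin n) λ f → k′ f + k f ≢ 0ℤ
      decided with FP.any? (λ f → ¬? (k′ f + k f ℤP.≟ 0ℤ))
      ... | yes p = p
      ... | no vanish = ⊥-elim (k′e (acyclic ck′ (cone-cong (negated λ f →
        decidable-stable (k′ f + k f ℤP.≟ 0ℤ) λ nz → vanish (f , nz)) ck) e))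

    ⊏-wellFounded : WellFounded _⊏_
    ⊏-wellFounded = FI.spo-wellFounded {_≈_ = _≡_} record
      { isEquivalence = isEquivalence
      ; irrefl = λ { {i} refl (k , _ , (e , ke) , rev) → ke (reversed-irrefl (rev e)) }
      ; trans = λ {i} {j} {l} → ⊏-trans {i} {j} {l}
      ; <-resp-≈ = (λ { refl p → p }) , λ { refl p → p }
      }

  -- `shift` is the sum of all reversed circuits. It remembers exactly which elements end up
  -- reversed, so the sequence of reversals can be forgotten.
  record Unopposing (O : Fin n → Bool) : Set where
    field
      target    : Fin n → Bool
      shift     : Fin n → ℤ
      member    : K shift
      unopposed : ¬ Opposed S (λ e → one (target e))
      reversed  : ∀ e → Reversed (O e) (target e) (shift e)

  private
    toggle : ℤ → Bool → Bool
    toggle x b with x ℤP.≟ 0ℤ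
    ... | yes _ = b
    ... | no _  = not b

    toggle-reversed : ∀ {x} b → IsSign x → 0ℤ ≤ ε b * (- x) → Reversed b (toggle x b) x
    toggle-reversed     b     (inj₁ refl)        _ = fixed refl refl
    toggle-reversed     false (inj₂ (inj₁ refl)) _ = flipped refl refl
    toggle-reversed     true  (inj₂ (inj₂ refl)) _ = flipped refl refl
    toggle-reversed     true  (inj₂ (inj₁ refl)) ()
    toggle-reversed     false (inj₂ (inj₂ refl)) ()

    go : ∀ i → Acc _⊏_ i → Unopposing (decode {n} i)
    go i (acc rec) with opposed? (λ e → one (decode {n} i e))
    ... | no unopp = record { target = decode {n} i ; shift = λ _ → 0ℤ ; member = K-0
                            ; unopposed = unopp ; reversed = λ _ → fixed refl refl }
    ... | yes (s , Ss , conf) = record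
      { target = target ; shift = λ e → s e + shift e
      ; member = K-+ (Elementary.member (elementary Ss)) member
      ; unopposed = unopposed ; reversed = λ e → reversed-trans (step e) (reversed e) }
      where
      j : Fin (2 ℕ.^ n)
      j = encode (λ e → toggle (s e) (decode {n} i e))
      step : ∀ e → Reversed (decode {n} i e) (decode {n} j e) (s e)
      step e = subst (λ b → Reversed (decode {n} i e) b (s e)) (sym (decode-encode (λ e → toggle (s e) (decode {n} i e)) e))
        (toggle-reversed (decode {n} i e) (Elementary.signed (elementary Ss) e) (conf e))
      open Unopposing (go j (rec {j} (s , cone-generator Ss , Elementary.point (elementary Ss) , step)))

    transport : ∀ {O O′} → (∀ e → O e ≡ O′ e) → Unopposing O → Unopposing O′
    transport eq U = record
      { target = target ; shift = shift ; member = member ; unopposed = unopposed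
      ; reversed = λ e → subst (λ b → Reversed b (target e) (shift e)) (eq e) (reversed e) }
      where open Unopposing U

  abstract
    unopposing : ∀ O → Unopposing O
    unopposing O = transport (decode-encode O) (go (encode O) (⊏-wellFounded (encode O)))

-- Conformal decomposition into disjoint elementary vectors

patternOf : ℤ → Pattern
patternOf (+ zero)  = none
patternOf +[1+ _ ]  = one true
patternOf -[1+ _ ]  = one false

patternOf-conf : ∀ x → Conf (patternOf x) x
patternOf-conf (+ zero)  = refl
patternOf-conf +[1+ m ]  = ≤-resp (sym (ℤP.*-identityˡ +[1+ m ])) (+≤+ ℕ.z≤n)
patternOf-conf -[1+ m ]  = ≤-resp (sym (ℤP.-1*i≡-i -[1+ m ])) (+≤+ ℕ.z≤n)

patternOf-sign : ∀ {x c} → IsSign x → IsSign c → Conf (patternOf x) c → c ≡ 0ℤ ⊎ c ≡ x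
patternOf-sign (inj₁ refl)         _                   c≡0 = inj₁ c≡0
patternOf-sign _                   (inj₁ refl)         _   = inj₁ refl
patternOf-sign (inj₂ (inj₁ refl)) (inj₂ (inj₁ refl)) _   = inj₂ refl
patternOf-sign (inj₂ (inj₂ refl)) (inj₂ (inj₂ refl)) _   = inj₂ refl
patternOf-sign (inj₂ (inj₁ refl)) (inj₂ (inj₂ refl)) ()
patternOf-sign (inj₂ (inj₂ refl)) (inj₂ (inj₁ refl)) ()

patternOf-one : ∀ {x} → IsSign x → x ≢ 0ℤ → Σ Bool λ b → patternOf x ≡ one b × x ≡ ε b
patternOf-one (inj₁ x≡0)          x≢0 = ⊥-elim (x≢0 x≡0)
patternOf-one (inj₂ (inj₁ refl)) _   = true , refl , refl
patternOf-one (inj₂ (inj₂ refl)) _   = false , refl , refl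

module Conformal {n : ℕ} {K R : (Fin n → ℤ) → Set} (pair : RegularPair K R) where
  open RegularPair pair

  Part : (Fin n → ℤ) → (Fin n → ℤ) → Set
  Part k c = ∀ e → c e ≡ 0ℤ ⊎ c e ≡ k e

  Apart : (Fin n → ℤ) → (Fin n → ℤ) → Set
  Apart c d = ∀ e → c e ≡ 0ℤ ⊎ d e ≡ 0ℤ

  record Parts (k : Fin n → ℤ) : Set where
    field
      list       : List (Fin n → ℤ)
      elementary : All (Elementary K) list
      parts      : All (Part k) list
      apart      : AllPairs Apart list
      covering   : ∀ e → k e ≢ 0ℤ → Any (λ c → c e ≢ 0ℤ) list

  -- Minty's lemma for the sign pattern of `k` itself: a row-space answer would have nonnegative
  -- products with `k` and a nonzero one at `e`. As all entries are signs, a conforming elementary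
  -- vector is a restriction of `k`.
  elementary-part : ∀ {k} → (∀ e → IsSign (k e)) → K k → ∀ e → k e ≢ 0ℤ →
    Σ (Fin n → ℤ) λ c → Elementary K c × Part k c × c e ≡ k e
  elementary-part {k} signed kk e ke with patternOf-one (signed e) ke
  ... | b , Pe , kb with Minty.minty pair (λ f → patternOf (k f)) e b Pe
  ...   | inj₁ (c , ec , ce , conf) =
    c , ec , (λ f → patternOf-sign (signed f) (Elementary.signed ec f) (conf f)) , trans ce (sym kb)
  ...   | inj₂ (w , ew , we , conf) = ⊥-elim (nonzero (ℤP.i*j≡0⇒i≡0∨j≡0 (k e) (Minty.opposite-signs pair {k} {w} kk
    (Elementary.member ew) (λ f → conf-product (patternOf (k f)) (patternOf-conf (k f)) (conf f)) e)))
    where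
    nonzero : k e ≡ 0ℤ ⊎ w e ≡ 0ℤ → ⊥
    nonzero (inj₁ z) = ke z
    nonzero (inj₂ z) = ε≢0 b (trans (sym we) z)

  decompose : ∀ {k} → (∀ e → IsSign (k e)) → K k → Parts k
  decompose signed kk = go (List.allFin n) signed kk (λ e _ → ∈-allFin e)
    where
    go : ∀ l {k} → (∀ e → IsSign (k e)) → K k → (∀ e → k e ≢ 0ℤ → e ∈ˡ l) → Parts k
    go [] {k} signed kk todo = record
      { list = [] ; elementary = [] ; parts = [] ; apart = [] ; covering = λ e ke → ⊥-elim (absurd (todo e ke)) }
      where
      absurd : ∀ {e} → e ∈ˡ [] → ⊥
      absurd ()
    go (h ∷ l) {k} signed kk todo with k h ℤP.≟ 0ℤ
    ... | yes kh = go l signed kk λ e ke → Any.tail (λ { refl → ke kh }) (todo e ke)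
    ... | no kh with elementary-part signed kk h kh
    ...   | c , ec , part , ch = record
      { list       = c ∷ list
      ; elementary = ec ∷ elementary
      ; parts      = part ∷ All.map (λ p e → widen (part e) (p e)) parts
      ; apart      = All.map (λ p e → separate (part e) (p e)) parts ∷ apart
      ; covering   = covering′
      }
      where
      -- Since `c` equals `k` on its own support, subtracting it only erases those entries; hence
      -- the later parts are disjoint from `c`.
      k′ : Fin n → ℤ
      k′ e = k e + -1ℤ * c e
      k′-zero : ∀ {e} → c e ≡ k e → k′ e ≡ 0ℤ
      k′-zero {e} eq = trans (cong (λ x → k e + -1ℤ * x) eq) (cancel (k e))
        where
        cancel : ∀ x → x + -1ℤ * x ≡ 0ℤ
        cancel = solve-∀
      k′-keep : ∀ {e} → c e ≡ 0ℤ → k′ e ≡ k e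
      k′-keep {e} eq = trans (cong (λ x → k e + -1ℤ * x) eq) (ℤP.+-identityʳ (k e))
      signed′ : ∀ e → IsSign (k′ e)
      signed′ e with part e
      ... | inj₁ c≡0 = subst IsSign (sym (k′-keep c≡0)) (signed e)
      ... | inj₂ c≡k = inj₁ (k′-zero c≡k)
      todo′ : ∀ e → k′ e ≢ 0ℤ → e ∈ˡ l
      todo′ e k′e with part e
      ... | inj₂ c≡k = ⊥-elim (k′e (k′-zero c≡k))
      ... | inj₁ c≡0 = Any.tail (λ { refl → kh (trans (sym ch) c≡0) }) (todo e λ ke → k′e (trans (k′-keep c≡0) ke))
      open Parts (go l {k′} signed′ (K-+ kk (K-* -1ℤ (Elementary.member ec))) todo′)
      widen : ∀ {e x} → c e ≡ 0ℤ ⊎ c e ≡ k e → x ≡ 0ℤ ⊎ x ≡ k′ e → x ≡ 0ℤ ⊎ x ≡ k e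
      widen _          (inj₁ x≡0)  = inj₁ x≡0
      widen (inj₁ c≡0) (inj₂ x≡k′) = inj₂ (trans x≡k′ (k′-keep c≡0))
      widen (inj₂ c≡k) (inj₂ x≡k′) = inj₁ (trans x≡k′ (k′-zero c≡k))
      separate : ∀ {e x} → c e ≡ 0ℤ ⊎ c e ≡ k e → x ≡ 0ℤ ⊎ x ≡ k′ e → c e ≡ 0ℤ ⊎ x ≡ 0ℤ
      separate (inj₁ c≡0) _           = inj₁ c≡0
      separate _          (inj₁ x≡0)  = inj₂ x≡0
      separate (inj₂ c≡k) (inj₂ x≡k′) = inj₂ (trans x≡k′ (k′-zero c≡k))
      covering′ : ∀ e → k e ≢ 0ℤ → Any (λ d → d e ≢ 0ℤ) (c ∷ list)
      covering′ e ke with part e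
      ... | inj₂ c≡k = here λ c≡0 → ke (trans (sym c≡k) c≡0)
      ... | inj₁ c≡0 = there (covering e λ k′e → ke (trans (sym (k′-keep c≡0)) k′e))

-- o is the orientation and o′ the compatible orientation at an element, x and y the entries there of the sums
-- of the circuits and of the cocircuits that are reversed.
data Cell (o o′ : Bool) (x y : ℤ) : Set where
  kept   : o ≡ o′     → x ≡ 0ℤ   → y ≡ 0ℤ   → Cell o o′ x y
  circ   : o ≡ not o′ → x ≡ ε o′ → y ≡ 0ℤ   → Cell o o′ x y
  cocirc : o ≡ not o′ → x ≡ 0ℤ   → y ≡ ε o′ → Cell o o′ x y

module Resolution {n : ℕ} {K R S S* : (Fin n → ℤ) → Set}
  (pair : RegularPair K R) (sig : Signature K S) (sig* : Signature R S*) where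
  open RegularPair pair

  record Resolved (O : Fin n → Bool) : Set where
    field
      target     : Fin n → Bool
      circuits   : Fin n → ℤ
      cocircuits : Fin n → ℤ
      in-K       : K circuits
      in-R       : R cocircuits
      unopposed  : ¬ Opposed S (λ e → one (target e))
      unopposed* : ¬ Opposed S* (λ e → one (target e))
      cells      : ∀ e → Cell (O e) (target e) (circuits e) (cocircuits e)

  -- Vectors of K and R whose sign patterns fit a common orientation have disjoint supports, so
  -- reversing cocircuits neither creates nor destroys circuits.
  resolve : ∀ O → Resolved O
  resolve O = record
    { target = O₂ ; circuits = k ; cocircuits = r ; in-K = First.member ; in-R = Second.member
    ; unopposed = unopposed ; unopposed* = Second.unopposed ; cells = cells }
    where
    module First = Reversal.Unopposing (Reversal.unopposing pair sig O)
    module Second = Reversal.Unopposing (Reversal.unopposing (dual pair) sig* First.target)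
    O₁ O₂ : Fin n → Bool
    O₁ = First.target
    O₂ = Second.target
    k r : Fin n → ℤ
    k = First.shift
    r = Second.shift
    common-orientation : ∀ {v w} → K v → R w → (∀ e → 0ℤ ≤ ε (O₂ e) * v e) → (∀ e → 0ℤ ≤ ε (O₂ e) * w e) → ∀ e → v e ≡ 0ℤ ⊎ w e ≡ 0ℤ
    common-orientation {v} {w} kv rw gv gw e = ℤP.i*j≡0⇒i≡0∨j≡0 (v e) (Minty.opposite-signs pair {v} {w} kv rw
      (λ f → ≤-resp (ε*ε-product (O₂ f) (v f) (w f)) (*-nonneg (gv f) (gw f))) e)
    unopposed : ¬ Opposed S (λ e → one (O₂ e))
    unopposed (s , Ss , conf) = First.unopposed (s , Ss , good)
      where
      s≡0∨r≡0 : ∀ e → - s e ≡ 0ℤ ⊎ r e ≡ 0ℤ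
      s≡0∨r≡0 = common-orientation {neg s} {r}
        (K-cong (λ e → ℤP.-1*i≡-i (s e)) (K-* -1ℤ (Elementary.member (Signature.elementary sig Ss))))
        Second.member conf (λ e → reversed-nonneg (Second.reversed e))
      good : ∀ e → 0ℤ ≤ ε (O₁ e) * (- s e)
      good e with Second.reversed e | s≡0∨r≡0 e
      ... | fixed eq _    | _        = subst (λ b → 0ℤ ≤ ε b * (- s e)) (sym eq) (conf e)
      ... | flipped _ _   | inj₁ s≡0 = ≡⇒0≤ (ε*0 (O₁ e) s≡0)
      ... | flipped _ req | inj₂ r≡0 = ⊥-elim (ε≢0 (O₂ e) (trans (sym req) r≡0))
    -- At an element flipped in both stages `k` has the sign of `O₁` and `r` that of `O₂`, which are
    -- opposite there. So `- k` and `r` never clash, and orthogonality rules out double flips.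
    k*r : ∀ e → 0ℤ ≤ (- k e) * r e
    k*r e with First.reversed e | Second.reversed e
    ... | fixed _ k≡0 | _           = ≡⇒0≤ (cong (λ x → (- x) * r e) k≡0)
    ... | flipped _ _ | fixed _ r≡0 = ≡⇒0≤ (trans (cong (_*_ (- k e)) r≡0) (ℤP.*-zeroʳ (- k e)))
    ... | flipped _ keq | flipped eq req = ≤-resp (sym (trans
      (cong₂ _*_ (trans (cong -_ (trans keq (cong ε eq))) (trans (-ε (not (O₂ e))) (cong ε (BP.not-involutive (O₂ e))))) req)
      (ε*ε (O₂ e)))) (+≤+ ℕ.z≤n)
    k≡0∨r≡0 : ∀ e → - k e ≡ 0ℤ ⊎ r e ≡ 0ℤ
    k≡0∨r≡0 e = ℤP.i*j≡0⇒i≡0∨j≡0 (- k e) (Minty.opposite-signs pair {neg k} {r}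
      (K-cong (λ e → ℤP.-1*i≡-i (k e)) (K-* -1ℤ First.member)) Second.member k*r e)
    cells : ∀ e → Cell (O e) (O₂ e) (k e) (r e)
    cells e with First.reversed e | Second.reversed e | k≡0∨r≡0 e
    ... | fixed o≡ k≡0   | fixed o₁≡ r≡0   | _ = kept (trans o≡ o₁≡) k≡0 r≡0
    ... | fixed o≡ k≡0   | flipped o₁≡ r≡ε | _ = cocirc (trans o≡ o₁≡) k≡0 r≡ε
    ... | flipped o≡ k≡ε | fixed o₁≡ r≡0   | _ = circ (trans o≡ (cong not o₁≡)) (trans k≡ε (cong ε o₁≡)) r≡0
    ... | flipped _ k≡ε  | flipped _ _     | inj₁ -k≡0 =
      ⊥-elim (ε≢0 (O₁ e) (trans (sym k≡ε) (trans (sym (ℤP.neg-involutive (k e))) (cong -_ -k≡0))))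
    ... | flipped _ _    | flipped _ r≡ε   | inj₂ r≡0 = ⊥-elim (ε≢0 (O₂ e) (trans (sym r≡ε) r≡0))

-- Circuits and signatures of the matroid

regularPair : ∀ {r n} (A : Fin r → Fin n → ℤ) → TotallyUnimodular A → RegularPair (Kernel A) (RowSpan A)
regularPair {r} {n} A tu = record
  { K-0 = λ i → sumFin-0 λ j → ℤP.*-zeroʳ (A i j) ; K-+ = Kernel-+ A ; K-* = Kernel-* A ; K-cong = Kernel-cong A
  ; R-0 = RowSpan-* A 0ℤ {λ _ → 0ℤ} (RowSpan-sum A {zero} (λ ()) λ ())
  ; R-+ = RowSpan-+ A ; R-* = RowSpan-* A ; R-cong = RowSpan-cong A
  ; orthogonal = Kernel⊥RowSpan A
  ; alternative = λ D e → restrict D e (kernel-or-rowSpan A tu (without D e) e (without-self D e))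
  }
  where
  without-self : ∀ D (e : Fin n) → without D e e ≡ false
  without-self D e with e FP.≟ e
  ... | yes _  = refl
  ... | no e≢e = ⊥-elim (e≢e refl)
  restrict : ∀ D e →
    (Σ (Fin n → ℤ) λ v → Kernel A v × v e ≡ 1ℤ × (∀ f → f ≢ e → without D e f ≡ false → v f ≡ 0ℤ)) ⊎
    (Σ (Fin n → ℤ) λ w → RowSpan A w × w e ≡ 1ℤ × (∀ f → without D e f ≡ true → w f ≡ 0ℤ)) →
    (Σ (Fin n → ℤ) λ v → Kernel A v × v e ≡ 1ℤ × (∀ f → f ≢ e → D f ≡ false → v f ≡ 0ℤ)) ⊎
    (Σ (Fin n → ℤ) λ w → RowSpan A w × w e ≡ 1ℤ × (∀ f → f ≢ e → D f ≡ true → w f ≡ 0ℤ))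
  restrict D e (inj₁ (v , kv , ve , off)) = inj₁ (v , kv , ve , λ f f≢e Df → off f f≢e (without-false D Df))
  restrict D e (inj₂ (w , rw , we , on))  = inj₂ (w , rw , we , λ f f≢e Df → on f (without-keep D Df f≢e))

∈⇒true : ∀ {n} {p : Subset n} {e} → e ∈ p → lookup p e ≡ true
∈⇒true = VP.[]=⇒lookup

true⇒∈ : ∀ {n} {p : Subset n} {e} → lookup p e ≡ true → e ∈ p
true⇒∈ {p = p} {e} = VP.lookup⇒[]= e p

∉⇒false : ∀ {n} {p : Subset n} {e} → e ∉ p → lookup p e ≡ false
∉⇒false e∉p = ≢⇒not λ eq → e∉p (true⇒∈ eq)

false⇒∉ : ∀ {n} {p : Subset n} {e} → lookup p e ≡ false → e ∉ p
false⇒∉ eq e∈p = false≢true eq (∈⇒true e∈p)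

vec-ext : ∀ {X : Set} {n} {u v : Vec X n} → (∀ e → lookup u e ≡ lookup v e) → u ≡ v
vec-ext {u = u} {v} h = trans (sym (VP.tabulate∘lookup u)) (trans (VP.tabulate-cong h) (VP.tabulate∘lookup v))

≡0-vec : ∀ {n} {v : Vec ℤ n} → (∀ e → lookup v e ≡ 0ℤ) → v ≡ replicate n 0ℤ
≡0-vec h = vec-ext λ e → trans (h e) (sym (VP.lookup-replicate e 0ℤ))

≢0-vec : ∀ {n} {v : Vec ℤ n} e → lookup v e ≢ 0ℤ → v ≢ replicate n 0ℤ
≢0-vec e ve v≡0 = ve (trans (cong (λ u → lookup u e) v≡0) (VP.lookup-replicate e 0ℤ))

nonzero-entry : ∀ {n} {v : Vec ℤ n} → v ≢ replicate n 0ℤ → Σ (Fin n) λ e → lookup v e ≢ 0ℤ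
nonzero-entry {v = v} v≢0 with FP.any? (λ e → ¬? (lookup v e ℤP.≟ 0ℤ))
... | yes p     = p
... | no vanish = ⊥-elim (v≢0 (≡0-vec λ e → decidable-stable (lookup v e ℤP.≟ 0ℤ) λ ve → vanish (e , ve)))

not-isZero : ∀ x → not (isZero x) ≡ false → x ≡ 0ℤ
not-isZero (+ zero)  _ = refl

isZero-not : ∀ x → x ≢ 0ℤ → not (isZero x) ≡ true
isZero-not (+ zero)  x≢0 = ⊥-elim (x≢0 refl)
isZero-not +[1+ _ ]  _   = refl
isZero-not -[1+ _ ]  _   = refl

support-lookup : ∀ {n} (v : Vec ℤ n) e → lookup (support v) e ≡ not (isZero (lookup v e))
support-lookup v e = VP.lookup-map e (λ x → not (isZero x)) v

support-false : ∀ {n} (v : Vec ℤ n) {e} → lookup (support v) e ≡ false → lookup v e ≡ 0ℤ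
support-false v {e} eq = not-isZero (lookup v e) (trans (sym (support-lookup v e)) eq)

support-true : ∀ {n} (v : Vec ℤ n) {e} → lookup v e ≢ 0ℤ → e ∈ support v
support-true v {e} ve = true⇒∈ (trans (support-lookup v e) (isZero-not (lookup v e) ve))

∈support : ∀ {n} (v : Vec ℤ n) {e} → e ∈ support v → lookup v e ≢ 0ℤ
∈support v {e} e∈v ve = false≢true (trans (support-lookup v e) (cong (λ x → not (isZero x)) ve)) (∈⇒true e∈v)

∉support : ∀ {n} (v : Vec ℤ n) {e} → e ∉ support v → lookup v e ≡ 0ℤ
∉support v e∉v = support-false v (∉⇒false e∉v)

support-cong : ∀ {n} {u v : Vec ℤ n} → (∀ e → isZero (lookup u e) ≡ isZero (lookup v e)) → support u ≡ support v
support-cong {u = u} {v} h = vec-ext λ e → trans (support-lookup u e) (trans (cong not (h e)) (sym (support-lookup v e)))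

isZero-neg : ∀ x → isZero (- x) ≡ isZero x
isZero-neg (+ zero)  = refl
isZero-neg +[1+ _ ]  = refl
isZero-neg -[1+ _ ]  = refl

-- For K = Kernel A and K = RowSpan A the next three notions unfold to the same types as the ones of Matroid A.
DependentIn : ∀ {n} → ((Fin n → ℤ) → Set) → Subset n → Set
DependentIn {n} K D = Σ (Vec ℤ n) λ v → K (lookup v) × v ≢ replicate n 0ℤ × support v ⊆ D

CircuitIn : ∀ {n} → ((Fin n → ℤ) → Set) → Subset n → Set
CircuitIn K C = DependentIn K C × (∀ D → D ⊂ C → ¬ DependentIn K D)

SignedCircuitIn : ∀ {n} → ((Fin n → ℤ) → Set) → Vec ℤ n → Set
SignedCircuitIn K v = IsSignVec v × K (lookup v) × CircuitIn K (support v)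

module Circuits {n : ℕ} {K R : (Fin n → ℤ) → Set} (pair : RegularPair K R) where
  open RegularPair pair

  elementary⇒signed : ∀ v → Elementary K (lookup v) → SignedCircuitIn K v
  elementary⇒signed v ev = signed , member , (v , member , ≢0-vec (proj₁ point) (proj₂ point) , λ p → p) , least
    where
    open Elementary ev
    least : ∀ D → D ⊂ support v → ¬ DependentIn K D
    least D (D⊆v , g , g∈v , g∉D) (u , ku , u≢0 , u⊆D) = u≢0 (≡0-vec (minimal (lookup u) ku
      (λ f vf → ∉support u λ f∈u → ∈support v (D⊆v (u⊆D f∈u)) vf) g (∈support v g∈v) (∉support u λ g∈u → g∉D (u⊆D g∈u))))

  signed⇒elementary : ∀ v → SignedCircuitIn K v → Elementary K (lookup v)
  signed⇒elementary v (signed , kv , (w , kw , w≢0 , w⊆v) , least) = record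
    { signed = signed ; member = kv
    ; point = let (e , we) = nonzero-entry w≢0 in e , ∈support v (w⊆v (support-true w we))
    ; minimal = minimal }
    where
    minimal : ∀ u → K u → (∀ f → lookup v f ≡ 0ℤ → u f ≡ 0ℤ) → ∀ g → lookup v g ≢ 0ℤ → u g ≡ 0ℤ → ∀ f → u f ≡ 0ℤ
    minimal u ku sub g vg ug f = decidable-stable (u f ℤP.≟ 0ℤ) λ uf → least (support u′)
      ((λ {h} h∈u → support-true v λ vh → ∈support u′ h∈u (trans (u′-at h) (sub h vh)))
        , g , support-true v vg , λ g∈u → ∈support u′ g∈u (trans (u′-at g) ug))
      (u′ , K-cong (λ h → sym (u′-at h)) ku , ≢0-vec f (λ eq → uf (trans (sym (u′-at f)) eq)) , λ p → p)
      where
      u′ : Vec ℤ n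
      u′ = tabulate u
      u′-at : ∀ h → lookup u′ h ≡ u h
      u′-at = VP.lookup∘tabulate u

  sign-dichotomy : ∀ {x y} → IsSign x → IsSign y → x ≢ 0ℤ → y ≢ 0ℤ → x ≡ y ⊎ x ≡ - y
  sign-dichotomy (inj₁ x≡0) _ x≢0 _ = ⊥-elim (x≢0 x≡0)
  sign-dichotomy _ (inj₁ y≡0) _ y≢0 = ⊥-elim (y≢0 y≡0)
  sign-dichotomy (inj₂ (inj₁ refl)) (inj₂ (inj₁ refl)) _ _ = inj₁ refl
  sign-dichotomy (inj₂ (inj₁ refl)) (inj₂ (inj₂ refl)) _ _ = inj₂ refl
  sign-dichotomy (inj₂ (inj₂ refl)) (inj₂ (inj₁ refl)) _ _ = inj₂ refl
  sign-dichotomy (inj₂ (inj₂ refl)) (inj₂ (inj₂ refl)) _ _ = inj₁ refl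

  -- At a point of the common support the entries are equal or opposite, so the difference or the
  -- sum vanishes there and, by minimality, everywhere.
  elementary-unique : ∀ {c d} → Elementary K c → Elementary K d → (∀ e → c e ≡ 0ℤ → d e ≡ 0ℤ) → (∀ e → d e ≡ 0ℤ → c e ≡ 0ℤ) →
    (∀ e → c e ≡ d e) ⊎ (∀ e → c e ≡ - d e)
  elementary-unique {c} {d} ec ed c⇒d d⇒c with point
    where open Elementary ec
  ... | g , cg with sign-dichotomy (Elementary.signed ec g) (Elementary.signed ed g) cg (λ dg → cg (d⇒c g dg))
  ...   | inj₁ eq = inj₁ λ e → trans (solve-for (c e) (d e)) (trans (cong (λ x → x + d e) (vanish e)) (ℤP.+-identityˡ (d e)))
    where
    solve-for : ∀ x y → x ≡ (x + -1ℤ * y) + y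
    solve-for = solve-∀
    cancel : ∀ y → y + -1ℤ * y ≡ 0ℤ
    cancel = solve-∀
    vanish : ∀ e → c e + -1ℤ * d e ≡ 0ℤ
    vanish = Elementary.minimal ec (λ e → c e + -1ℤ * d e) (K-+ (Elementary.member ec) (K-* -1ℤ (Elementary.member ed)))
      (λ e ce → cong₂ (λ x y → x + -1ℤ * y) ce (c⇒d e ce)) g cg (trans (cong (λ x → x + -1ℤ * d g) eq) (cancel (d g)))
  ...   | inj₂ eq = inj₂ λ e → trans (solve-for (c e) (d e)) (trans (cong (λ x → x - d e) (vanish e)) (ℤP.+-identityˡ (- d e)))
    where
    solve-for : ∀ x y → x ≡ (x + y) - y
    solve-for = solve-∀
    vanish : ∀ e → c e + d e ≡ 0ℤ
    vanish = Elementary.minimal ec (λ e → c e + d e) (K-+ (Elementary.member ec) (Elementary.member ed))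
      (λ e ce → cong₂ _+_ ce (c⇒d e ce)) g cg (trans (cong (λ x → x + d g) eq) (ℤP.+-inverseˡ (d g)))

  Through : Subset n → Fin n → Set
  Through D e = Σ (Fin n → ℤ) λ v → K v × v e ≡ 1ℤ × (∀ f → f ≢ e → lookup D f ≡ false → v f ≡ 0ℤ)

  single-product : ∀ {u w} → K u → R w → ∀ e → w e ≡ 1ℤ → (∀ f → f ≢ e → u f * w f ≡ 0ℤ) → u e ≡ 0ℤ
  single-product {u} {w} ku rw e we off = trans (sym (trans (cong (_*_ (u e)) we) (ℤP.*-identityʳ (u e))))
    (trans (sym (sumFin-single {f = λ f → u f * w f} e off)) (orthogonal ku rw))

  -- The supports of `u` and `w` meet at most in `e`. Hence the two cases of `alternative` exclude
  -- each other, which makes dependence decidable.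
  excluded : ∀ D {e w u} → R w → w e ≡ 1ℤ → (∀ f → f ≢ e → lookup D f ≡ true → w f ≡ 0ℤ) →
    K u → (∀ f → f ≢ e → lookup D f ≡ false → u f ≡ 0ℤ) → u e ≡ 0ℤ
  excluded D {e} {w} {u} rw we on ku off = single-product {u} {w} ku rw e we λ f f≢e → elsewhere f f≢e (lookup D f) refl
    where
    elsewhere : ∀ f → f ≢ e → ∀ b → lookup D f ≡ b → u f * w f ≡ 0ℤ
    elsewhere f f≢e true  Df = trans (cong (_*_ (u f)) (on f f≢e Df)) (ℤP.*-zeroʳ (u f))
    elsewhere f f≢e false Df = cong (λ x → x * w f) (off f f≢e Df)

  through? : ∀ D e → Dec (Through D e)
  through? D e with alternative (lookup D) e
  ... | inj₁ t = yes t
  ... | inj₂ (w , rw , we , on) = no λ (v , kv , ve , off) → ε≢0 true (trans (sym ve) (excluded D rw we on kv off))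

  dependent? : ∀ D → Dec (DependentIn K D)
  dependent? D with FP.any? (λ e → (lookup D e BP.≟ true) ×-dec through? D e)
  ... | yes (e , De , v , kv , ve , off) = yes (v′ , K-cong (λ f → sym (v′-at f)) kv
    , ≢0-vec e (λ eq → ε≢0 true (trans (sym ve) (trans (sym (v′-at e)) eq))) , inside)
    where
    v′ : Vec ℤ n
    v′ = tabulate v
    v′-at : ∀ f → lookup v′ f ≡ v f
    v′-at = VP.lookup∘tabulate v
    inside : support v′ ⊆ D
    inside {f} f∈v with f FP.≟ e
    ... | yes refl = true⇒∈ De
    ... | no f≢e   = true⇒∈ (≢⇒not λ Df → ∈support v′ f∈v (trans (v′-at f) (off f f≢e Df)))
  ... | no none-through = no λ (u , ku , u≢0 , u⊆D) →
    let (e , ue) = nonzero-entry u≢0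
        De = ∈⇒true (u⊆D (support-true u ue))
    in contradiction u ku u⊆D e ue De
    where
    contradiction : ∀ u → K (lookup u) → support u ⊆ D → ∀ e → lookup u e ≢ 0ℤ → lookup D e ≡ true → ⊥
    contradiction u ku u⊆D e ue De with alternative (lookup D) e
    ... | inj₁ t = none-through (e , De , t)
    ... | inj₂ (w , rw , we , on) = ue (excluded D {u = lookup u} rw we on ku
      λ f _ Df → ∉support u λ f∈u → false⇒∉ Df (u⊆D f∈u))

  circuit? : ∀ C → Dec (CircuitIn K C)
  circuit? C with dependent? C | SP.anySubset? (λ D → (D SP.⊂? C) ×-dec dependent? D)
  ... | no ¬dep | _                 = no λ circuit → ¬dep (proj₁ circuit)
  ... | yes _   | yes (D , D⊂C , dep) = no λ circuit → proj₂ circuit D D⊂C dep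
  ... | yes dep | no least          = yes (dep , λ D D⊂C depD → least (D , D⊂C , depD))

conf? : ∀ p x → Dec (Conf p x)
conf? none    x = x ℤP.≟ 0ℤ
conf? any     x = yes tt
conf? (one b) x = 0ℤ ℤP.≤? ε b * x

module Signed {r n : ℕ} (A : Fin r → Fin n → ℤ) {K R : (Fin n → ℤ) → Set} (pair : RegularPair K R)
  (σ : Subset n → Vec ℤ n)
  (chooses : ∀ C → CircuitIn K C → SignedCircuitIn K (σ C) × support (σ C) ≡ C)
  (σ-acyclic : ∀ (L : List (Subset n × ℕ)) → All (λ p → CircuitIn K (proj₁ p)) L →
    Matroid.linComb A σ L ≡ replicate n 0ℤ → All (λ p → proj₂ p ≡ 0) L) where
  open RegularPair pair
  open Circuits pair

  Selected : (Fin n → ℤ) → Set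
  Selected u = Σ (Subset n) λ C → CircuitIn K C × (∀ e → u e ≡ lookup (σ C) e)

  elementary-cong : ∀ {u v} → (∀ e → u e ≡ v e) → Elementary K u → Elementary K v
  elementary-cong h eu = record
    { signed = λ e → subst IsSign (h e) (signed e)
    ; member = K-cong h member
    ; point = proj₁ point , λ ve → proj₂ point (trans (h _) ve)
    ; minimal = λ w kw sub g vg → minimal w kw (λ f uf → sub f (trans (sym (h f)) uf)) g (λ ug → vg (trans (sym (h g)) ug))
    }
    where open Elementary eu

  σ-elementary : ∀ {C} → CircuitIn K C → Elementary K (lookup (σ C))
  σ-elementary {C} circuit = signed⇒elementary (σ C) (proj₁ (chooses C circuit))

  select : ∀ {c} → Elementary K c → Selected c ⊎ Selected (neg c)
  select {c} ec = orient (elementary-unique ec (σ-elementary circuit) c⇒σ σ⇒c)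
    where
    C : Subset n
    C = support (tabulate c)
    circuit : CircuitIn K C
    circuit = proj₂ (proj₂ (elementary⇒signed (tabulate c) (elementary-cong (λ e → sym (VP.lookup∘tabulate c e)) ec)))
    same-support : support (σ C) ≡ C
    same-support = proj₂ (chooses C circuit)
    c⇒σ : ∀ e → c e ≡ 0ℤ → lookup (σ C) e ≡ 0ℤ
    c⇒σ e ce = ∉support (σ C) λ e∈σ → ∈support (tabulate c) (subst (e ∈_) same-support e∈σ) (trans (VP.lookup∘tabulate c e) ce)
    σ⇒c : ∀ e → lookup (σ C) e ≡ 0ℤ → c e ≡ 0ℤ
    σ⇒c e σe = trans (sym (VP.lookup∘tabulate c e)) (∉support (tabulate c) λ e∈C → ∈support (σ C) (subst (e ∈_) (sym same-support) e∈C) σe)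
    orient : (∀ e → c e ≡ lookup (σ C) e) ⊎ (∀ e → c e ≡ - lookup (σ C) e) → Selected c ⊎ Selected (neg c)
    orient (inj₁ eq) = inj₁ (C , circuit , eq)
    orient (inj₂ eq) = inj₂ (C , circuit , λ e → trans (cong -_ (eq e)) (ℤP.neg-involutive _))

  cone-list : ∀ {u} → Cone Selected u → List (Subset n × ℕ)
  cone-list (cone-0 _)             = []
  cone-list (cone-+ (C , _) cu _) = (C , 1) ∷ cone-list cu

  cone-list-circuits : ∀ {u} (cu : Cone Selected u) → All (λ p → CircuitIn K (proj₁ p)) (cone-list cu)
  cone-list-circuits (cone-0 _)                       = []
  cone-list-circuits (cone-+ (C , circuit , _) cu _) = circuit ∷ cone-list-circuits cu

  cone-list-value : ∀ {u} (cu : Cone Selected u) e → lookup (Matroid.linComb A σ (cone-list cu)) e ≡ u e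
  cone-list-value (cone-0 z) e = trans (VP.lookup-replicate e 0ℤ) (sym (z e))
  cone-list-value (cone-+ {u = u} (C , _ , s≡σ) cu eq) e = trans
    (VP.lookup-zipWith _+_ e (Data.Vec.map (_*_ 1ℤ) (σ C)) (Matroid.linComb A σ (cone-list cu)))
    (trans (cong₂ _+_ (trans (VP.lookup-map e (_*_ 1ℤ) (σ C)) (trans (ℤP.*-identityˡ _) (sym (s≡σ e)))) (cone-list-value cu e))
      (sym (eq e)))

  -- If the first cone contributed a vector, the list for their sum would carry a nonzero coefficient.
  cone-acyclic : ∀ {u} → Cone Selected u → Cone Selected (neg u) → ∀ e → u e ≡ 0ℤ
  cone-acyclic (cone-0 z) _ = z
  cone-acyclic {u} cu@(cone-+ Ss cu′ eq) cnu = ⊥-elim (nonzero (σ-acyclic (cone-list sum) (cone-list-circuits sum)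
    (≡0-vec λ e → trans (cone-list-value sum e) (ℤP.+-inverseʳ (u e)))))
    where
    sum : Cone Selected (λ e → u e + - u e)
    sum = cone-sum cu cnu
    nonzero : All (λ p → proj₂ p ≡ 0) (cone-list sum) → ⊥
    nonzero (() ∷ _)

  signature : Signature K Selected
  signature = record
    { elementary = λ (C , circuit , eq) → elementary-cong (λ e → sym (eq e)) (σ-elementary circuit)
    ; total = select
    ; acyclic = cone-acyclic
    ; opposed? = opposed? }
    where
    opposed? : ∀ P → Dec (Opposed Selected P)
    opposed? P with SP.anySubset? (λ C → circuit? C ×-dec FP.all? (λ e → conf? (P e) (- lookup (σ C) e)))
    ... | yes (C , circuit , conf) = yes (lookup (σ C) , (C , circuit , λ _ → refl) , conf)
    ... | no none-opposed = no λ (s , (C , circuit , eq) , conf) →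
      none-opposed (C , circuit , λ e → subst (λ x → Conf (P e) (- x)) (eq e) (conf e))

-- Bases and fundamental circuits

≤⇒agrees : ∀ {x} o → 0ℤ ≤ ε o * x → (x ≡ 1ℤ → o ≡ true) × (x ≡ -1ℤ → o ≡ false)
≤⇒agrees true  p = (λ _ → refl) , λ { refl → ⊥-elim (absurd p) }
  where
  absurd : ¬ 0ℤ ≤ -1ℤ
  absurd ()
≤⇒agrees false p = (λ { refl → ⊥-elim (absurd p) }) , λ _ → refl
  where
  absurd : ¬ 0ℤ ≤ -1ℤ
  absurd ()

agrees⇒≤ : ∀ {x} o → IsSign x → (x ≡ 1ℤ → o ≡ true) × (x ≡ -1ℤ → o ≡ false) → 0ℤ ≤ ε o * x
agrees⇒≤ o (inj₁ refl)        _       = ≡⇒0≤ (ℤP.*-zeroʳ (ε o))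
agrees⇒≤ o (inj₂ (inj₁ refl)) (t , _) = subst (λ b → 0ℤ ≤ ε b * 1ℤ) (sym (t refl)) (+≤+ ℕ.z≤n)
agrees⇒≤ o (inj₂ (inj₂ refl)) (_ , f) = subst (λ b → 0ℤ ≤ ε b * -1ℤ) (sym (f refl)) (+≤+ ℕ.z≤n)

independent⇒null : ∀ {n} {K : (Fin n → ℤ) → Set} {B D b} → (∀ {u v} → (∀ e → u e ≡ v e) → K u → K v) →
  (∀ f → lookup D f ≡ false → lookup B f ≡ b) → ¬ DependentIn K D → Null K (lookup B) b
independent⇒null {D = D} K-cong side indep v kv off e = decidable-stable (v e ℤP.≟ 0ℤ) λ ve → indep
  (v′ , K-cong (λ f → sym (v′-at f)) kv , ≢0-vec e (λ eq → ve (trans (sym (v′-at e)) eq)) , inside)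
  where
  v′ : Vec ℤ _
  v′ = tabulate v
  v′-at : ∀ f → lookup v′ f ≡ v f
  v′-at = VP.lookup∘tabulate v
  inside : support v′ ⊆ D
  inside {f} f∈v = true⇒∈ (≢⇒not λ Df → ∈support v′ f∈v (trans (v′-at f) (off f (side f Df))))

null⇒independent : ∀ {n} {K : (Fin n → ℤ) → Set} {B D b} → (∀ f → lookup B f ≡ b → lookup D f ≡ false) →
  Null K (lookup B) b → ¬ DependentIn K D
null⇒independent side null (v , kv , v≢0 , v⊆D) = v≢0 (≡0-vec (null (lookup v) kv λ f Bf →
  ∉support v λ f∈v → false⇒∉ (side f Bf) (v⊆D f∈v)))

MaximalIndependent : ∀ {n} → ((Fin n → ℤ) → Set) → Subset n → Set
MaximalIndependent {n} K B = ¬ DependentIn K B × (∀ D → B ⊆ D → ¬ DependentIn K D → D ≡ B)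

module Bases {n : ℕ} {K R : (Fin n → ℤ) → Set} (pair : RegularPair K R) where
  open RegularPair pair
  open Circuits

  maximal⇒null : ∀ {B} → MaximalIndependent K B → Null K (lookup B) false
  maximal⇒null {B} (indep , _) = independent⇒null {B = B} {B} {b = false} K-cong (λ f Bf → Bf) indep

  -- Suppose `w` vanishes on `B` but not at `e`. A kernel vector through `e` supported in `B` and
  -- `e` would meet `w` in `e` alone; a row-space vector separating `e` from `B` would make
  -- `B ∪ ⁅ e ⁆` independent, against maximality.
  maximal⇒null* : ∀ {B} → MaximalIndependent K B → Null R (lookup B) true
  maximal⇒null* {B} (indep , maximal) w rw off e = decidable-stable (w e ℤP.≟ 0ℤ) λ we → clash we (lookup B e) refl
    where
    clash : w e ≢ 0ℤ → ∀ b → lookup B e ≡ b → ⊥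
    clash we true  Be = we (off e Be)
    clash we false Be with alternative (lookup B) e
    ... | inj₁ (v , kv , ve , v-off) = we (single-product (dual pair) {w} {v} rw kv e ve λ f f≢e → elsewhere f f≢e (lookup B f) refl)
      where
      elsewhere : ∀ f → f ≢ e → ∀ b → lookup B f ≡ b → w f * v f ≡ 0ℤ
      elsewhere f f≢e true  Bf = cong (λ x → x * v f) (off f Bf)
      elsewhere f f≢e false Bf = trans (cong (_*_ (w f)) (v-off f f≢e Bf)) (ℤP.*-zeroʳ (w f))
    ... | inj₂ (z , rz , ze , z-on) = false⇒∉ Be (subst (e ∈_) (maximal (B ∪ ⁅ e ⁆) (SP.p⊆p∪q ⁅ e ⁆) indep′)
        (SP.x∈p∪q⁺ {p = B} (inj₂ (SP.x∈⁅x⁆ e))))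
      where
      null′ : Null K (lookup (B ∪ ⁅ e ⁆)) false
      null′ u ku u-off = independent⇒null {B = B} {B} {b = false} K-cong (λ f Bf → Bf) indep u ku zero-off-B
        where
        u-outside : ∀ f → f ≢ e → lookup B f ≡ false → u f ≡ 0ℤ
        u-outside f f≢e Bf = u-off f (∉⇒false λ f∈ → outside (SP.x∈p∪q⁻ B ⁅ e ⁆ f∈))
          where
          outside : f ∈ B ⊎ f ∈ ⁅ e ⁆ → ⊥
          outside (inj₁ f∈B) = false⇒∉ Bf f∈B
          outside (inj₂ f∈e) = f≢e (SP.x∈⁅y⁆⇒x≡y e f∈e)
        zero-off-B : ∀ f → lookup B f ≡ false → u f ≡ 0ℤ
        zero-off-B f Bf with f FP.≟ e
        ... | yes refl = excluded pair B {u = u} rz ze z-on ku u-outside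
        ... | no f≢e   = u-outside f f≢e Bf
      indep′ : ¬ DependentIn K (B ∪ ⁅ e ⁆)
      indep′ = null⇒independent {B = B ∪ ⁅ e ⁆} {b = false} (λ f Bf → Bf) null′

  null⇒maximal : ∀ {B} → Null K (lookup B) false → Null R (lookup B) true → MaximalIndependent K B
  null⇒maximal {B} nullK nullR = null⇒independent {B = B} {b = false} (λ f Bf → Bf) nullK , λ D B⊆D indepD → vec-ext λ e → same D B⊆D indepD e (lookup B e) refl
    where
    same : ∀ D → B ⊆ D → ¬ DependentIn K D → ∀ e b → lookup B e ≡ b → lookup D e ≡ lookup B e
    same D B⊆D indepD e true  Be = trans (∈⇒true (B⊆D (true⇒∈ Be))) (sym Be)
    same D B⊆D indepD e false Be = trans (≢⇒not λ De → dependent De) (sym Be)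
      where
      dependent : lookup D e ≡ true → ⊥
      dependent De with alternative (lookup B) e
      ... | inj₂ (w , rw , we , on) = ε≢0 true (trans (sym we) (nullR w rw (λ f Bf → on f (λ { refl → false≢true Be Bf }) Bf) e))
      ... | inj₁ (v , kv , ve , off) = ε≢0 true (trans (sym ve)
        (independent⇒null {B = D} {D} {b = false} K-cong (λ f Df → Df) indepD v kv off-D e))
        where
        off-D : ∀ f → lookup D f ≡ false → v f ≡ 0ℤ
        off-D f Df = off f (λ { refl → false≢true Df De }) (∉⇒false λ f∈B → false⇒∉ Df (B⊆D f∈B))

module SignedBases {r n : ℕ} (A : Fin r → Fin n → ℤ) {K R : (Fin n → ℤ) → Set} (pair : RegularPair K R)
  (σ : Subset n → Vec ℤ n)
  (chooses : ∀ C → CircuitIn K C → SignedCircuitIn K (σ C) × support (σ C) ≡ C)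
  (σ-acyclic : ∀ (L : List (Subset n × ℕ)) → All (λ p → CircuitIn K (proj₁ p)) L →
    Matroid.linComb A σ L ≡ replicate n 0ℤ → All (λ p → proj₂ p ≡ 0) L) where
  open RegularPair pair
  open Circuits pair
  open Signed A pair σ chooses σ-acyclic

  -- One half of `IsG`: circuits for `D = B` and `b = false`, cocircuits for `D = ∁ B` and
  -- `b = true`.
  FundamentalAgreement : Subset n → Subset n → Bool → Vec Bool n → Set
  FundamentalAgreement B D b O = ∀ e → lookup B e ≡ b → ∀ C → CircuitIn K C × C ⊆ (D ∪ ⁅ e ⁆) → Matroid.AgreesAt A O e (σ C)

  off-support : ∀ {C} → CircuitIn K C → ∀ {f} → f ∉ C → lookup (σ C) f ≡ 0ℤ
  off-support {C} circuit {f} f∉C = ∉support (σ C) λ f∈σ → f∉C (subst (f ∈_) (proj₂ (chooses C circuit)) f∈σ)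

  -- `IsG` quantifies over all fundamental circuits, so passing to a frame needs the existence of
  -- one, and the converse needs the uniqueness of its sign.
  agreement⇒half-frame : ∀ {B D b O} → (∀ f → lookup D f ≡ false → lookup B f ≡ b) → Null R (lookup B) (not b) →
    FundamentalAgreement B D b O → HalfFrame Selected (lookup B) b (lookup O)
  agreement⇒half-frame {B} {D} {b} {O} side nullR agree e Be with fundamental-exists pair signature (lookup B) b nullR e Be
  ... | g , s , (C , circuit , s≡σ) , se , off = s , (C , circuit , s≡σ) , trans se (cong ε (sym (value g (trans (sym (s≡σ e)) se)))) , off
    where
    C⊆ : C ⊆ (D ∪ ⁅ e ⁆)
    C⊆ {f} f∈C with f FP.≟ e
    ... | yes refl = SP.x∈p∪q⁺ {p = D} (inj₂ (SP.x∈⁅x⁆ e))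
    ... | no f≢e   = SP.x∈p∪q⁺ {q = ⁅ e ⁆} (inj₁ (true⇒∈ (≢⇒not λ Df →
      ∈support (σ C) (subst (f ∈_) (sym (proj₂ (chooses C circuit))) f∈C) (trans (sym (s≡σ f)) (off f f≢e (side f Df))))))
    value : ∀ g → lookup (σ C) e ≡ ε g → lookup O e ≡ g
    value true  eq = proj₁ (agree e Be C (circuit , C⊆)) eq
    value false eq = proj₂ (agree e Be C (circuit , C⊆)) eq

  half-frame⇒agreement : ∀ {B D b O} → (∀ f → lookup B f ≡ b → lookup D f ≡ false) → Null K (lookup B) b →
    HalfFrame Selected (lookup B) b (lookup O) → FundamentalAgreement B D b O
  half-frame⇒agreement {B} {D} {b} {O} side nullK half e Be C (circuit , C⊆) =
    (λ eq → sym (half-frame-unique pair signature nullK half e Be true (fundamental true eq))) ,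
    (λ eq → sym (half-frame-unique pair signature nullK half e Be false (fundamental false eq)))
    where
    fundamental : ∀ g → lookup (σ C) e ≡ ε g → Fundamental Selected (lookup B) b e g
    fundamental g eq = lookup (σ C) , (C , circuit , λ _ → refl) , eq , λ f f≢e Bf →
      off-support circuit λ f∈C → outside f f≢e Bf (SP.x∈p∪q⁻ D ⁅ e ⁆ (C⊆ f∈C))
      where
      outside : ∀ f → f ≢ e → lookup B f ≡ b → f ∈ D ⊎ f ∈ ⁅ e ⁆ → ⊥
      outside f f≢e Bf (inj₁ f∈D) = false⇒∉ (side f Bf) f∈D
      outside f f≢e Bf (inj₂ f∈e) = f≢e (SP.x∈⁅y⁆⇒x≡y e f∈e)

  CompatibleWith : Vec Bool n → Set
  CompatibleWith O = ∀ v → SignedCircuitIn K v → Matroid.InOri A v O → v ≡ σ (support v)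

  -- The negative of an opposed `σ C` is a signed circuit in `O`, so compatibility would equate it
  -- with `σ C`, which is impossible at a point of the support.
  compatible⇒unopposed : ∀ {O} → CompatibleWith O → ¬ Opposed Selected (λ e → one (lookup O e))
  compatible⇒unopposed {O} compatible (s , (C , circuit , s≡σ) , conf) = σ-point (self-negative⇒0 _ (begin
    lookup (σ C) p           ≡⟨ cong (λ D → lookup (σ D) p) (sym same-support) ⟩
    lookup (σ (support v)) p ≡⟨ cong (λ u → lookup u p) (sym (compatible v signed in-O)) ⟩
    lookup v p               ≡⟨ v-at p ⟩
    - lookup (σ C) p ∎))
    where
    open ≡-Reasoning
    v : Vec ℤ n
    v = Data.Vec.map -_ (σ C)
    v-at : ∀ e → lookup v e ≡ - lookup (σ C) e
    v-at e = VP.lookup-map e -_ (σ C)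
    p : Fin n
    p = proj₁ (Elementary.point (σ-elementary circuit))
    σ-point : lookup (σ C) p ≢ 0ℤ
    σ-point = proj₂ (Elementary.point (σ-elementary circuit))
    signed : SignedCircuitIn K v
    signed = elementary⇒signed v (elementary-cong (λ e → trans (ℤP.-1*i≡-i _) (sym (v-at e)))
      (Shrink.elementary-ε pair false (σ-elementary circuit)))
    in-O : Matroid.InOri A v O
    in-O e = ≤⇒agrees (lookup O e) (≤-resp (cong (_*_ (ε (lookup O e))) (trans (cong -_ (s≡σ e)) (sym (v-at e)))) (conf e))
    same-support : support v ≡ C
    same-support = trans (support-cong {u = v} {σ C} λ e → trans (cong isZero (v-at e)) (isZero-neg _)) (proj₂ (chooses C circuit))

  unopposed⇒compatible : ∀ {O} → ¬ Opposed Selected (λ e → one (lookup O e)) → CompatibleWith O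
  unopposed⇒compatible {O} unopposed v signed in-O with select (signed⇒elementary v signed)
  ... | inj₁ (C , circuit , v≡σ) = trans v≡σC (cong σ (sym (trans (cong support v≡σC) (proj₂ (chooses C circuit)))))
    where
    v≡σC : v ≡ σ C
    v≡σC = vec-ext v≡σ
  ... | inj₂ selected = ⊥-elim (unopposed (neg (lookup v) , selected , λ e →
    ≤-resp (cong (_*_ (ε (lookup O e))) (sym (ℤP.neg-involutive (lookup v e)))) (agrees⇒≤ (lookup O e) (proj₁ signed e) (in-O e))))

-- Uniqueness and restriction

-- The image under φ at one element: `x` and `y` are the entries of the circuit and cocircuit sums,
-- and `b` tells whether the element is in the basis.
placed : ℤ → ℤ → Bool → Bool
placed x y b = (b ∨ not (isZero x)) ∧ not (not (isZero y))

ε-injective : ∀ {a b} → ε a ≡ ε b → a ≡ b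
ε-injective {true}  {true}  _ = refl
ε-injective {false} {false} _ = refl

ε-sign : ∀ b → IsSign (ε b)
ε-sign true  = inj₂ (inj₁ refl)
ε-sign false = inj₂ (inj₂ refl)

isZero-ε : ∀ b → isZero (ε b) ≡ false
isZero-ε true  = refl
isZero-ε false = refl

placed-kept : ∀ {x y} b → x ≡ 0ℤ → y ≡ 0ℤ → placed x y b ≡ b
placed-kept true  refl refl = refl
placed-kept false refl refl = refl

placed-circ : ∀ {x y g} b → x ≡ ε g → y ≡ 0ℤ → placed x y b ≡ true
placed-circ {g = g} b refl refl = trans (BP.∧-identityʳ _) (trans (cong (λ z → b ∨ not z) (isZero-ε g)) (BP.∨-zeroʳ b))

placed-cocirc : ∀ {x y g} b → y ≡ ε g → placed x y b ≡ false
placed-cocirc {x} {g = g} b refl =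
  trans (cong (λ z → (b ∨ not (isZero x)) ∧ not (not z)) (isZero-ε g)) (BP.∧-zeroʳ _)

cell-reversed : ∀ {o o′ x y} → Cell o o′ x y → Reversed o o′ (x + y)
cell-reversed (kept o≡ refl refl)               = fixed o≡ refl
cell-reversed {o′ = o′} (circ o≡ refl refl)     = flipped o≡ (ℤP.+-identityʳ (ε o′))
cell-reversed {o′ = o′} (cocirc o≡ refl refl)   = flipped o≡ (ℤP.+-identityˡ (ε o′))

cell-nonneg : ∀ {o o′ x y} → Cell o o′ x y → 0ℤ ≤ ε o′ * x × 0ℤ ≤ ε o′ * y
cell-nonneg {o′ = g} (kept _ x≡0 y≡0)   = ≡⇒0≤ (ε*0 g x≡0) , ≡⇒0≤ (ε*0 g y≡0)
cell-nonneg {o′ = g} (circ _ refl y≡0)  = ≤-resp (sym (ε*ε g)) (+≤+ ℕ.z≤n) , ≡⇒0≤ (ε*0 g y≡0)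
cell-nonneg {o′ = g} (cocirc _ x≡0 refl) = ≡⇒0≤ (ε*0 g x≡0) , ≤-resp (sym (ε*ε g)) (+≤+ ℕ.z≤n)

cell-product : ∀ {o o′ x y} → Cell o o′ x y → x * y ≡ 0ℤ
cell-product (kept _ refl _)              = refl
cell-product {o′ = g} (circ _ refl refl) = ℤP.*-zeroʳ (ε g)
cell-product (cocirc _ refl _)            = refl

cell-same : ∀ {o x y} → Cell o o x y → x ≡ 0ℤ × y ≡ 0ℤ
cell-same (kept _ x≡0 y≡0) = x≡0 , y≡0
cell-same (circ eq _ _)    = ⊥-elim (not-self eq)
cell-same (cocirc eq _ _)  = ⊥-elim (not-self eq)

cell-sign : ∀ {o o′ x y} → Cell o o′ x y → IsSign x × IsSign y
cell-sign (kept _ refl refl)                = inj₁ refl , inj₁ refl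
cell-sign {o′ = g} (circ _ refl refl)   = ε-sign g , inj₁ refl
cell-sign {o′ = g} (cocirc _ refl refl) = inj₁ refl , ε-sign g

-- Of the source, the target and the amount of a reversal any two determine the third; this and the
-- next two lemmas are the three cases.
reversed-amount-unique : ∀ {o g x x′} → Reversed o g x → Reversed o g x′ → x ≡ x′
reversed-amount-unique (fixed _ refl)   (fixed _ refl)   = refl
reversed-amount-unique (flipped _ refl) (flipped _ refl) = refl
reversed-amount-unique (fixed refl _)   (flipped eq _)   = ⊥-elim (not-self eq)
reversed-amount-unique (flipped eq _)   (fixed refl _)   = ⊥-elim (not-self eq)

reversed-target-unique : ∀ {o g g′ x} → Reversed o g x → Reversed o g′ x → g ≡ g′
reversed-target-unique (fixed o≡g _)   (fixed o≡g′ _)    = trans (sym o≡g) o≡g′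
reversed-target-unique (flipped _ x≡) (flipped _ x≡′)   = ε-injective (trans (sym x≡) x≡′)
reversed-target-unique {g′ = g′} (fixed _ x≡0) (flipped _ x≡) = ⊥-elim (ε≢0 g′ (trans (sym x≡) x≡0))
reversed-target-unique {g = g} (flipped _ x≡) (fixed _ x≡0)   = ⊥-elim (ε≢0 g (trans (sym x≡) x≡0))

reversed-source-unique : ∀ {o o′ g x} → Reversed o g x → Reversed o′ g x → o ≡ o′
reversed-source-unique (fixed o≡g _)   (fixed o′≡g _)    = trans o≡g (sym o′≡g)
reversed-source-unique (flipped o≡ _) (flipped o′≡ _)   = trans o≡ (sym o′≡)
reversed-source-unique {g = g} (fixed _ x≡0) (flipped _ x≡) = ⊥-elim (ε≢0 g (trans (sym x≡) x≡0))
reversed-source-unique {g = g} (flipped _ x≡) (fixed _ x≡0) = ⊥-elim (ε≢0 g (trans (sym x≡) x≡0))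

-- The difference of the circuit entries and that of the cocircuit entries never have the same sign, for two
-- resolutions of one orientation: equal targets force opposite differences, otherwise one resolution is trivial.
resolutions-oppose : ∀ {o g g′ x x′ y y′} → Cell o g x y → Cell o g′ x′ y′ →
  0ℤ ≤ (- (x + -1ℤ * x′)) * (y + -1ℤ * y′)
resolutions-oppose {o} {g} {g′} {x} {x′} {y} {y′} c c′ with g BP.≟ g′
... | yes refl = ≤-resp (trans (square x x′) (cong (_*_ (- (x + -1ℤ * x′))) (sym opposite))) (square-nonneg (x + -1ℤ * x′))
  where
  square : ∀ x x′ → (x + -1ℤ * x′) * (x + -1ℤ * x′) ≡ (- (x + -1ℤ * x′)) * (- (x + -1ℤ * x′))
  square = solve-∀
  square-nonneg : ∀ z → 0ℤ ≤ z * z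
  square-nonneg (+ z)    = *-nonneg {+ z} {+ z} (+≤+ ℕ.z≤n) (+≤+ ℕ.z≤n)
  square-nonneg -[1+ z ] = +≤+ ℕ.z≤n
  regroup : ∀ x x′ y y′ → y + -1ℤ * y′ ≡ (x + y) + -1ℤ * (x′ + y′) + (- (x + -1ℤ * x′))
  regroup = solve-∀
  cancel : ∀ s z → s + -1ℤ * s + z ≡ z
  cancel = solve-∀
  opposite : y + -1ℤ * y′ ≡ - (x + -1ℤ * x′)
  opposite = trans (regroup x x′ y y′) (trans
    (cong (λ s → s + -1ℤ * (x′ + y′) + (- (x + -1ℤ * x′))) (reversed-amount-unique (cell-reversed c) (cell-reversed c′)))
    (cancel (x′ + y′) (- (x + -1ℤ * x′))))
... | no g≢g′ = ≡⇒0≤ (either (o BP.≟ g))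
  where
  first-trivial : ∀ x′ y′ → (- (0ℤ + -1ℤ * x′)) * (0ℤ + -1ℤ * y′) ≡ - (x′ * y′)
  first-trivial = solve-∀
  second-trivial : ∀ x y → (- (x + -1ℤ * 0ℤ)) * (y + -1ℤ * 0ℤ) ≡ - (x * y)
  second-trivial = solve-∀
  either : Dec (o ≡ g) → (- (x + -1ℤ * x′)) * (y + -1ℤ * y′) ≡ 0ℤ
  either (yes refl) = trans (cong₂ (λ a b → (- (a + -1ℤ * x′)) * (b + -1ℤ * y′)) (proj₁ (cell-same c)) (proj₂ (cell-same c)))
    (trans (first-trivial x′ y′) (cong -_ (cell-product c′)))
  either (no o≢g) with trans (≢⇒not o≢g) (sym (≢⇒not (λ eq → g≢g′ (sym eq))))
  ... | refl = trans (cong₂ (λ a b → (- (x + -1ℤ * a)) * (y + -1ℤ * b)) (proj₁ (cell-same c′)) (proj₂ (cell-same c′)))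
    (trans (second-trivial x y) (cong -_ (cell-product c)))

-- Where the targets differ, `x` and `- x′` both have weakly the sign `g`, so their sum does too.
-- Where they agree, the difference could have either sign, hence the hypothesis `same`.
difference-nonneg : ∀ {g g′ x x′} → (g ≡ g′ → x + -1ℤ * x′ ≡ 0ℤ) → 0ℤ ≤ ε g * x → 0ℤ ≤ ε g′ * x′ →
  0ℤ ≤ ε g * (x + -1ℤ * x′) × 0ℤ ≤ ε g′ * (- (x + -1ℤ * x′))
difference-nonneg {g} {g′} {x} {x′} same p p′ with g BP.≟ g′
... | yes g≡g′ = ≡⇒0≤ (ε*0 g (same g≡g′)) , ≡⇒0≤ (ε*0 g′ (cong -_ (same g≡g′)))
... | no g≢g′ with ≢⇒not g≢g′
...   | refl = first , ≤-resp (ε-not g′ (x + -1ℤ * x′)) first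
  where
  split : ∀ a x x′ → a * (x + -1ℤ * x′) ≡ a * x + a * (- x′)
  split = solve-∀
  first : 0ℤ ≤ ε (not g′) * (x + -1ℤ * x′)
  first = ≤-resp (sym (trans (split (ε (not g′)) x x′) (cong (_+_ (ε (not g′) * x)) (ε-not-neg g′ x′)))) (ℤP.+-mono-≤ p p′)

difference-0 : ∀ {x x′} → x + -1ℤ * x′ ≡ 0ℤ → x ≡ x′
difference-0 {x} {x′} eq = trans (solve-for x x′) (trans (cong (λ z → z + x′) eq) (ℤP.+-identityˡ x′))
  where
  solve-for : ∀ x y → x ≡ (x + -1ℤ * y) + y
  solve-for = solve-∀

-- Single-valuedness and injectivity of φ

module Mapping {n : ℕ} {K R S S* : (Fin n → ℤ) → Set}
  (pair : RegularPair K R) (sig : Signature K S) (sig* : Signature R S*) where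
  open RegularPair pair
  open Frames pair sig sig*

  record Mapped (O X : Fin n → Bool) : Set where
    field
      basis      : Fin n → Bool
      target     : Fin n → Bool
      circuits   : Fin n → ℤ
      cocircuits : Fin n → ℤ
      frame      : Frame basis target
      in-K       : K circuits
      in-R       : R cocircuits
      cells      : ∀ e → Cell (O e) (target e) (circuits e) (cocircuits e)
      image      : ∀ e → X e ≡ placed (circuits e) (cocircuits e) (basis e)

  -- The differences `v` of the circuit sums and `w` of the cocircuit sums never have the same sign,
  -- so orthogonality makes them disjoint. Where the targets agree, `v` and `w` also cancel, so both
  -- vanish; elsewhere their signs follow the targets. Thus `two-frames` applies to both, equal sums
  -- give equal targets, and the bases coincide.
  functional : ∀ {O X X′} → Mapped O X → Mapped O X′ → ∀ e → X e ≡ X′ e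
  functional {O} M M′ e = begin
    _                                                  ≡⟨ M.image e ⟩
    placed (M.circuits e) (M.cocircuits e) (M.basis e) ≡⟨ cong₂ (λ x y → placed x y (M.basis e)) (k≡k′ e) (r≡r′ e) ⟩
    placed (M′.circuits e) (M′.cocircuits e) (M.basis e)
      ≡⟨ cong (placed (M′.circuits e) (M′.cocircuits e)) (basis-unique M.frame M′.frame (λ f _ → target≡ f) e) ⟩
    placed (M′.circuits e) (M′.cocircuits e) (M′.basis e) ≡⟨ sym (M′.image e) ⟩
    _ ∎
    where
    open ≡-Reasoning
    module M = Mapped M
    module M′ = Mapped M′
    v w : Fin n → ℤ
    v f = M.circuits f + -1ℤ * M′.circuits f
    w f = M.cocircuits f + -1ℤ * M′.cocircuits f
    Kv : K v
    Kv = K-+ M.in-K (K-* -1ℤ M′.in-K)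
    Rw : R w
    Rw = R-+ M.in-R (R-* -1ℤ M′.in-R)
    disjoint : ∀ f → - v f ≡ 0ℤ ⊎ w f ≡ 0ℤ
    disjoint f = ℤP.i*j≡0⇒i≡0∨j≡0 (- v f) (Minty.opposite-signs pair {neg v} {w} (K-cong (λ g → ℤP.-1*i≡-i (v g)) (K-* -1ℤ Kv)) Rw
      (λ g → resolutions-oppose (M.cells g) (M′.cells g)) f)
    total : ∀ f → M.target f ≡ M′.target f → v f + w f ≡ 0ℤ
    total f same = trans (regroup (M.circuits f) (M′.circuits f) (M.cocircuits f) (M′.cocircuits f)) (trans
      (cong (λ s → s + -1ℤ * (M′.circuits f + M′.cocircuits f)) (reversed-amount-unique (cell-reversed (M.cells f))
        (subst (λ g → Reversed (O f) g _) (sym same) (cell-reversed (M′.cells f)))))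
      (cancel (M′.circuits f + M′.cocircuits f)))
      where
      regroup : ∀ x x′ y y′ → (x + -1ℤ * x′) + (y + -1ℤ * y′) ≡ (x + y) + -1ℤ * (x′ + y′)
      regroup = solve-∀
      cancel : ∀ s → s + -1ℤ * s ≡ 0ℤ
      cancel = solve-∀
    v≡0×w≡0 : ∀ f → M.target f ≡ M′.target f → v f ≡ 0ℤ × w f ≡ 0ℤ
    v≡0×w≡0 f same with disjoint f
    ... | inj₁ -v≡0 = v≡0 , trans (sym (ℤP.+-identityˡ (w f))) (trans (cong (λ z → z + w f) (sym v≡0)) (total f same))
      where
      v≡0 : v f ≡ 0ℤ
      v≡0 = trans (sym (ℤP.neg-involutive (v f))) (cong -_ -v≡0)
    ... | inj₂ w≡0 = trans (sym (ℤP.+-identityʳ (v f))) (trans (cong (_+_ (v f)) (sym w≡0)) (total f same)) , w≡0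
    k-good : ∀ f → 0ℤ ≤ ε (M.target f) * v f × 0ℤ ≤ ε (M′.target f) * (- v f)
    k-good f = difference-nonneg (λ same → proj₁ (v≡0×w≡0 f same)) (proj₁ (cell-nonneg (M.cells f))) (proj₁ (cell-nonneg (M′.cells f)))
    r-good : ∀ f → 0ℤ ≤ ε (M.target f) * w f × 0ℤ ≤ ε (M′.target f) * (- w f)
    r-good f = difference-nonneg (λ same → proj₂ (v≡0×w≡0 f same)) (proj₂ (cell-nonneg (M.cells f))) (proj₂ (cell-nonneg (M′.cells f)))
    k≡k′ : ∀ f → M.circuits f ≡ M′.circuits f
    k≡k′ f = difference-0 (two-frames pair sig (Frame.nullK M.frame) (Frame.halfK M.frame) (Frame.nullK M′.frame) (Frame.halfK M′.frame)
      Kv (λ g _ → proj₁ (k-good g)) (λ g _ → proj₂ (k-good g)) f)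
    r≡r′ : ∀ f → M.cocircuits f ≡ M′.cocircuits f
    r≡r′ f = difference-0 (two-frames (dual pair) sig* (Frame.nullR M.frame) (Frame.halfR M.frame) (Frame.nullR M′.frame) (Frame.halfR M′.frame)
      Rw (λ g _ → proj₁ (r-good g)) (λ g _ → proj₂ (r-good g)) f)
    target≡ : ∀ f → M.target f ≡ M′.target f
    target≡ f = reversed-target-unique (cell-reversed (M.cells f))
      (subst (Reversed (O f) (M′.target f)) (sym (cong₂ _+_ (k≡k′ f) (r≡r′ f))) (cell-reversed (M′.cells f)))

  -- If x′ is nonzero then the image is true at an element outside the basis b, so x is nonzero as well.
  circuit-difference-good : ∀ {o o′ g g′ x x′ y y′ b′} → Cell o g x y → Cell o′ g′ x′ y′ →
    placed x y false ≡ placed x′ y′ b′ → 0ℤ ≤ ε g * (x + -1ℤ * x′)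
  circuit-difference-good {g = g} {x = x} c (kept _ refl _) _ =
    ≤-resp (cong (_*_ (ε g)) (sym (ℤP.+-identityʳ x))) (proj₁ (cell-nonneg c))
  circuit-difference-good {g = g} {x = x} c (cocirc _ refl _) _ =
    ≤-resp (cong (_*_ (ε g)) (sym (ℤP.+-identityʳ x))) (proj₁ (cell-nonneg c))
  circuit-difference-good {b′ = b′} (kept _ x≡0 y≡0) (circ _ x′≡ y′≡0) eq =
    ⊥-elim (false≢true (trans (sym eq) (placed-kept false x≡0 y≡0)) (placed-circ b′ x′≡ y′≡0))
  circuit-difference-good {x = x} {b′ = b′} (cocirc _ _ y≡) (circ _ x′≡ y′≡0) eq =
    ⊥-elim (false≢true (trans (sym eq) (placed-cocirc {x} false y≡)) (placed-circ b′ x′≡ y′≡0))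
  circuit-difference-good {g = g} {g′} (circ _ refl _) (circ _ refl _) _ = signs g g′
    where
    signs : ∀ g g′ → 0ℤ ≤ ε g * (ε g + -1ℤ * ε g′)
    signs true  true  = +≤+ ℕ.z≤n
    signs true  false = +≤+ ℕ.z≤n
    signs false true  = +≤+ ℕ.z≤n
    signs false false = +≤+ ℕ.z≤n

  cocircuit-difference-good : ∀ {o o′ g g′ x x′ y y′ b′} → Cell o g x y → Cell o′ g′ x′ y′ →
    placed x y true ≡ placed x′ y′ b′ → 0ℤ ≤ ε g * (y + -1ℤ * y′)
  cocircuit-difference-good {g = g} {y = y} c (kept _ _ refl) _ =
    ≤-resp (cong (_*_ (ε g)) (sym (ℤP.+-identityʳ y))) (proj₂ (cell-nonneg c))
  cocircuit-difference-good {g = g} {y = y} c (circ _ _ refl) _ =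
    ≤-resp (cong (_*_ (ε g)) (sym (ℤP.+-identityʳ y))) (proj₂ (cell-nonneg c))
  cocircuit-difference-good {x′ = x′} {b′ = b′} (kept _ x≡0 y≡0) (cocirc _ _ y′≡) eq =
    ⊥-elim (false≢true (placed-cocirc {x′} b′ y′≡) (trans (sym eq) (placed-kept true x≡0 y≡0)))
  cocircuit-difference-good {x′ = x′} {b′ = b′} (circ _ x≡ y≡0) (cocirc _ _ y′≡) eq =
    ⊥-elim (false≢true (placed-cocirc {x′} b′ y′≡) (trans (sym eq) (placed-circ true x≡ y≡0)))
  cocircuit-difference-good {g = g} {g′} (cocirc _ _ refl) (cocirc _ _ refl) _ = signs g g′
    where
    signs : ∀ g g′ → 0ℤ ≤ ε g * (ε g + -1ℤ * ε g′)
    signs true  true  = +≤+ ℕ.z≤n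
    signs true  false = +≤+ ℕ.z≤n
    signs false true  = +≤+ ℕ.z≤n
    signs false false = +≤+ ℕ.z≤n

  -- An element lying in only one of the bases can have the same image for both only if it is
  -- reversed, and then the common nonzero entry determines the target.
  same-entries⇒same-target : ∀ {o o′ g g′ x y b b′} → Cell o g x y → Cell o′ g′ x y →
    placed x y b ≡ placed x y b′ → b ≢ b′ → g ≡ g′
  same-entries⇒same-target {b = b} {b′} (kept _ x≡0 y≡0) _ eq b≢b′ =
    ⊥-elim (b≢b′ (trans (sym (placed-kept b x≡0 y≡0)) (trans eq (placed-kept b′ x≡0 y≡0))))
  same-entries⇒same-target (circ _ x≡ _) (circ _ x≡′ _) _ _ = ε-injective (trans (sym x≡) x≡′)
  same-entries⇒same-target (cocirc _ _ y≡) (cocirc _ _ y≡′) _ _ = ε-injective (trans (sym y≡) y≡′)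
  same-entries⇒same-target {g = g} (circ _ x≡ _) (kept _ x≡0 _) _ _ = ⊥-elim (ε≢0 g (trans (sym x≡) x≡0))
  same-entries⇒same-target {g = g} (circ _ x≡ _) (cocirc _ x≡0 _) _ _ = ⊥-elim (ε≢0 g (trans (sym x≡) x≡0))
  same-entries⇒same-target {g = g} (cocirc _ _ y≡) (kept _ _ y≡0) _ _ = ⊥-elim (ε≢0 g (trans (sym y≡) y≡0))
  same-entries⇒same-target {g = g} (cocirc _ _ y≡) (circ _ _ y≡0) _ _ = ⊥-elim (ε≢0 g (trans (sym y≡) y≡0))

  -- Here the two orientations are unrelated, and the signs come from the common image: for circuits
  -- they are needed only outside the basis, for cocircuits only inside. With equal sums the targets
  -- agree wherever the bases differ, so the bases coincide, and a basis determines its orientation.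
  injective : ∀ {O O′ X} → Mapped O X → Mapped O′ X → ∀ e → O e ≡ O′ e
  injective {O} {O′} M M′ e = reversed-source-unique (cell-reversed (M.cells e))
    (subst (λ g → Reversed (O′ e) g _) (sym (target≡ e))
      (subst (Reversed (O′ e) (M′.target e)) (sym (cong₂ _+_ (k≡k′ e) (r≡r′ e))) (cell-reversed (M′.cells e))))
    where
    module M = Mapped M
    module M′ = Mapped M′
    v w : Fin n → ℤ
    v f = M.circuits f + -1ℤ * M′.circuits f
    w f = M.cocircuits f + -1ℤ * M′.cocircuits f
    Kv : K v
    Kv = K-+ M.in-K (K-* -1ℤ M′.in-K)
    Rw : R w
    Rw = R-+ M.in-R (R-* -1ℤ M′.in-R)
    same-image : ∀ f → placed (M.circuits f) (M.cocircuits f) (M.basis f) ≡ placed (M′.circuits f) (M′.cocircuits f) (M′.basis f)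
    same-image f = trans (sym (M.image f)) (M′.image f)
    reverse-difference : ∀ x x′ → x′ + -1ℤ * x ≡ - (x + -1ℤ * x′)
    reverse-difference = solve-∀
    k≡k′ : ∀ f → M.circuits f ≡ M′.circuits f
    k≡k′ f = difference-0 (two-frames pair sig (Frame.nullK M.frame) (Frame.halfK M.frame) (Frame.nullK M′.frame) (Frame.halfK M′.frame) Kv
      (λ g Bg → circuit-difference-good {b′ = M′.basis g} (M.cells g) (M′.cells g)
        (trans (cong (placed (M.circuits g) (M.cocircuits g)) (sym Bg)) (same-image g)))
      (λ g Bg → ≤-resp (cong (_*_ (ε (M′.target g))) (reverse-difference (M.circuits g) (M′.circuits g)))
        (circuit-difference-good {b′ = M.basis g} (M′.cells g) (M.cells g)
          (trans (cong (placed (M′.circuits g) (M′.cocircuits g)) (sym Bg)) (sym (same-image g))))) f)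
    r≡r′ : ∀ f → M.cocircuits f ≡ M′.cocircuits f
    r≡r′ f = difference-0 (two-frames (dual pair) sig* (Frame.nullR M.frame) (Frame.halfR M.frame) (Frame.nullR M′.frame) (Frame.halfR M′.frame) Rw
      (λ g Bg → cocircuit-difference-good {b′ = M′.basis g} (M.cells g) (M′.cells g)
        (trans (cong (placed (M.circuits g) (M.cocircuits g)) (sym Bg)) (same-image g)))
      (λ g Bg → ≤-resp (cong (_*_ (ε (M′.target g))) (reverse-difference (M.cocircuits g) (M′.cocircuits g)))
        (cocircuit-difference-good {b′ = M.basis g} (M′.cells g) (M.cells g)
          (trans (cong (placed (M′.circuits g) (M′.cocircuits g)) (sym Bg)) (sym (same-image g))))) f)
    cell′ : ∀ f → Cell (O′ f) (M′.target f) (M.circuits f) (M.cocircuits f)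
    cell′ f = subst (λ x → Cell (O′ f) (M′.target f) x (M.cocircuits f)) (sym (k≡k′ f))
      (subst (Cell (O′ f) (M′.target f) (M′.circuits f)) (sym (r≡r′ f)) (M′.cells f))
    basis≡ : ∀ f → M.basis f ≡ M′.basis f
    basis≡ = basis-unique M.frame M′.frame λ f differ → same-entries⇒same-target {b = M.basis f} {M′.basis f} (M.cells f) (cell′ f)
      (trans (same-image f) (cong₂ (λ x y → placed x y (M′.basis f)) (sym (k≡k′ f)) (sym (r≡r′ f)))) differ
    fundamental′ : ∀ {S b f g} → Fundamental S M′.basis b f g → Fundamental S M.basis b f g
    fundamental′ (s , Ss , sf , off) = s , Ss , sf , λ h h≢f Bh → off h h≢f (trans (sym (basis≡ h)) Bh)
    target≡ : ∀ f → M.target f ≡ M′.target f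
    target≡ f with M.basis f in Bf
    ... | false = sym (half-frame-unique pair sig (Frame.nullK M.frame) (Frame.halfK M.frame) f Bf (M′.target f)
      (fundamental′ (Frame.halfK M′.frame f (trans (sym (basis≡ f)) Bf))))
    ... | true  = sym (half-frame-unique (dual pair) sig* (Frame.nullR M.frame) (Frame.halfR M.frame) f Bf (M′.target f)
      (fundamental′ (Frame.halfR M′.frame f (trans (sym (basis≡ f)) Bf))))

-- Effect of reversals on compatibility

module Restriction {n : ℕ} {K R S : (Fin n → ℤ) → Set} (pair : RegularPair K R) (sig : Signature K S) where
  open RegularPair pair
  open Signature sig

  -- Where `r` is reversed, a vector in `O` has weakly the sign opposite to `r`. So the circuit
  -- `- s` and `r` are disjoint by orthogonality, and `- s` already lies in `G`.
  reversing-preserves : ∀ {O G : Fin n → Bool} {r} → ¬ Opposed S (λ e → one (G e)) → R r → (∀ e → Reversed (O e) (G e) (r e)) →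
    ¬ Opposed S (λ e → one (O e))
  reversing-preserves {O} {G} {r} unopposed rr reversed (s , Ss , conf) = unopposed (s , Ss , good)
    where
    product : ∀ e → 0ℤ ≤ s e * r e
    product e with reversed e
    ... | fixed _ r≡0 = ≡⇒0≤ (trans (cong (_*_ (s e)) r≡0) (ℤP.*-zeroʳ (s e)))
    ... | flipped o≡ r≡ = ≤-resp (ε*ε-product (G e) (s e) (r e)) (*-nonneg
      (≤-resp (trans (cong (λ b → ε b * (- s e)) o≡) (ε-not-neg (G e) (s e))) (conf e))
      (reversed-nonneg (reversed e)))
    good : ∀ e → 0ℤ ≤ ε (G e) * (- s e)
    good e with reversed e | ℤP.i*j≡0⇒i≡0∨j≡0 (s e)
      (Minty.opposite-signs pair {s} {r} (Elementary.member (elementary Ss)) rr product e)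
    ... | fixed o≡ _   | _        = subst (λ b → 0ℤ ≤ ε b * (- s e)) o≡ (conf e)
    ... | flipped _ _  | inj₁ s≡0 = ≡⇒0≤ (ε*0 (G e) (cong -_ s≡0))
    ... | flipped _ r≡ | inj₂ r≡0 = ⊥-elim (ε≢0 (G e) (trans (sym r≡) r≡0))

  -- An elementary part `c` of `k` lies in `G` and its negative lies in `O`. The signature selects
  -- `c` or `- c`, so one of the two orientations would be opposed.
  unopposed⇒no-circuits : ∀ {O G : Fin n → Bool} {k} → ¬ Opposed S (λ e → one (G e)) → ¬ Opposed S (λ e → one (O e)) → K k →
    (∀ e → k e ≡ 0ℤ ⊎ (k e ≡ ε (G e) × O e ≡ not (G e))) → ∀ e → k e ≡ 0ℤ
  unopposed⇒no-circuits {O} {G} {k} unopp-G unopp-O kk at e = decidable-stable (k e ℤP.≟ 0ℤ) clash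
    where
    signed : ∀ f → IsSign (k f)
    signed f with at f
    ... | inj₁ k≡0 = inj₁ k≡0
    ... | inj₂ (k≡ , _) = subst IsSign (sym k≡) (ε-sign (G f))
    k-good : ∀ f → 0ℤ ≤ ε (G f) * k f
    k-good f with at f
    ... | inj₁ k≡0      = ≡⇒0≤ (ε*0 (G f) k≡0)
    ... | inj₂ (k≡ , _) = ≤-resp (sym (trans (cong (_*_ (ε (G f))) k≡) (ε*ε (G f)))) (+≤+ ℕ.z≤n)
    clash : k e ≢ 0ℤ → ⊥
    clash ke with Conformal.elementary-part pair signed kk e ke
    ... | c , ec , part , _ = orient (total ec)
      where
      in-G : ∀ f → 0ℤ ≤ ε (G f) * c f
      in-G f with part f
      ... | inj₁ c≡0 = ≡⇒0≤ (ε*0 (G f) c≡0)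
      ... | inj₂ c≡k = ≤-resp (cong (_*_ (ε (G f))) (sym c≡k)) (k-good f)
      opposite-in-O : ∀ f → 0ℤ ≤ ε (O f) * (- c f)
      opposite-in-O f with part f | at f
      ... | inj₁ c≡0 | _             = ≡⇒0≤ (ε*0 (O f) (cong -_ c≡0))
      ... | inj₂ c≡k | inj₁ k≡0      = ≡⇒0≤ (ε*0 (O f) (cong -_ (trans c≡k k≡0)))
      ... | inj₂ _   | inj₂ (_ , o≡) = ≤-resp (sym (trans (cong (λ b → ε b * (- c f)) o≡) (ε-not-neg (G f) (c f)))) (in-G f)
      orient : S c ⊎ S (neg c) → ⊥
      orient (inj₁ Sc) = unopp-O (c , Sc , opposite-in-O)
      orient (inj₂ Sc) = unopp-G (neg c , Sc , λ f → ≤-resp (cong (_*_ (ε (G f))) (sym (ℤP.neg-involutive (c f)))) (in-G f))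

-- Lists of disjoint signed vectors

agrees⇒entry : ∀ {x} o → IsSign x → (x ≡ 1ℤ → o ≡ true) × (x ≡ -1ℤ → o ≡ false) → x ≢ 0ℤ → x ≡ ε o
agrees⇒entry o (inj₁ x≡0)          _       x≢0 = ⊥-elim (x≢0 x≡0)
agrees⇒entry o (inj₂ (inj₁ refl)) (t , _) _   = cong ε (sym (t refl))
agrees⇒entry o (inj₂ (inj₂ refl)) (_ , f) _   = cong ε (sym (f refl))

isZero-≢ : ∀ x → x ≢ 0ℤ → isZero x ≡ false
isZero-≢ (+ zero)  x≢0 = ⊥-elim (x≢0 refl)
isZero-≢ +[1+ _ ]  _   = refl
isZero-≢ -[1+ _ ]  _   = refl

difference-lookup : ∀ {n} (p q : Subset n) e → lookup (p ─ q) e ≡ lookup p e ∧ not (lookup q e)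
difference-lookup (x ∷ p) (true ∷ q)  zero    = sym (BP.∧-zeroʳ x)
difference-lookup (x ∷ p) (false ∷ q) zero    = sym (BP.∧-identityʳ x)
difference-lookup (x ∷ p) (y ∷ q)     (suc e) = difference-lookup p q e

module Reversals {r n : ℕ} (A : Fin r → Fin n → ℤ) where
  open Matroid A using (reverse; reverseAll; unionSupp; Disjoint; InOri)

  total : List (Vec ℤ n) → Fin n → ℤ
  total []      e = 0ℤ
  total (v ∷ L) e = lookup v e + total L e

  AllZero AnyNonzero : Fin n → List (Vec ℤ n) → Set
  AllZero e    = All (λ v → lookup v e ≡ 0ℤ)
  AnyNonzero e = Any (λ v → lookup v e ≢ 0ℤ)

  allZero-or-anyNonzero : ∀ e L → AllZero e L ⊎ AnyNonzero e L
  allZero-or-anyNonzero e [] = inj₁ []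
  allZero-or-anyNonzero e (v ∷ L) with lookup v e ℤP.≟ 0ℤ | allZero-or-anyNonzero e L
  ... | no ve  | _       = inj₂ (here ve)
  ... | yes _  | inj₂ nz = inj₂ (there nz)
  ... | yes ve | inj₁ z  = inj₁ (ve ∷ z)

  disjoint-at : ∀ {u v e} → Disjoint u v → lookup u e ≢ 0ℤ → lookup v e ≡ 0ℤ
  disjoint-at {u} {v} {e} disjoint ue = decidable-stable (lookup v e ℤP.≟ 0ℤ) λ ve →
    SP.∉⊥ (subst (e ∈_) disjoint (SP.x∈p∩q⁺ (support-true u ue , support-true v ve)))

  disjoint-from-any : ∀ {v e L} → All (Disjoint v) L → AnyNonzero e L → lookup v e ≡ 0ℤ
  disjoint-from-any {v} {e} (d ∷ _) (here ue) = decidable-stable (lookup v e ℤP.≟ 0ℤ) λ ve → ue (disjoint-at d ve)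
  disjoint-from-any (_ ∷ ds) (there nz)      = disjoint-from-any ds nz

  nonzero-⊥ : ∀ {e L} → AllZero e L → AnyNonzero e L → ⊥
  nonzero-⊥ (z ∷ _)  (here nz)  = nz z
  nonzero-⊥ (_ ∷ zs) (there nz) = nonzero-⊥ zs nz

  reverse-zero : ∀ O v e → lookup v e ≡ 0ℤ → lookup (reverse O v) e ≡ lookup O e
  reverse-zero O v e ve = trans (VP.lookup-zipWith _ e O v)
    (cong (λ z → if z then lookup O e else not (lookup O e)) (cong isZero ve))

  reverse-nonzero : ∀ O v e → lookup v e ≢ 0ℤ → lookup (reverse O v) e ≡ not (lookup O e)
  reverse-nonzero O v e ve = trans (VP.lookup-zipWith _ e O v)
    (cong (λ z → if z then lookup O e else not (lookup O e)) (isZero-≢ (lookup v e) ve))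

  reverseAll-zero : ∀ O {e L} → AllZero e L → lookup (reverseAll O L) e ≡ lookup O e
  reverseAll-zero O []               = refl
  reverseAll-zero O {e} {v ∷ L} (ve ∷ zs) = trans (reverse-zero (reverseAll O L) v e ve) (reverseAll-zero O zs)

  reverseAll-nonzero : ∀ O {e L} → AllPairs Disjoint L → AnyNonzero e L → lookup (reverseAll O L) e ≡ not (lookup O e)
  reverseAll-nonzero O {e} {v ∷ L} (ds ∷ _) (here ve) = trans (reverse-nonzero (reverseAll O L) v e ve)
    (cong not (reverseAll-zero O (All.map (λ d → disjoint-at d ve) ds)))
  reverseAll-nonzero O {e} {v ∷ L} (ds ∷ pairs) (there nz) = trans (reverse-zero (reverseAll O L) v e (disjoint-from-any ds nz))
    (reverseAll-nonzero O pairs nz)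

  total-zero : ∀ {e L} → AllZero e L → total L e ≡ 0ℤ
  total-zero []        = refl
  total-zero (ve ∷ zs) = cong₂ _+_ ve (total-zero zs)

  total-nonzero : ∀ {e o L} → AllPairs Disjoint L → All (λ v → lookup v e ≢ 0ℤ → lookup v e ≡ ε o) L → AnyNonzero e L → total L e ≡ ε o
  total-nonzero {o = o} (ds ∷ _) (entry ∷ _) (here ve) =
    trans (cong₂ _+_ (entry ve) (total-zero (All.map (λ d → disjoint-at d ve) ds))) (ℤP.+-identityʳ (ε o))
  total-nonzero {o = o} (ds ∷ pairs) (_ ∷ entries) (there nz) =
    trans (cong₂ _+_ (disjoint-from-any ds nz) (total-nonzero pairs entries nz)) (ℤP.+-identityˡ (ε o))

  union-lookup : ∀ v L e → lookup (unionSupp (v ∷ L)) e ≡ not (isZero (lookup v e)) ∨ lookup (unionSupp L) e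
  union-lookup v L e = trans (VP.lookup-zipWith _∨_ e (support v) (unionSupp L))
    (cong (λ b → b ∨ lookup (unionSupp L) e) (support-lookup v e))

  union-zero : ∀ {e L} → AllZero e L → lookup (unionSupp L) e ≡ false
  union-zero {e} []                = VP.lookup-replicate e false
  union-zero {e} {v ∷ L} (ve ∷ zs) = trans (union-lookup v L e) (cong₂ (λ x b → not (isZero x) ∨ b) ve (union-zero zs))

  union-nonzero : ∀ {e L} → AnyNonzero e L → lookup (unionSupp L) e ≡ true
  union-nonzero {e} {v ∷ L} (here ve) = trans (union-lookup v L e)
    (cong (λ b → not b ∨ lookup (unionSupp L) e) (isZero-≢ (lookup v e) ve))
  union-nonzero {e} {v ∷ L} (there nz) = trans (union-lookup v L e)
    (trans (cong (_∨_ (not (isZero (lookup v e)))) (union-nonzero nz)) (BP.∨-zeroʳ _))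

  pairs-left : ∀ L {L′} → AllPairs Disjoint (L List.++ L′) → AllPairs Disjoint L
  pairs-left []      _            = []
  pairs-left (v ∷ L) (ds ∷ pairs) = AllP.++⁻ˡ L ds ∷ pairs-left L pairs

  pairs-right : ∀ L {L′} → AllPairs Disjoint (L List.++ L′) → AllPairs Disjoint L′
  pairs-right []      pairs        = pairs
  pairs-right (v ∷ L) (_ ∷ pairs)  = pairs-right L pairs

  pairs-cross : ∀ L {L′ e} → AllPairs Disjoint (L List.++ L′) → AnyNonzero e L → AllZero e L′
  pairs-cross (v ∷ L) (ds ∷ _)    (here ve)   = All.map (λ d → disjoint-at d ve) (AllP.++⁻ʳ L ds)
  pairs-cross (v ∷ L) (_ ∷ pairs) (there nz) = pairs-cross L pairs nz

  any-left : ∀ {e L L′} → AnyNonzero e L → AnyNonzero e (L List.++ L′)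
  any-left (here ve)   = here ve
  any-left (there nz) = there (any-left nz)

  any-right : ∀ {e} L {L′} → AnyNonzero e L′ → AnyNonzero e (L List.++ L′)
  any-right []      nz = nz
  any-right (v ∷ L) nz = there (any-right L nz)

  -- What remains of the two lists at one element. The `marks` say that the support of a sum is the
  -- union of the supports, which holds because disjoint vectors do not cancel.
  record Located (O G : Vec Bool n) (Ls Lc : List (Vec ℤ n)) (e : Fin n) : Set where
    field
      cell  : Cell (lookup O e) (lookup G e) (total Ls e) (total Lc e)
      marks : lookup (unionSupp Ls) e ≡ not (isZero (total Ls e))
      marks* : lookup (unionSupp Lc) e ≡ not (isZero (total Lc e))

  locate : ∀ {G} Ls Lc → All IsSignVec Ls → All IsSignVec Lc → All (λ v → InOri v G) (Ls List.++ Lc) →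
    AllPairs Disjoint (Ls List.++ Lc) → ∀ e → Located (reverseAll G (Ls List.++ Lc)) G Ls Lc e
  locate {G} Ls Lc sLs sLc inG pairs e with allZero-or-anyNonzero e Ls | allZero-or-anyNonzero e Lc
  ... | inj₁ z | inj₁ z* = record
    { cell   = kept (reverseAll-zero G (AllP.++⁺ z z*)) (total-zero z) (total-zero z*)
    ; marks  = trans (union-zero z) (cong (λ x → not (isZero x)) (sym (total-zero z)))
    ; marks* = trans (union-zero z*) (cong (λ x → not (isZero x)) (sym (total-zero z*))) }
  ... | inj₂ nz | inj₂ nz* = ⊥-elim (nonzero-⊥ (pairs-cross Ls pairs nz) nz*)
  ... | inj₂ nz | inj₁ z* = record
    { cell   = circ (reverseAll-nonzero G pairs (any-left nz)) total≡ (total-zero z*)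
    ; marks  = trans (union-nonzero nz) (sym (trans (cong (λ x → not (isZero x)) total≡) (cong not (isZero-ε (lookup G e)))))
    ; marks* = trans (union-zero z*) (cong (λ x → not (isZero x)) (sym (total-zero z*))) }
    where
    total≡ : total Ls e ≡ ε (lookup G e)
    total≡ = total-nonzero (pairs-left Ls pairs)
      (All.zipWith (λ (signed , agree) → agrees⇒entry (lookup G e) (signed e) (agree e)) (sLs , AllP.++⁻ˡ Ls inG)) nz
  ... | inj₁ z | inj₂ nz* = record
    { cell   = cocirc (reverseAll-nonzero G pairs (any-right Ls nz*)) (total-zero z) total≡
    ; marks  = trans (union-zero z) (cong (λ x → not (isZero x)) (sym (total-zero z)))
    ; marks* = trans (union-nonzero nz*) (sym (trans (cong (λ x → not (isZero x)) total≡) (cong not (isZero-ε (lookup G e))))) }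
    where
    total≡ : total Lc e ≡ ε (lookup G e)
    total≡ = total-nonzero (pairs-right Ls pairs)
      (All.zipWith (λ (signed , agree) → agrees⇒entry (lookup G e) (signed e) (agree e)) (sLc , AllP.++⁻ʳ Ls inG)) nz*

  total-member : ∀ {K R : (Fin n → ℤ) → Set} → RegularPair K R → ∀ {L} → All (λ v → K (lookup v)) L → K (total L)
  total-member pair []        = RegularPair.K-0 pair
  total-member pair (kv ∷ ks) = RegularPair.K-+ pair kv (total-member pair ks)

  image-lookup : ∀ {O G Ls Lc e} B → Located O G Ls Lc e →
    lookup ((B ∪ unionSupp Ls) ─ unionSupp Lc) e ≡ placed (total Ls e) (total Lc e) (lookup B e)
  image-lookup {Ls = Ls} {Lc} {e} B located = trans (difference-lookup (B ∪ unionSupp Ls) (unionSupp Lc) e)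
    (cong₂ (λ a b → a ∧ not b)
      (trans (VP.lookup-zipWith _∨_ e B (unionSupp Ls)) (cong (_∨_ (lookup B e)) (Located.marks located)))
      (Located.marks* located))

  located-eq : ∀ {O O′ G Ls Lc e} → O ≡ O′ → Located O G Ls Lc e → Located O′ G Ls Lc e
  located-eq refl located = located

-- The bijection

funToFin-cong : ∀ {m k} {f g : Fin m → Fin k} → (∀ i → f i ≡ g i) → funToFin f ≡ funToFin g
funToFin-cong {zero}  h = refl
funToFin-cong {suc m} h = cong₂ combine (h zero) (funToFin-cong (λ i → h (suc i)))

encode-injective : ∀ {n} {O O′ : Fin n → Bool} → encode O ≡ encode O′ → ∀ e → O e ≡ O′ e
encode-injective {n} {O} {O′} eq e =
  trans (sym (decode-encode O e)) (trans (cong (λ i → decode {n} i e) eq) (decode-encode O′ e))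

encode-decode : ∀ {n} i → encode (decode {n} i) ≡ i
encode-decode {n} i = trans
  (funToFin-cong {n} {2} {g = finToFun {2} {n} i} λ e → Inverse.strictlyInverseʳ FP.2↔Bool (finToFun {2} {n} i e))
  (FP.funToFin-finToFin {n} {2} i)

encode-cong : ∀ {n} {O O′ : Fin n → Bool} → (∀ e → O e ≡ O′ e) → encode O ≡ encode O′
encode-cong h = funToFin-cong λ e → cong (Inverse.from FP.2↔Bool) (h e)

-- Pigeonhole: prepending the code of a missed subset to the codes of the images would inject
-- `2 ^ n + 1` indices into `2 ^ n` codes.
injective⇒surjective : ∀ {n} (f : Subset n → Subset n) → (∀ {p q} → f p ≡ f q → p ≡ q) → ∀ q → Σ (Subset n) λ p → f p ≡ q
injective⇒surjective {n} f inj q with SP.anySubset? (λ p → VP.≡-dec BP._≟_ (f p) q)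
... | yes found = found
... | no missed = ⊥-elim (ℕP.<⇒≱ (ℕP.n<1+n (2 ℕ.^ n)) (FP.injective⇒≤ {f = cons (encode (lookup q)) image} (cons-injective fresh image-injective)))
  where
  subset : Fin (2 ℕ.^ n) → Subset n
  subset i = tabulate (decode {n} i)
  image : Fin (2 ℕ.^ n) → Fin (2 ℕ.^ n)
  image i = encode {n} (lookup (f (subset i)))
  fresh : ∀ i → encode (lookup q) ≢ image i
  fresh i eq = missed (subset i , vec-ext λ e → sym (encode-injective {n} eq e))
  image-injective : Injective _≡_ _≡_ image
  image-injective {i} {j} eq = trans (sym (encode-decode {n} i)) (trans (encode-cong same) (encode-decode {n} j))
    where
    same : ∀ e → decode {n} i e ≡ decode {n} j e
    same e = trans (sym (VP.lookup∘tabulate (decode {n} i) e))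
      (trans (cong (λ p → lookup p e) (inj (vec-ext (encode-injective {n} eq)))) (VP.lookup∘tabulate (decode {n} j) e))

module Orientations {r n : ℕ} (A : Fin r → Fin n → ℤ) (tu : TotallyUnimodular A)
  (σ σ* : Subset n → Vec ℤ n)
  (σ-signature : Matroid.CircuitSignature A σ) (σ-acyclic : Matroid.Acyclic A σ)
  (σ*-signature : Matroid.CocircuitSignature A σ*) (σ*-acyclic : Matroid.CoAcyclic A σ*) where
  open Matroid A
  open Matroid.Signatures A σ σ*
  open Reversals A

  pair : RegularPair (Kernel A) (RowSpan A)
  pair = regularPair A tu

  module Sᴷ = Signed A pair σ σ-signature σ-acyclic
  module Sᴿ = Signed A (dual pair) σ* σ*-signature σ*-acyclic
  module Bᴷ = SignedBases A pair σ σ-signature σ-acyclic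
  module Bᴿ = SignedBases A (dual pair) σ* σ*-signature σ*-acyclic
  open Frames pair Sᴷ.signature Sᴿ.signature
  open Mapping pair Sᴷ.signature Sᴿ.signature
  open RegularPair pair

  lookup-∁ : ∀ (B : Subset n) e → lookup (∁ B) e ≡ not (lookup B e)
  lookup-∁ B e = VP.lookup-map e not B

  isG⇒frame : ∀ {B O} → Basis B → IsG B O → Frame (lookup B) (lookup O)
  isG⇒frame {B} {O} basis isG = record
    { nullK = nullK ; nullR = nullR
    ; halfK = Bᴷ.agreement⇒half-frame {B} {B} {false} {O} (λ f Df → Df) nullR (λ e Be C → proj₁ (isG e) (false⇒∉ Be) C)
    ; halfR = Bᴿ.agreement⇒half-frame {B} {∁ B} {true} {O}
        (λ f Df → trans (sym (BP.not-involutive _)) (cong not (trans (sym (lookup-∁ B f)) Df))) nullK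
        (λ e Be C → proj₂ (isG e) (true⇒∈ Be) C)
    }
    where
    nullK : Null (Kernel A) (lookup B) false
    nullK = Bases.maximal⇒null pair basis
    nullR : Null (RowSpan A) (lookup B) true
    nullR = Bases.maximal⇒null* pair basis

  frame⇒basis : ∀ {B O} → Frame (lookup B) (lookup O) → Basis B
  frame⇒basis F = Bases.null⇒maximal pair (Frame.nullK F) (Frame.nullR F)

  frame⇒isG : ∀ {B O} → Frame (lookup B) (lookup O) → IsG B O
  frame⇒isG {B} {O} F e =
    (λ e∉B C → Bᴷ.half-frame⇒agreement {B} {B} {false} {O} (λ f Bf → Bf) (Frame.nullK F) (Frame.halfK F) e (∉⇒false e∉B) C) ,
    (λ e∈B C → Bᴿ.half-frame⇒agreement {B} {∁ B} {true} {O} (λ f Bf → trans (lookup-∁ B f) (cong not Bf))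
      (Frame.nullR F) (Frame.halfR F) e (∈⇒true e∈B) C)

  frame-tabulate : ∀ {B G O} → Frame B G → (∀ e → G e ≡ O e) → Frame (lookup (tabulate B)) (lookup (tabulate O))
  frame-tabulate {B} {G} {O} F G≡O = record
    { nullK = λ v kv off → nullK v kv λ e Be → off e (trans (B-at e) Be)
    ; nullR = λ w rw off → nullR w rw λ e Be → off e (trans (B-at e) Be)
    ; halfK = λ e Be → fundamental e (halfK e (trans (sym (B-at e)) Be))
    ; halfR = λ e Be → fundamental e (halfR e (trans (sym (B-at e)) Be)) }
    where
    open Frame F
    B-at : ∀ e → lookup (tabulate B) e ≡ B e
    B-at = VP.lookup∘tabulate B
    fundamental : ∀ {S b} e → Fundamental S B b e (G e) → Fundamental S (lookup (tabulate B)) b e (lookup (tabulate O) e)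
    fundamental e (s , Ss , se , off) = s , Ss , trans se (cong ε (trans (G≡O e) (sym (VP.lookup∘tabulate O e))))
      , λ f f≢e Bf → off f f≢e (trans (sym (B-at f)) Bf)

  located : ∀ {O Ocp Ls Lc} → Decomposition O Ocp Ls Lc → ∀ e → Located O Ocp Ls Lc e
  located {Ls = Ls} {Lc} (_ , circuits , cocircuits , inOcp , pairs , O≡) e =
    located-eq (sym O≡) (locate Ls Lc (All.map proj₁ circuits) (All.map proj₁ cocircuits) inOcp pairs e)

  mapped : ∀ {O X} → Phi O X → Mapped (lookup O) (lookup X)
  mapped {O} {X} (B , Ocp , Ls , Lc , decomposition@(_ , circuits , cocircuits , _) , basis , isG , X≡) = record
    { basis = lookup B ; target = lookup Ocp ; circuits = total Ls ; cocircuits = total Lc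
    ; frame = isG⇒frame {B} {Ocp} basis isG
    ; in-K = total-member pair (All.map (λ c → proj₁ (proj₂ c)) circuits)
    ; in-R = total-member (dual pair) (All.map (λ c → proj₁ (proj₂ c)) cocircuits)
    ; cells = λ e → Located.cell (located decomposition e)
    ; image = λ e → trans (cong (λ Y → lookup Y e) X≡) (image-lookup B (located decomposition e))
    }

  apart⇒disjoint : ∀ {c d : Fin n → ℤ} → (∀ e → c e ≡ 0ℤ ⊎ d e ≡ 0ℤ) → Disjoint (tabulate c) (tabulate d)
  apart⇒disjoint {c} {d} apart = SP.Empty-unique λ (e , e∈) → clash e (SP.x∈p∩q⁻ (support (tabulate c)) (support (tabulate d)) e∈)
    where
    clash : ∀ e → e ∈ support (tabulate c) × e ∈ support (tabulate d) → ⊥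
    clash e (e∈c , e∈d) with apart e
    ... | inj₁ c≡0 = ∈support (tabulate c) e∈c (trans (VP.lookup∘tabulate c e) c≡0)
    ... | inj₂ d≡0 = ∈support (tabulate d) e∈d (trans (VP.lookup∘tabulate d e) d≡0)

  part-in : ∀ {O : Fin n → Bool} {k c : Fin n → ℤ} → (∀ e → 0ℤ ≤ ε (O e) * k e) → (∀ e → c e ≡ 0ℤ ⊎ c e ≡ k e) →
    InOri (tabulate c) (tabulate O)
  part-in {O} {k} {c} good part e = ≤⇒agrees (lookup (tabulate O) e)
    (≤-resp (cong₂ (λ o x → ε o * x) (sym (VP.lookup∘tabulate O e)) (sym (VP.lookup∘tabulate c e))) (c-good (part e)))
    where
    c-good : c e ≡ 0ℤ ⊎ c e ≡ k e → 0ℤ ≤ ε (O e) * c e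
    c-good (inj₁ c≡0) = ≡⇒0≤ (ε*0 (O e) c≡0)
    c-good (inj₂ c≡k) = ≤-resp (cong (_*_ (ε (O e))) (sym c≡k)) (good e)

  module Realization {O} (resolved : Resolution.Resolved pair Sᴷ.signature Sᴿ.signature (lookup O))
    (partsᴷ : Conformal.Parts pair (Resolution.Resolved.circuits resolved))
    (partsᴿ : Conformal.Parts (dual pair) (Resolution.Resolved.cocircuits resolved)) where
    open Resolution.Resolved resolved
    private
      module Pᴷ = Conformal.Parts partsᴷ
      module Pᴿ = Conformal.Parts partsᴿ
    Ocp : Orientation
    Ocp = tabulate target
    Ls Lc : List (Vec ℤ n)
    Ls = List.map tabulate Pᴷ.list
    Lc = List.map tabulate Pᴿ.list
    target-at : ∀ e → lookup Ocp e ≡ target e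
    target-at = VP.lookup∘tabulate target
    compatible : Compatible Ocp
    compatible =
      Bᴷ.unopposed⇒compatible {Ocp} (λ (s , Ss , conf) →
        unopposed (s , Ss , λ e → subst (λ o → 0ℤ ≤ ε o * (- s e)) (target-at e) (conf e))) ,
      Bᴿ.unopposed⇒compatible {Ocp} (λ (s , Ss , conf) →
        unopposed* (s , Ss , λ e → subst (λ o → 0ℤ ≤ ε o * (- s e)) (target-at e) (conf e)))
    signed : All SignedCircuit Ls
    signed = AllP.map⁺ (All.map (λ {c} ec → Circuits.elementary⇒signed pair (tabulate c)
      (Sᴷ.elementary-cong (λ e → sym (VP.lookup∘tabulate c e)) ec)) Pᴷ.elementary)
    signed* : All SignedCocircuit Lc
    signed* = AllP.map⁺ (All.map (λ {c} ec → Circuits.elementary⇒signed (dual pair) (tabulate c)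
      (Sᴿ.elementary-cong (λ e → sym (VP.lookup∘tabulate c e)) ec)) Pᴿ.elementary)
    in-Ocp : All (λ v → InOri v Ocp) (Ls List.++ Lc)
    in-Ocp = AllP.++⁺ (AllP.map⁺ (All.map (λ {c} → part-in {target} {circuits} {c} (λ e → proj₁ (cell-nonneg (cells e)))) Pᴷ.parts))
                      (AllP.map⁺ (All.map (λ {c} → part-in {target} {cocircuits} {c} (λ e → proj₂ (cell-nonneg (cells e)))) Pᴿ.parts))
    cross : ∀ {c d : Fin n → ℤ} → (∀ e → c e ≡ 0ℤ ⊎ c e ≡ circuits e) → (∀ e → d e ≡ 0ℤ ⊎ d e ≡ cocircuits e) → ∀ e → c e ≡ 0ℤ ⊎ d e ≡ 0ℤ
    cross pc pd e with pc e | pd e | ℤP.i*j≡0⇒i≡0∨j≡0 (circuits e) (cell-product (cells e))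
    ... | inj₁ c≡0 | _        | _        = inj₁ c≡0
    ... | _        | inj₁ d≡0 | _        = inj₂ d≡0
    ... | inj₂ c≡k | inj₂ _   | inj₁ k≡0 = inj₁ (trans c≡k k≡0)
    ... | inj₂ _   | inj₂ d≡r | inj₂ r≡0 = inj₂ (trans d≡r r≡0)
    pairs : AllPairs Disjoint (Ls List.++ Lc)
    pairs = AllPairsP.++⁺ (AllPairsP.map⁺ (AllPairs.map (λ {c} {d} → apart⇒disjoint {c} {d}) Pᴷ.apart)) (AllPairsP.map⁺ (AllPairs.map (λ {c} {d} → apart⇒disjoint {c} {d}) Pᴿ.apart))
      (AllP.map⁺ (All.map (λ {c} pc → AllP.map⁺ (All.map (λ {d} pd → apart⇒disjoint {c} {d} (cross {c} {d} pc pd)) Pᴿ.parts)) Pᴷ.parts))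
    all-zero : ∀ {k : Fin n → ℤ} {e l} → k e ≡ 0ℤ → All (λ c → ∀ f → c f ≡ 0ℤ ⊎ c f ≡ k f) l → AllZero e (List.map tabulate l)
    all-zero {k} {e} ke parts = AllP.map⁺ (All.map (λ {c} part → trans (VP.lookup∘tabulate c e) (zero-at (part e))) parts)
      where
      zero-at : ∀ {x} → x ≡ 0ℤ ⊎ x ≡ k e → x ≡ 0ℤ
      zero-at (inj₁ x≡0) = x≡0
      zero-at (inj₂ x≡k) = trans x≡k ke
    any-nonzero : ∀ {e} {l : List (Fin n → ℤ)} → Any (λ c → c e ≢ 0ℤ) l → AnyNonzero e (List.map tabulate l)
    any-nonzero {e} nz = AnyP.map⁺ (Any.map (λ {c} ce eq → ce (trans (sym (VP.lookup∘tabulate c e)) eq)) nz)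
    reversed : ∀ e → lookup O e ≡ lookup (reverseAll Ocp (Ls List.++ Lc)) e
    reversed e with cells e
    ... | kept o≡ k≡0 r≡0 = trans o≡ (sym (trans (reverseAll-zero Ocp (AllP.++⁺ (all-zero {circuits} k≡0 Pᴷ.parts) (all-zero {cocircuits} r≡0 Pᴿ.parts))) (target-at e)))
    ... | circ o≡ k≡ _ = trans o≡ (sym (trans (reverseAll-nonzero Ocp pairs (any-left (any-nonzero
      (Pᴷ.covering e λ k≡0 → ε≢0 (target e) (trans (sym k≡) k≡0))))) (cong not (target-at e))))
    ... | cocirc o≡ _ r≡ = trans o≡ (sym (trans (reverseAll-nonzero Ocp pairs (any-right Ls (any-nonzero
      (Pᴿ.covering e λ r≡0 → ε≢0 (target e) (trans (sym r≡) r≡0))))) (cong not (target-at e))))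
    decomposition : Decomposition O Ocp Ls Lc
    decomposition = compatible , signed , signed* , in-Ocp , pairs , vec-ext reversed

    realize : ∀ {B G} → Frame B G → (∀ e → G e ≡ target e) → Σ (Subset n) (Phi O)
    realize {B} F G≡target = (tabulate B ∪ unionSupp Ls) ─ unionSupp Lc
      , tabulate B , Ocp , Ls , Lc , decomposition , frame⇒basis {tabulate B} {Ocp} frame , frame⇒isG {tabulate B} {Ocp} frame , refl
      where
      frame : Frame (lookup (tabulate B)) (lookup Ocp)
      frame = frame-tabulate F G≡target

  abstract
    phi-exists : ∀ O → Σ (Subset n) (Phi O)
    phi-exists O = assemble (Resolution.resolve pair Sᴷ.signature Sᴿ.signature (lookup O))
      where
      assemble : Resolution.Resolved pair Sᴷ.signature Sᴿ.signature (lookup O) → Σ (Subset n) (Phi O)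
      assemble resolved = let (_ , _ , F , G≡target) = Compatible.compatible⇒frame pair Sᴷ.signature Sᴿ.signature target unopposed unopposed*
        in Realization.realize resolved (Conformal.decompose pair (λ e → proj₁ (cell-sign (cells e))) in-K)
             (Conformal.decompose (dual pair) (λ e → proj₂ (cell-sign (cells e))) in-R) F G≡target
        where open Resolution.Resolved resolved

  phi : Orientation → Subset n
  phi O = proj₁ (phi-exists O)

  phi-functional : ∀ O X X′ → Phi O X → Phi O X′ → X ≡ X′
  phi-functional O X X′ P P′ = vec-ext (functional (mapped {O} {X} P) (mapped {O} {X′} P′))

  phi-injective : ∀ O O′ X → Phi O X → Phi O′ X → O ≡ O′
  phi-injective O O′ X P P′ = vec-ext (injective (mapped {O} {X} P) (mapped {O′} {X} P′))

  phi-holds : ∀ {O X} → phi O ≡ X → Phi O X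
  phi-holds {O} refl = proj₂ (phi-exists O)

  phi-total : ∀ O → Σ (Subset n) λ X → Phi O X × (∀ X′ → Phi O X′ → X′ ≡ X)
  phi-total O = phi O , phi-holds {O} refl , λ X P → phi-functional O X (phi O) P (phi-holds {O} refl)

  phi-one-to-one : ∀ {O O′} → phi O ≡ phi O′ → O ≡ O′
  phi-one-to-one {O} {O′} eq = phi-injective O O′ (phi O′) (phi-holds {O} eq) (phi-holds {O′} refl)

  phi-preimage : ∀ X O → phi O ≡ X → Σ Orientation λ O → Phi O X × (∀ O′ → Phi O′ X → O′ ≡ O)
  phi-preimage X O eq = O , phi-holds {O} eq , λ O′ P′ → phi-injective O′ O X P′ (phi-holds {O} eq)

  phi-onto : ∀ X → Σ Orientation λ O → Phi O X × (∀ O′ → Phi O′ X → O′ ≡ O)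
  phi-onto X = phi-preimage X (proj₁ preimage) (proj₂ preimage)
    where
    preimage : Σ Orientation λ O → phi O ≡ X
    preimage = injective⇒surjective phi phi-one-to-one X

  phi-bijection : IsBijectionRel Phi
  phi-bijection = phi-total , phi-onto

  module _ {O Ocp Ls Lc} (decomposition : Decomposition O Ocp Ls Lc) where
    private
      cell : ∀ e → Cell (lookup O e) (lookup Ocp e) (total Ls e) (total Lc e)
      cell e = Located.cell (located decomposition e)
      in-K : Kernel A (total Ls)
      in-K = total-member pair (All.map (λ c → proj₁ (proj₂ c)) (proj₁ (proj₂ decomposition)))
      in-R : RowSpan A (total Lc)
      in-R = total-member (dual pair) (All.map (λ c → proj₁ (proj₂ c)) (proj₁ (proj₂ (proj₂ decomposition))))
      unopposed : ¬ Opposed Sᴷ.Selected (λ e → one (lookup Ocp e))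
      unopposed = Bᴷ.compatible⇒unopposed {Ocp} (proj₁ (proj₁ decomposition))
      unopposed* : ¬ Opposed Sᴿ.Selected (λ e → one (lookup Ocp e))
      unopposed* = Bᴿ.compatible⇒unopposed {Ocp} (proj₂ (proj₁ decomposition))

    compatible⇒no-circuits : SigmaCompatible O → ∀ e → total Ls e ≡ 0ℤ
    compatible⇒no-circuits compatible = Restriction.unopposed⇒no-circuits pair Sᴷ.signature {lookup O} {lookup Ocp} unopposed
      (Bᴷ.compatible⇒unopposed {O} compatible) in-K at
      where
      at : ∀ e → total Ls e ≡ 0ℤ ⊎ (total Ls e ≡ ε (lookup Ocp e) × lookup O e ≡ not (lookup Ocp e))
      at e with cell e
      ... | kept _ k≡0 _   = inj₁ k≡0
      ... | circ o≡ k≡ _   = inj₂ (k≡ , o≡)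
      ... | cocirc _ k≡0 _ = inj₁ k≡0

    no-circuits⇒compatible : (∀ e → total Ls e ≡ 0ℤ) → SigmaCompatible O
    no-circuits⇒compatible k≡0 = Bᴷ.unopposed⇒compatible {O} (Restriction.reversing-preserves pair Sᴷ.signature
      {lookup O} {lookup Ocp} unopposed in-R λ e → subst (Reversed (lookup O e) (lookup Ocp e))
        (trans (cong (λ x → x + total Lc e) (k≡0 e)) (ℤP.+-identityˡ (total Lc e))) (cell-reversed (cell e)))

    compatible*⇒no-cocircuits : SigmaStarCompatible O → ∀ e → total Lc e ≡ 0ℤ
    compatible*⇒no-cocircuits compatible = Restriction.unopposed⇒no-circuits (dual pair) Sᴿ.signature {lookup O} {lookup Ocp} unopposed*
      (Bᴿ.compatible⇒unopposed {O} compatible) in-R at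
      where
      at : ∀ e → total Lc e ≡ 0ℤ ⊎ (total Lc e ≡ ε (lookup Ocp e) × lookup O e ≡ not (lookup Ocp e))
      at e with cell e
      ... | kept _ _ r≡0   = inj₁ r≡0
      ... | circ _ _ r≡0   = inj₁ r≡0
      ... | cocirc o≡ _ r≡ = inj₂ (r≡ , o≡)

    no-cocircuits⇒compatible* : (∀ e → total Lc e ≡ 0ℤ) → SigmaStarCompatible O
    no-cocircuits⇒compatible* r≡0 = Bᴿ.unopposed⇒compatible {O} (Restriction.reversing-preserves (dual pair) Sᴿ.signature
      {lookup O} {lookup Ocp} unopposed* in-K λ e → subst (Reversed (lookup O e) (lookup Ocp e))
        (trans (cong (_+_ (total Ls e)) (r≡0 e)) (ℤP.+-identityʳ (total Ls e))) (cell-reversed (cell e)))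

    image-without-circuits : ∀ B → SigmaCompatible O → (B ∪ unionSupp Ls) ─ unionSupp Lc ≡ B ─ unionSupp Lc
    image-without-circuits B compatible = vec-ext λ e → trans (difference-lookup (B ∪ unionSupp Ls) (unionSupp Lc) e) (trans
      (cong (_∧ not (lookup (unionSupp Lc) e)) (trans (VP.lookup-zipWith _∨_ e B (unionSupp Ls))
        (trans (cong (_∨_ (lookup B e)) (trans (Located.marks (located decomposition e))
          (cong (λ x → not (isZero x)) (compatible⇒no-circuits compatible e)))) (BP.∨-identityʳ (lookup B e)))))
      (sym (difference-lookup B (unionSupp Lc) e)))

    image-without-cocircuits : ∀ B → SigmaStarCompatible O → (B ∪ unionSupp Ls) ─ unionSupp Lc ≡ B ∪ unionSupp Ls
    image-without-cocircuits B compatible = vec-ext λ e → trans (difference-lookup (B ∪ unionSupp Ls) (unionSupp Lc) e) (trans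
      (cong (λ b → lookup (B ∪ unionSupp Ls) e ∧ not b) (trans (Located.marks* (located decomposition e))
        (cong (λ x → not (isZero x)) (compatible*⇒no-cocircuits compatible e))))
      (BP.∧-identityʳ (lookup (B ∪ unionSupp Ls) e)))

  -- Reversed circuits stay inside `X`, as cocircuits remove only elements disjoint from them; so
  -- `circuits` is a kernel vector supported in `X`, and independence kills it. Without circuits,
  -- `X` is contained in the basis.
  compatible⇔independent : ∀ O X → Phi O X → SigmaCompatible O ⇔ Independent X
  compatible⇔independent O X P@(B , Ocp , Ls , Lc , decomposition , _) = mk⇔
    (λ compatible → null⇒independent {B = X} {b = false} (λ f Xf → Xf) (null (compatible⇒no-circuits decomposition compatible)))
    (λ independent → no-circuits⇒compatible decomposition
      (independent⇒null {B = X} {D = X} {b = false} K-cong (λ f Xf → Xf) independent circuits in-K zero-off-X))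
    where
    open Mapped (mapped {O} {X} P)
    null : (∀ e → circuits e ≡ 0ℤ) → Null (Kernel A) (lookup X) false
    null k≡0 v kv off = Frame.nullK frame v kv λ e Be → off e (trans (image e) (trans (cong (placed _ _) Be) (outside e)))
      where
      outside : ∀ e → placed (circuits e) (cocircuits e) false ≡ false
      outside e = cong (λ x → not (isZero x) ∧ not (not (isZero (cocircuits e)))) (k≡0 e)
    zero-off-X : ∀ e → lookup X e ≡ false → circuits e ≡ 0ℤ
    zero-off-X e Xe with cells e
    ... | kept _ k≡0 _   = k≡0
    ... | cocirc _ k≡0 _ = k≡0
    ... | circ _ k≡ r≡0  = ⊥-elim (false≢true Xe (trans (image e) (placed-circ (basis e) k≡ r≡0)))

  -- Reversed cocircuits miss `X`, so `cocircuits` vanishes on any basis inside `X` and is therefore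
  -- zero. Without cocircuits, `X` contains the basis `B`.
  compatible*⇔spanning : ∀ O X → Phi O X → SigmaStarCompatible O ⇔ Spanning X
  compatible*⇔spanning O X P@(B , Ocp , Ls , Lc , decomposition , basis , _) = mk⇔
    (λ compatible → B , basis , λ {e} e∈B → true⇒∈ (trans (image e) (inside e (compatible*⇒no-cocircuits decomposition compatible) (∈⇒true e∈B))))
    (λ (B′ , basis′ , B′⊆X) → no-cocircuits⇒compatible* decomposition
      (Bases.maximal⇒null* pair basis′ cocircuits in-R λ e B′e → zero-on-X e (∈⇒true (B′⊆X (true⇒∈ B′e)))))
    where
    open Mapped (mapped {O} {X} P) hiding (basis)
    inside : ∀ e → (∀ e → cocircuits e ≡ 0ℤ) → lookup B e ≡ true → placed (circuits e) (cocircuits e) (lookup B e) ≡ true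
    inside e r≡0 Be = cong₂ (λ b y → (b ∨ not (isZero (circuits e))) ∧ not (not (isZero y))) Be (r≡0 e)
    zero-on-X : ∀ e → lookup X e ≡ true → cocircuits e ≡ 0ℤ
    zero-on-X e Xe with cells e
    ... | kept _ _ r≡0  = r≡0
    ... | circ _ _ r≡0  = r≡0
    ... | cocirc _ _ r≡ = ⊥-elim (false≢true (trans (image e) (placed-cocirc {circuits e} (lookup B e) r≡)) Xe)

theorem5p2 : ∀ {r n : ℕ} (A : Fin r → Fin n → ℤ) →
    TotallyUnimodular A → FullRowRank A →
    (σ σ* : Subset n → Vec ℤ n) →
    Matroid.CircuitSignature A σ → Matroid.Acyclic A σ →
    Matroid.CocircuitSignature A σ* → Matroid.CoAcyclic A σ* →
    IsBijectionRel (Matroid.Signatures.Phi A σ σ*) ×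
    ((∀ O X → Matroid.Signatures.Phi A σ σ* O X →
    (Matroid.Signatures.SigmaCompatible A σ σ* O ⇔ Matroid.Independent A X)) ×
    (∀ O B Ocp Ls Lc → Matroid.Signatures.Decomposition A σ σ* O Ocp Ls Lc →
    Matroid.Basis A B → Matroid.Signatures.IsG A σ σ* B Ocp →
    Matroid.Signatures.SigmaCompatible A σ σ* O →
    ((B ∪ Matroid.unionSupp A Ls) ─ Matroid.unionSupp A Lc) ≡ (B ─ Matroid.unionSupp A Lc))) ×
    ((∀ O X → Matroid.Signatures.Phi A σ σ* O X →
    (Matroid.Signatures.SigmaStarCompatible A σ σ* O ⇔ Matroid.Spanning A X)) ×
    (∀ O B Ocp Ls Lc → Matroid.Signatures.Decomposition A σ σ* O Ocp Ls Lc →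
    Matroid.Basis A B → Matroid.Signatures.IsG A σ σ* B Ocp →
    Matroid.Signatures.SigmaStarCompatible A σ σ* O →
    ((B ∪ Matroid.unionSupp A Ls) ─ Matroid.unionSupp A Lc) ≡ (B ∪ Matroid.unionSupp A Ls)))
theorem5p2 A tu _ σ σ* σ-signature σ-acyclic σ*-signature σ*-acyclic =
  phi-bijection
  , (compatible⇔independent , λ O B Ocp Ls Lc decomposition _ _ → image-without-circuits decomposition B)
  , (compatible*⇔spanning , λ O B Ocp Ls Lc decomposition _ _ → image-without-cocircuits decomposition B)
  where open Orientations A tu σ σ* σ-signature σ-acyclic σ*-signature σ*-acyclic
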